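{- Let $b\ge 2$ be an integer. Then, as $x\to\infty$, \[\sum_{n\leq x}\frac{H_b(n)}{n}= C_b \log x +O_b(1),\] where \[C_b=\frac{1}{\zeta(b)}\prod_p\left[1+(p^{b+1}-1)\sum_{k=1}^{\infty}\frac{p^k}{p^{k(b+1)}(p^{b+1}-p)+p-1}\right],\] the product running over all primes $p$.
   Context: For an integer $b\ge 2$ and positive integers $m,n$, the generalized gcd is $(m,n)_b:=\max\{d\ge 1: d^b\mid m \text{ and } d^b\mid n\}$. The harmonic mean of the generalized gcd function is $H_b(n):=n\left(\sum_{1\le j\le n}\frac{1}{(j,n)_b}\right)^{ -1}$. Here $\zeta$ is the Riemann zeta function, $x$ is a real variable, sums over $n\le x$ run over positive integers $n$, and $O_b$ means that the implied constant may depend on $b$. -}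

module Defs where

open import Data.Bool.Base using (if_then_else_)
open import Data.Integer.Base as ℤ using (+_; +0; +[1+_]; -[1+_])
import Data.Integer.Properties as ℤ
open import Data.List.Base using (List; foldr; filter; applyUpTo)
open import Data.Nat.Base as ℕ using (ℕ; zero; suc)
import Data.Nat.Properties as ℕ
open import Data.Nat.Divisibility using (_∣?_)
open import Data.Nat.Primality using (prime?)
open import Data.Product.Base using (∃; _×_; _,_)
open import Data.Rational.Base
open import Data.Rational.Properties
import Data.Rational.Unnormalised.Base as U
import Data.Rational.Unnormalised.Properties as ℚᵘ
open import Data.Rational.Solver using (module +-*-Solver)
open import Data.Sum.Base using (inj₁; inj₂)
open import Relation.Binary.PropositionalEquality
open import Relation.Nullary.Decidable using (does; _×-dec_)

open +-*-Solver using (solve; _:=_; _:+_; _:*_; _:-_; :-_; con)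

ι : ℕ → ℚ
ι n = + n / 1

-- Total reciprocal and division, with the convention 1/0 = 0.  A zero
-- argument occurs only in initial terms of Cauchy sequences, where it does
-- not matter.
inv : ℚ → ℚ
inv   (mkℚ +0       _ _) = 0ℚ
inv q@(mkℚ +[1+ _ ] _ _) = 1/ q
inv q@(mkℚ -[1+ _ ] _ _) = 1/ q

infixl 7 _÷₀_
_÷₀_ : ℚ → ℚ → ℚ
p ÷₀ q = p * inv q

sum : ℕ → (ℕ → ℚ) → ℚ
sum zero    f = 0ℚ
sum (suc n) f = sum n f + f n

sum₁ : ℕ → (ℕ → ℚ) → ℚ
sum₁ n f = sum n (λ i → f (suc i))

-- Lemmas needed only for the Cauchy proofs carried by the real operations
module Aux where

  diff⇒≤ : ∀ {p q} → 0ℚ ≤ q - p → p ≤ q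
  diff⇒≤ {p} {q} h = subst₂ _≤_ (+-identityʳ p)
    (solve 2 (λ p q → p :+ (q :- p) := q) refl p q) (+-monoʳ-≤ p h)

  ≤⇒diff : ∀ {p q} → p ≤ q → 0ℚ ≤ q - p
  ≤⇒diff {p} {q} h = subst (_≤ q - p) (+-inverseʳ p) (+-monoˡ-≤ (- p) h)

  *-nonneg : ∀ {p q} → 0ℚ ≤ p → 0ℚ ≤ q → 0ℚ ≤ p * q
  *-nonneg {p} {q} hp hq = subst (_≤ p * q) (*-zeroʳ p)
    (*-monoˡ-≤-nonNeg p {{nonNegative hp}} hq)

  *-positive : ∀ {p q} → 0ℚ < p → 0ℚ < q → 0ℚ < p * q
  *-positive {p} {q} hp hq = subst (_< p * q) (*-zeroʳ p)
    (*-monoʳ-<-pos p {{positive hp}} hq)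

  *-mono : ∀ {p q r s} → 0ℚ ≤ p → p ≤ q → 0ℚ ≤ r → r ≤ s → p * r ≤ q * s
  *-mono {p} {q} {r} {s} 0≤p p≤q 0≤r r≤s = ≤-trans
    (*-monoˡ-≤-nonNeg p {{nonNegative 0≤p}} r≤s)
    (*-monoʳ-≤-nonNeg s {{nonNegative (≤-trans 0≤r r≤s)}} p≤q)

  0<1 : 0ℚ < 1ℚ
  0<1 = *<* (ℤ.+<+ (ℕ.s≤s ℕ.z≤n))

  0≤1 : 0ℚ ≤ 1ℚ
  0≤1 = <⇒≤ 0<1

  0<½ : 0ℚ < ½
  0<½ = *<* (ℤ.+<+ (ℕ.s≤s ℕ.z≤n))

  p≤∣p∣ : ∀ p → p ≤ ∣ p ∣
  p≤∣p∣ p with ≤-total 0ℚ p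
  ... | inj₁ h = ≤-reflexive (sym (0≤p⇒∣p∣≡p h))
  ... | inj₂ h = ≤-trans h (0≤∣p∣ p)

  ∣-∣-sym : ∀ p q → ∣ p - q ∣ ≡ ∣ q - p ∣
  ∣-∣-sym p q = trans (cong ∣_∣ (solve 2 (λ p q → p :- q := :- (q :- p)) refl p q))
                      (∣-p∣≡∣p∣ (q - p))

  p≤q+∣p-q∣ : ∀ p q → p ≤ q + ∣ p - q ∣
  p≤q+∣p-q∣ p q = subst (_≤ q + ∣ p - q ∣)
    (solve 2 (λ p q → q :+ (p :- q) := p) refl p q) (+-monoʳ-≤ q (p≤∣p∣ (p - q)))

  ∣-∣-intro : ∀ {p q e} → p ≤ q + e → q ≤ p + e → ∣ p - q ∣ ≤ e
  ∣-∣-intro {p} {q} {e} h₁ h₂ with ∣p∣≡p∨∣p∣≡-p (p - q)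
  ... | inj₁ eq = ≤-trans (≤-reflexive eq) (diff⇒≤ (subst (0ℚ ≤_)
        (solve 3 (λ p q e → (q :+ e) :- p := e :- (p :- q)) refl p q e) (≤⇒diff h₁)))
  ... | inj₂ eq = ≤-trans (≤-reflexive eq) (diff⇒≤ (subst (0ℚ ≤_)
        (solve 3 (λ p q e → (p :+ e) :- q := e :- (:- (p :- q))) refl p q e) (≤⇒diff h₂)))

  half+half : ∀ e → e * ½ + e * ½ ≡ e
  half+half e = trans (sym (*-distribˡ-+ e ½ ½)) (*-identityʳ e)

  half-pos : ∀ {e} → 0ℚ < e → 0ℚ < e * ½
  half-pos h = *-positive h 0<½

  inv≡1/ : ∀ q .{{_ : NonZero q}} → inv q ≡ 1/ q
  inv≡1/ (mkℚ +[1+ _ ] _ _) = refl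
  inv≡1/ (mkℚ -[1+ _ ] _ _) = refl

  *-inv : ∀ {q} → 0ℚ < q → q * inv q ≡ 1ℚ
  *-inv {q} h = trans (cong (q *_) (inv≡1/ q {{nz}})) (*-inverseʳ q {{nz}})
    where nz = >-nonZero h

  inv-pos : ∀ {q} → 0ℚ < q → 0ℚ < inv q
  inv-pos {q} h = subst (0ℚ <_) (sym (inv≡1/ q {{>-nonZero h}}))
    (positive⁻¹ _ {{1/pos⇒pos q {{positive h}}}})

  inv-nonneg : ∀ {q} → 0ℚ < q → 0ℚ ≤ inv q
  inv-nonneg h = <⇒≤ (inv-pos h)

  inv-anti : ∀ {p q} → 0ℚ < p → p ≤ q → inv q ≤ inv p
  inv-anti {p} {q} 0<p p≤q = subst₂ _≤_ e₁ e₂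
    (*-mono (<⇒≤ 0<p) p≤q (*-nonneg (inv-nonneg 0<p) (inv-nonneg 0<q)) ≤-refl)
    where
    0<q = <-≤-trans 0<p p≤q
    e₁ : p * (inv p * inv q) ≡ inv q
    e₁ = trans (sym (*-assoc p (inv p) (inv q)))
         (trans (cong (_* inv q) (*-inv 0<p)) (*-identityˡ (inv q)))
    e₂ : q * (inv p * inv q) ≡ inv p
    e₂ = trans (solve 3 (λ q a b → q :* (a :* b) := (q :* b) :* a) refl q (inv p) (inv q))
         (trans (cong (_* inv p) (*-inv 0<q)) (*-identityˡ (inv p)))

  inv≤1 : ∀ {q} → 1ℚ ≤ q → inv q ≤ 1ℚ
  inv≤1 h = inv-anti 0<1 h

  inv-lip : ∀ {a b c} → 0ℚ < c → c ≤ a → c ≤ b →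
            inv a ≤ inv b + ∣ a - b ∣ * (inv c * inv c)
  inv-lip {a} {b} {c} 0<c c≤a c≤b = diff⇒≤ (subst (0ℚ ≤_) eq (≤⇒diff
      (≤-trans (≤-trans (p≤∣p∣ ((b - a) * w)) (≤-reflexive (∣p*q∣≡∣p∣*∣q∣ (b - a) w)))
        (≤-trans (≤-reflexive (cong₂ _*_ (∣-∣-sym b a) (0≤p⇒∣p∣≡p w≥0)))
          (*-mono (0≤∣p∣ (a - b)) ≤-refl w≥0 w≤)))))
    where
    0<a = <-≤-trans 0<c c≤a
    0<b = <-≤-trans 0<c c≤b
    w = inv a * inv b
    w≥0 : 0ℚ ≤ w
    w≥0 = *-nonneg (inv-nonneg 0<a) (inv-nonneg 0<b)
    w≤ : w ≤ inv c * inv c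
    w≤ = *-mono (inv-nonneg 0<a) (inv-anti 0<c c≤a) (inv-nonneg 0<b) (inv-anti 0<c c≤b)
    E = ∣ a - b ∣ * (inv c * inv c)
    key : (b - a) * w ≡ inv a - inv b
    key = trans (solve 4 (λ a b ia ib → (b :- a) :* (ia :* ib)
                    := (b :* ib) :* ia :- (a :* ia) :* ib) refl a b (inv a) (inv b))
          (cong₂ (λ y z → y - z) (trans (cong (_* inv a) (*-inv 0<b)) (*-identityˡ (inv a)))
                     (trans (cong (_* inv b) (*-inv 0<a)) (*-identityˡ (inv b))))
    eq : E - (b - a) * w ≡ (inv b + E) - inv a
    eq = trans (cong (λ z → E - z) key)
      (solve 3 (λ e p q → e :- (p :- q) := (q :+ e) :- p) refl E (inv a) (inv b))

  ι-suc : ∀ n → ι (suc n) ≡ ι n + 1ℚ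
  ι-suc n = toℚᵘ-injective (ℚᵘ.≃-trans (toℚᵘ-homo-/ (suc n))
              (ℚᵘ.≃-sym (ℚᵘ.≃-trans (toℚᵘ-homo-+ (ι n) 1ℚ)
                (ℚᵘ.≃-trans (ℚᵘ.+-cong (toℚᵘ-homo-/ n) ℚᵘ.≃-refl) (U.*≡* eq)))))
    where
    toℚᵘ-homo-/ : ∀ n → toℚᵘ (ι n) U.≃ U.mkℚᵘ (+ n) 0
    toℚᵘ-homo-/ n = toℚᵘ-fromℚᵘ (U.mkℚᵘ (+ n) 0)
    eq : (+ n ℤ.* + 1 ℤ.+ + 1 ℤ.* + 1) ℤ.* + 1 ≡ + suc n ℤ.* + 1
    eq = cong (ℤ._* + 1) (trans (cong (ℤ._+ + 1) (ℤ.*-identityʳ (+ n)))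
           (cong +_ (ℕ.+-comm n 1)))

  ι-+ : ∀ m n → ι (m ℕ.+ n) ≡ ι m + ι n
  ι-+ zero    n = sym (+-identityˡ (ι n))
  ι-+ (suc m) n = trans (ι-suc (m ℕ.+ n)) (trans (cong (_+ 1ℚ) (ι-+ m n))
    (trans (solve 3 (λ a b c → (a :+ b) :+ c := (a :+ c) :+ b) refl (ι m) (ι n) 1ℚ)
      (cong (_+ ι n) (sym (ι-suc m)))))

  ι-* : ∀ m n → ι (m ℕ.* n) ≡ ι m * ι n
  ι-* zero    n = sym (*-zeroˡ (ι n))
  ι-* (suc m) n = trans (ι-+ n (m ℕ.* n)) (trans (cong (λ z → ι n + z) (ι-* m n))
    (trans (cong (_+ ι m * ι n) (sym (*-identityˡ (ι n))))
      (trans (solve 3 (λ a b c → c :* b :+ a :* b := (a :+ c) :* b) refl (ι m) (ι n) 1ℚ)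
        (cong (_* ι n) (sym (ι-suc m))))))

  ι-nonneg : ∀ n → 0ℚ ≤ ι n
  ι-nonneg zero    = ≤-refl
  ι-nonneg (suc n) = subst (0ℚ ≤_) (sym (ι-suc n)) (+-mono-≤ (ι-nonneg n) 0≤1)

  ι-mono : ∀ {m n} → m ℕ.≤ n → ι m ≤ ι n
  ι-mono {n = n} ℕ.z≤n = ι-nonneg n
  ι-mono {suc m} {suc n} (ℕ.s≤s h) =
    subst₂ _≤_ (sym (ι-suc m)) (sym (ι-suc n)) (+-monoˡ-≤ 1ℚ (ι-mono h))

  ι-pos : ∀ n → 0ℚ < ι (suc n)
  ι-pos n = <-≤-trans 0<1 (ι-mono {1} {suc n} (ℕ.s≤s ℕ.z≤n))

  arch : ∀ q → ∃ λ N → q ≤ ι (suc N)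
  arch q@(mkℚ n d c) = ℤ.∣ n ∣ ,
    ≤-trans (toℚᵘ-cancel-≤ (ℚᵘ.≤-trans le (ℚᵘ.≤-reflexive (ℚᵘ.≃-sym
      (toℚᵘ-fromℚᵘ (U.mkℚᵘ (+ ℤ.∣ n ∣) 0)))))) (ι-mono {ℤ.∣ n ∣} (ℕ.n≤1+n ℤ.∣ n ∣))
    where
    n≤ : ∀ n → n ℤ.≤ + ℤ.∣ n ∣
    n≤ (+ n)      = ℤ.≤-refl
    n≤ -[1+ n ]   = ℤ.-≤+
    le : U.mkℚᵘ n d U.≤ U.mkℚᵘ (+ ℤ.∣ n ∣) 0
    le = U.*≤* (ℤ.≤-trans (ℤ.≤-reflexive (ℤ.*-identityʳ n))
          (ℤ.≤-trans (n≤ n) (subst (+ ℤ.∣ n ∣ ℤ.≤_) (ℤ.pos-* ℤ.∣ n ∣ (suc d))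
            (ℤ.+≤+ (ℕ.m≤m*n ℤ.∣ n ∣ (suc d))))))

  sum-cong : ∀ n {f g : ℕ → ℚ} → (∀ i → f i ≡ g i) → sum n f ≡ sum n g
  sum-cong zero    h = refl
  sum-cong (suc n) h = cong₂ _+_ (sum-cong n h) (h n)

  sum-++ : ∀ M K f → sum (M ℕ.+ K) f ≡ sum K f + sum M (λ j → f (j ℕ.+ K))
  sum-++ zero    K f = sym (+-identityʳ _)
  sum-++ (suc M) K f = trans (cong (_+ f (M ℕ.+ K)) (sum-++ M K f))
    (+-assoc (sum K f) (sum M (λ j → f (j ℕ.+ K))) (f (M ℕ.+ K)))

  ι-suc-* : ∀ n c → ι (suc n) * c ≡ ι n * c + c
  ι-suc-* n c = trans (cong (_* c) (ι-suc n)) (trans (*-distribʳ-+ c (ι n) 1ℚ)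
    (cong (λ z → ι n * c + z) (*-identityˡ c)))

  sum-≤ : ∀ n {f : ℕ → ℚ} {c} → (∀ i → i ℕ.< n → f i ≤ c) → sum n f ≤ ι n * c
  sum-≤ zero    {c = c} h = ≤-reflexive (sym (*-zeroˡ c))
  sum-≤ (suc n) {c = c} h = ≤-trans
    (+-mono-≤ (sum-≤ n (λ i i<n → h i (ℕ.m≤n⇒m≤1+n i<n))) (h n ℕ.≤-refl))
    (≤-reflexive (sym (ι-suc-* n c)))

  sum-≥ : ∀ n {f : ℕ → ℚ} {c} → (∀ i → i ℕ.< n → c ≤ f i) → ι n * c ≤ sum n f
  sum-≥ zero    {c = c} h = ≤-reflexive (*-zeroˡ c)
  sum-≥ (suc n) {c = c} h = ≤-trans (≤-reflexive (ι-suc-* n c))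
    (+-mono-≤ (sum-≥ n (λ i i<n → h i (ℕ.m≤n⇒m≤1+n i<n))) (h n ℕ.≤-refl))

  sum-≤+ : ∀ n {f g : ℕ → ℚ} {e} → (∀ i → f i ≤ g i + e) → sum n f ≤ sum n g + ι n * e
  sum-≤+ zero    {e = e} h = ≤-reflexive (sym (trans (+-identityˡ _) (*-zeroˡ e)))
  sum-≤+ (suc n) {f} {g} {e} h = ≤-trans (+-mono-≤ (sum-≤+ n h) (h n))
    (≤-reflexive (trans
      (solve 4 (λ a b c d → (a :+ b) :+ (c :+ d) := (a :+ c) :+ (b :+ d)) refl
        (sum n g) (ι n * e) (g n) e)
      (cong (λ z → sum n g + g n + z) (sym (ι-suc-* n e)))))

open Aux

IsCauchy : (ℕ → ℚ) → Set
IsCauchy s = ∀ ε → 0ℚ < ε → ∃ λ N → ∀ m n → N ℕ.≤ m → N ℕ.≤ n → ∣ s m - s n ∣ ≤ ε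

-- A Cauchy sequence carrying its modulus; distinct sequences may represent
-- the same number, and the order and limits below respect this.
record ℝ : Set where
  constructor mkℝ
  field
    seq    : ℕ → ℚ
    cauchy : IsCauchy seq

open ℝ

toCauchy : ∀ s → (∀ ε → 0ℚ < ε → ∃ λ N → ∀ m n → N ℕ.≤ m → N ℕ.≤ n → s m ≤ s n + ε) →
           IsCauchy s
toCauchy s h ε 0<ε with h ε 0<ε
... | N , p = N , λ m n N≤m N≤n → ∣-∣-intro (p m n N≤m N≤n) (p n m N≤n N≤m)

below : ∀ p q {e} → ∣ p - q ∣ ≤ e → p ≤ q + e
below p q h = ≤-trans (p≤q+∣p-q∣ p q) (+-monoʳ-≤ q h)

bounded : ∀ x → ∃ λ B → 0ℚ < B × ∃ λ N → ∀ n → N ℕ.≤ n → ∣ seq x n ∣ ≤ B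
bounded x with cauchy x 1ℚ 0<1
... | N , p = ∣ seq x N ∣ + 1ℚ , +-mono-≤-< (0≤∣p∣ (seq x N)) 0<1 , N , λ n N≤n →
  ≤-trans (≤-reflexive (cong ∣_∣ (solve 2 (λ a b → a := b :+ (a :- b)) refl (seq x n) (seq x N))))
    (≤-trans (∣p+q∣≤∣p∣+∣q∣ (seq x N) _) (+-monoʳ-≤ ∣ seq x N ∣ (p n N N≤n ℕ.≤-refl)))

fromℚ : ℚ → ℝ
fromℚ q = mkℝ (λ _ → q) (toCauchy (λ _ → q) λ ε 0<ε → 0 , λ _ _ _ _ →
  ≤-trans (≤-reflexive (sym (+-identityʳ q))) (+-monoʳ-≤ q (<⇒≤ 0<ε)))

fromℕ : ℕ → ℝ
fromℕ n = fromℚ (ι n)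

0ℝ 1ℝ : ℝ
0ℝ = fromℚ 0ℚ
1ℝ = fromℚ 1ℚ

infixl 6 _+ℝ_ _-ℝ_
infixl 7 _*ℝ_
infix  8 -ℝ_
infix  4 _≤ℝ_ _<ℝ_

_+ℝ_ : ℝ → ℝ → ℝ
x +ℝ y = mkℝ (λ n → seq x n + seq y n) (toCauchy (λ n → seq x n + seq y n) λ ε 0<ε →
  let N₁ , p₁ = cauchy x (ε * ½) (half-pos 0<ε)
      N₂ , p₂ = cauchy y (ε * ½) (half-pos 0<ε)
  in N₁ ℕ.⊔ N₂ , λ m n hm hn →
    ≤-trans (+-mono-≤
        (below (seq x m) (seq x n) (p₁ m n (ℕ.m⊔n≤o⇒m≤o N₁ N₂ hm) (ℕ.m⊔n≤o⇒m≤o N₁ N₂ hn)))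
        (below (seq y m) (seq y n) (p₂ m n (ℕ.m⊔n≤o⇒n≤o N₁ N₂ hm) (ℕ.m⊔n≤o⇒n≤o N₁ N₂ hn))))
      (≤-reflexive (trans
        (solve 4 (λ a b c d → (a :+ b) :+ (c :+ d) := (a :+ c) :+ (b :+ d)) refl
          (seq x n) (ε * ½) (seq y n) (ε * ½))
        (cong (λ z → seq x n + seq y n + z) (half+half ε)))))

-ℝ_ : ℝ → ℝ
-ℝ x = mkℝ (λ n → - seq x n) (toCauchy (λ n → - seq x n) λ ε 0<ε →
  let N , p = cauchy x ε 0<ε
  in N , λ m n hm hn → diff⇒≤ (subst (0ℚ ≤_)
       (solve 3 (λ a b e → (b :+ e) :- a := (:- a :+ e) :- (:- b)) refl
         (seq x n) (seq x m) ε)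
       (≤⇒diff (below (seq x n) (seq x m) (p n m hn hm)))))

_-ℝ_ : ℝ → ℝ → ℝ
x -ℝ y = x +ℝ (-ℝ y)

∣_∣ℝ : ℝ → ℝ
∣ x ∣ℝ = mkℝ (λ n → ∣ seq x n ∣) (toCauchy (λ n → ∣ seq x n ∣) λ ε 0<ε →
  let N , p = cauchy x ε 0<ε
  in N , λ m n hm hn →
    ≤-trans (≤-reflexive (cong ∣_∣ (solve 2 (λ a b → a := b :+ (a :- b)) refl (seq x m) (seq x n))))
      (≤-trans (∣p+q∣≤∣p∣+∣q∣ (seq x n) _) (+-monoʳ-≤ ∣ seq x n ∣ (p m n hm hn))))

_*ℝ_ : ℝ → ℝ → ℝ
x *ℝ y = mkℝ (λ n → seq x n * seq y n) (toCauchy (λ n → seq x n * seq y n) λ ε 0<ε →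
  let A , 0<A , M₁ , hA = bounded x
      B , 0<B , M₂ , hB = bounded y
      N₁ , p₁ = cauchy x (ε * ½ * inv B) (*-positive (half-pos 0<ε) (inv-pos 0<B))
      N₂ , p₂ = cauchy y (ε * ½ * inv A) (*-positive (half-pos 0<ε) (inv-pos 0<A))
      M = M₁ ℕ.⊔ M₂
      N = N₁ ℕ.⊔ N₂
  in M ℕ.⊔ N , λ m n hm hn →
    let M≤m = ℕ.m⊔n≤o⇒m≤o M N hm
        N≤m = ℕ.m⊔n≤o⇒n≤o M N hm
        M≤n = ℕ.m⊔n≤o⇒m≤o M N hn
        N≤n = ℕ.m⊔n≤o⇒n≤o M N hn
        a = seq x m
        a′ = seq x n
        b = seq y m
        b′ = seq y n
        t₁ : a * (b - b′) ≤ ε * ½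
        t₁ = prod 0<A (hA m (ℕ.m⊔n≤o⇒m≤o M₁ M₂ M≤m))
               (p₂ m n (ℕ.m⊔n≤o⇒n≤o N₁ N₂ N≤m) (ℕ.m⊔n≤o⇒n≤o N₁ N₂ N≤n))
        t₂ : b′ * (a - a′) ≤ ε * ½
        t₂ = prod 0<B (hB n (ℕ.m⊔n≤o⇒n≤o M₁ M₂ M≤n))
               (p₁ m n (ℕ.m⊔n≤o⇒m≤o N₁ N₂ N≤m) (ℕ.m⊔n≤o⇒m≤o N₁ N₂ N≤n))
    in ≤-trans (≤-reflexive
         (solve 4 (λ a a′ b b′ → a :* b := a′ :* b′ :+ (a :* (b :- b′) :+ b′ :* (a :- a′)))
           refl a a′ b b′))
       (+-monoʳ-≤ (a′ * b′) (≤-trans (+-mono-≤ t₁ t₂) (≤-reflexive (half+half ε)))))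
  where
  prod : ∀ {C u v e} → 0ℚ < C → ∣ u ∣ ≤ C → ∣ v ∣ ≤ e * inv C → u * v ≤ e
  prod {C} {u} {v} {e} 0<C hu hv = ≤-trans (p≤∣p∣ (u * v))
    (≤-trans (≤-reflexive (∣p*q∣≡∣p∣*∣q∣ u v))
    (≤-trans (*-mono (0≤∣p∣ u) hu (0≤∣p∣ v) hv)
      (≤-reflexive (trans (solve 3 (λ c e i → c :* (e :* i) := e :* (c :* i)) refl C e (inv C))
        (trans (cong (e *_) (*-inv 0<C)) (*-identityʳ e))))))

_≤ℝ_ : ℝ → ℝ → Set
x ≤ℝ y = ∀ ε → 0ℚ < ε → ∃ λ N → ∀ n → N ℕ.≤ n → seq x n ≤ seq y n + ε

_<ℝ_ : ℝ → ℝ → Set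
x <ℝ y = ∃ λ ε → 0ℚ < ε × ∃ λ N → ∀ n → N ℕ.≤ n → seq x n + ε ≤ seq y n

recip : (x : ℝ) → 0ℝ <ℝ x → ℝ
recip x (c , 0<c , M , c≤x) = mkℝ (λ n → inv (seq x n)) (toCauchy (λ n → inv (seq x n)) λ ε 0<ε →
  let N , p = cauchy x (ε * (c * c)) (*-positive 0<ε (*-positive 0<c 0<c))
  in M ℕ.⊔ N , λ m n hm hn →
    ≤-trans (inv-lip 0<c (lower m (ℕ.m⊔n≤o⇒m≤o M N hm)) (lower n (ℕ.m⊔n≤o⇒m≤o M N hn)))
      (+-monoʳ-≤ (inv (seq x n)) (≤-trans
        (*-monoʳ-≤-nonNeg (inv c * inv c)
          {{nonNegative (*-nonneg (inv-nonneg 0<c) (inv-nonneg 0<c))}}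
          (p m n (ℕ.m⊔n≤o⇒n≤o M N hm) (ℕ.m⊔n≤o⇒n≤o M N hn)))
        (≤-reflexive (cancel ε)))))
  where
  lower : ∀ n → M ℕ.≤ n → c ≤ seq x n
  lower n h = subst (_≤ seq x n) (+-identityˡ c) (c≤x n h)
  cancel : ∀ ε → ε * (c * c) * (inv c * inv c) ≡ ε
  cancel ε = trans (solve 3 (λ e c i → e :* (c :* c) :* (i :* i) := e :* ((c :* i) :* (c :* i)))
                      refl ε c (inv c))
             (trans (cong (λ z → ε * (z * z)) (*-inv 0<c)) (*-identityʳ ε))

infix 4 _⟶_
_⟶_ : (ℕ → ℝ) → ℝ → Set
s ⟶ L = ∀ ε → 0ℚ < ε → ∃ λ N → ∀ n → N ℕ.≤ n → ∣ s n -ℝ L ∣ℝ ≤ℝ fromℚ ε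

HasSum₁ : (ℕ → ℚ) → ℝ → Set
HasSum₁ a L = (λ N → fromℚ (sum₁ N a)) ⟶ L

primeProduct : (ℕ → ℝ) → ℕ → ℝ
primeProduct F zero    = 1ℝ
primeProduct F (suc n) =
  if does (prime? (suc n)) then primeProduct F n *ℝ F (suc n) else primeProduct F n

HasPrimeProduct : (ℕ → ℝ) → ℝ → Set
HasPrimeProduct F L = primeProduct F ⟶ L

-- Left Riemann sum over N equal subintervals of [a , b]
riemannSum : (ℚ → ℚ) → ℚ → ℚ → ℕ → ℚ
riemannSum f a b N = let h = (b - a) ÷₀ ι N in sum N (λ i → h * f (a + ι i * h))

module Log where

  term : ℚ → ℕ → ℚ
  term h i = h * inv (1ℚ + ι i * h)

  1≤den : ∀ {h} → 0ℚ ≤ h → ∀ i → 1ℚ ≤ 1ℚ + ι i * h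
  1≤den {h} 0≤h i = subst (_≤ 1ℚ + ι i * h) (+-identityʳ 1ℚ)
    (+-monoʳ-≤ 1ℚ (*-nonneg (ι-nonneg i) 0≤h))

  0<den : ∀ {h} → 0ℚ ≤ h → ∀ i → 0ℚ < 1ℚ + ι i * h
  0<den 0≤h i = <-≤-trans 0<1 (1≤den 0≤h i)

  term-anti : ∀ {h} → 0ℚ ≤ h → ∀ {i j} → i ℕ.≤ j → term h j ≤ term h i
  term-anti {h} 0≤h {i} {j} i≤j = *-monoˡ-≤-nonNeg h {{nonNegative 0≤h}}
    (inv-anti (0<den 0≤h i) (+-monoʳ-≤ 1ℚ (*-monoʳ-≤-nonNeg h {{nonNegative 0≤h}} (ι-mono i≤j))))

  term-nonneg : ∀ {h} → 0ℚ ≤ h → ∀ i → 0ℚ ≤ term h i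
  term-nonneg 0≤h i = *-nonneg 0≤h (inv-nonneg (0<den 0≤h i))

  -- Coarsening the step from g to M g
  coarse : ∀ M g i → ι M * term g (i ℕ.* M) ≡ term (ι M * g) i
  coarse M g i = trans (sym (*-assoc (ι M) g _)) (cong (λ z → ι M * g * inv (1ℚ + z))
    (trans (cong (_* g) (ι-* i M)) (*-assoc (ι i) (ι M) g)))

  module Refine (M : ℕ) (g : ℚ) (0≤g : 0ℚ ≤ g) where
    L R : ℕ → ℚ
    L n = sum n (term (ι M * g))
    R n = sum (n ℕ.* M) (term g)

    block : ℕ → ℚ
    block n = sum M (λ j → term g (j ℕ.+ n ℕ.* M))

    block-≤ : ∀ n → block n ≤ term (ι M * g) n
    block-≤ n = ≤-trans (sum-≤ M (λ j _ → term-anti 0≤g (ℕ.m≤n+m (n ℕ.* M) j)))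
      (≤-reflexive (coarse M g n))

    block-≥ : ∀ n → term (ι M * g) (suc n) ≤ block n
    block-≥ n = ≤-trans (≤-reflexive (sym (coarse M g (suc n))))
      (sum-≥ M (λ j j<M → term-anti 0≤g (ℕ.+-monoˡ-≤ (n ℕ.* M) (ℕ.<⇒≤ j<M))))

    R≤L : ∀ n → R n ≤ L n
    R≤L zero    = ≤-refl
    R≤L (suc n) = ≤-trans (≤-reflexive (sum-++ M (n ℕ.* M) (term g)))
      (+-mono-≤ (R≤L n) (block-≤ n))

    L≤R′ : ∀ n → L n + term (ι M * g) n ≤ R n + ι M * g
    L≤R′ zero    = +-monoʳ-≤ 0ℚ (≤-reflexive
      (trans (cong (λ z → ι M * g * inv (1ℚ + z)) (*-zeroˡ (ι M * g))) (*-identityʳ (ι M * g))))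
    L≤R′ (suc n) = ≤-trans (+-mono-≤ (L≤R′ n) (block-≥ n))
      (≤-reflexive (trans
        (solve 3 (λ a b c → a :+ b :+ c := a :+ c :+ b) refl (R n) (ι M * g) (block n))
        (cong (_+ ι M * g) (sym (sum-++ M (n ℕ.* M) (term g))))))

    L≤R : ∀ n → L n ≤ R n + ι M * g
    L≤R n = ≤-trans (subst (_≤ L n + term (ι M * g) n) (+-identityʳ (L n))
              (+-monoʳ-≤ (L n) (term-nonneg (*-nonneg (ι-nonneg M) 0≤g) n))) (L≤R′ n)

  step : ℚ → ℕ → ℚ
  step x N = (x - 1ℚ) ÷₀ ι N

  S : ℚ → ℕ → ℚ
  S x N = riemannSum inv 1ℚ x N

  0≤step : ∀ {x} → 1ℚ ≤ x → ∀ n → 0ℚ ≤ step x (suc n)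
  0≤step 1≤x n = *-nonneg (≤⇒diff 1≤x) (inv-nonneg (ι-pos n))

  ι-step : ∀ x n → ι (suc n) * step x (suc n) ≡ x - 1ℚ
  ι-step x n = trans (solve 3 (λ a u i → a :* (u :* i) := u :* (a :* i)) refl
                 (ι (suc n)) (x - 1ℚ) (inv (ι (suc n))))
               (trans (cong ((x - 1ℚ) *_) (*-inv (ι-pos n))) (*-identityʳ _))

  step-uniq : ∀ n {a b} → ι (suc n) * a ≡ ι (suc n) * b → a ≡ b
  step-uniq n {a} {b} h = trans (sym (c a)) (trans (cong (inv (ι (suc n)) *_) h) (c b))
    where
    c : ∀ a → inv (ι (suc n)) * (ι (suc n) * a) ≡ a
    c a = trans (solve 3 (λ i n a → i :* (n :* a) := (n :* i) :* a) refl
                   (inv (ι (suc n))) (ι (suc n)) a)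
          (trans (cong (_* a) (*-inv (ι-pos n))) (*-identityˡ a))

  step-coarse : ∀ x m n → ι (suc n) * step x (suc m ℕ.* suc n) ≡ step x (suc m)
  step-coarse x m n = step-uniq m (trans (sym (*-assoc (ι (suc m)) (ι (suc n)) _))
    (trans (cong (_* step x (suc m ℕ.* suc n)) (sym (ι-* (suc m) (suc n))))
      (trans (ι-step x (n ℕ.+ m ℕ.* suc n)) (sym (ι-step x m)))))

  upper : ∀ {x} → 1ℚ ≤ x → ∀ m n → S x (suc m) ≤ S x (suc m ℕ.* suc n) + step x (suc m)
  upper {x} 1≤x m n = subst
      (λ z → sum (suc m) (term z) ≤ S x (suc m ℕ.* suc n) + z)
      (step-coarse x m n)
      (Refine.L≤R (suc n) _ (0≤step 1≤x (n ℕ.+ m ℕ.* suc n)) (suc m))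

  lower : ∀ {x} → 1ℚ ≤ x → ∀ m n → S x (suc m ℕ.* suc n) ≤ S x (suc m)
  lower {x} 1≤x m n = subst
      (λ z → S x (suc m ℕ.* suc n) ≤ sum (suc m) (term z))
      (step-coarse x m n)
      (Refine.R≤L (suc n) _ (0≤step 1≤x (n ℕ.+ m ℕ.* suc n)) (suc m))

  compare : ∀ {x} → 1ℚ ≤ x → ∀ m n → S x (suc m) ≤ S x (suc n) + step x (suc m)
  compare {x} 1≤x m n = ≤-trans (upper 1≤x m n) (+-monoˡ-≤ (step x (suc m))
    (subst (λ k → S x k ≤ S x (suc n)) (ℕ.*-comm (suc n) (suc m)) (lower 1≤x n m)))

  term-lip : ∀ {h k} → 0ℚ ≤ h → 0ℚ ≤ k → ∀ i → term h i ≤ term k i + ∣ h - k ∣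
  term-lip {h} {k} 0≤h 0≤k i = diff⇒≤ (subst (0ℚ ≤_) eq (≤⇒diff le))
    where
    A = 1ℚ + ι i * h
    B = 1ℚ + ι i * k
    w = inv A * inv B
    w≥0 : 0ℚ ≤ w
    w≥0 = *-nonneg (inv-nonneg (0<den 0≤h i)) (inv-nonneg (0<den 0≤k i))
    w≤1 : w ≤ 1ℚ
    w≤1 = *-mono (inv-nonneg (0<den 0≤h i)) (inv≤1 (1≤den 0≤h i))
                 (inv-nonneg (0<den 0≤k i)) (inv≤1 (1≤den 0≤k i))
    le : (h - k) * w ≤ ∣ h - k ∣
    le = ≤-trans (p≤∣p∣ ((h - k) * w)) (≤-trans (≤-reflexive (∣p*q∣≡∣p∣*∣q∣ (h - k) w))
      (≤-trans (*-mono (0≤∣p∣ (h - k)) ≤-refl (0≤∣p∣ w)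
                 (≤-trans (≤-reflexive (0≤p⇒∣p∣≡p w≥0)) w≤1))
        (≤-reflexive (*-identityʳ _))))
    key : (h - k) * w ≡ term h i - term k i
    key = trans (solve 6 (λ h k n o a b → (h :- k) :* (a :* b)
              := (h :* a) :* ((o :+ n :* k) :* b) :- (k :* b) :* ((o :+ n :* h) :* a)
                 :+ (con 1ℚ :- o) :* ((h :- k) :* (a :* b))) refl
              h k (ι i) 1ℚ (inv A) (inv B))
          (trans (cong₂ (λ y z → (h * inv A) * y - (k * inv B) * z
                            + (1ℚ - 1ℚ) * ((h - k) * w))
                   (*-inv (0<den 0≤k i)) (*-inv (0<den 0≤h i)))
            (solve 3 (λ x y z → x :* con 1ℚ :- y :* con 1ℚ :+ (con 1ℚ :- con 1ℚ) :* z
                        := x :- y) refl (h * inv A) (k * inv B) ((h - k) * w)))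
    eq : ∣ h - k ∣ - (h - k) * w ≡ (term k i + ∣ h - k ∣) - term h i
    eq = trans (cong (λ z → ∣ h - k ∣ - z) key)
      (solve 3 (λ e p q → e :- (p :- q) := (q :+ e) :- p) refl
        ∣ h - k ∣ (term h i) (term k i))

  S-lip : ∀ {x y} → 1ℚ ≤ x → 1ℚ ≤ y → ∀ n → S x (suc n) ≤ S y (suc n) + ∣ x - y ∣
  S-lip {x} {y} 1≤x 1≤y n = ≤-trans
      (sum-≤+ (suc n) (term-lip (0≤step 1≤x n) (0≤step 1≤y n)))
      (≤-reflexive (cong (λ z → S y (suc n) + z) eq))
    where
    i = inv (ι (suc n))
    eq : ι (suc n) * ∣ step x (suc n) - step y (suc n) ∣ ≡ ∣ x - y ∣
    eq = trans (cong (λ z → ι (suc n) * ∣ z ∣)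
           (solve 4 (λ x y o i → (x :- o) :* i :- (y :- o) :* i := (x :- y) :* i)
             refl x y 1ℚ i))
         (trans (cong (ι (suc n) *_) (trans (∣p*q∣≡∣p∣*∣q∣ (x - y) i)
                   (cong (∣ x - y ∣ *_) (0≤p⇒∣p∣≡p (inv-nonneg (ι-pos n))))))
         (trans (solve 3 (λ a u i → a :* (u :* i) := u :* (a :* i)) refl
                   (ι (suc n)) ∣ x - y ∣ i)
         (trans (cong (∣ x - y ∣ *_) (*-inv (ι-pos n))) (*-identityʳ _))))

  step-small : ∀ {x B N m} → 0ℚ < B → x ≤ B → N ℕ.≤ m → ∀ {ε} → 0ℚ < ε →
               B * inv ε ≤ ι (suc N) → step x (suc m) ≤ ε
  step-small {x} {B} {N} {m} 0<B x≤B N≤m {ε} 0<ε h = ≤-trans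
    (*-monoʳ-≤-nonNeg i {{nonNegative i≥0}} (≤-trans x-1≤B B≤))
    (≤-reflexive (trans (*-assoc ε (ι (suc m)) i)
      (trans (cong (ε *_) (*-inv (ι-pos m))) (*-identityʳ ε))))
    where
    i = inv (ι (suc m))
    i≥0 = inv-nonneg (ι-pos m)
    x-1≤B : x - 1ℚ ≤ B
    x-1≤B = ≤-trans (diff⇒≤ (subst (0ℚ ≤_)
      (solve 2 (λ x o → o := x :- (x :- o)) refl x 1ℚ) 0≤1)) x≤B
    B≤ : B ≤ ε * ι (suc m)
    B≤ = ≤-trans (≤-reflexive (sym (trans
           (solve 3 (λ e b i → e :* (b :* i) := b :* (e :* i)) refl ε B (inv ε))
           (trans (cong (B *_) (*-inv 0<ε)) (*-identityʳ B)))))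
         (*-monoˡ-≤-nonNeg ε {{nonNegative (<⇒≤ 0<ε)}} (≤-trans h (ι-mono (ℕ.s≤s N≤m))))

  clamp-lip : ∀ p q → ∣ (1ℚ ⊔ p) - (1ℚ ⊔ q) ∣ ≤ ∣ p - q ∣
  clamp-lip p q = ∣-∣-intro (one p q)
    (subst (λ e → 1ℚ ⊔ q ≤ (1ℚ ⊔ p) + e) (∣-∣-sym q p) (one q p))
    where
    one : ∀ p q → 1ℚ ⊔ p ≤ (1ℚ ⊔ q) + ∣ p - q ∣
    one p q = ⊔-lub
      (≤-trans (p≤p⊔q 1ℚ q) (subst (_≤ (1ℚ ⊔ q) + ∣ p - q ∣) (+-identityʳ (1ℚ ⊔ q))
        (+-monoʳ-≤ (1ℚ ⊔ q) (0≤∣p∣ (p - q)))))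
      (≤-trans (p≤q+∣p-q∣ p q) (+-monoˡ-≤ ∣ p - q ∣ (p≤q⊔p 1ℚ q)))

  log-cauchy : ∀ x → IsCauchy (λ n → riemannSum inv 1ℚ (1ℚ ⊔ seq x n) n)
  log-cauchy x = toCauchy (λ n → riemannSum inv 1ℚ (1ℚ ⊔ seq x n) n) λ ε 0<ε →
    let B , 0<B , M , hB = bounded x
        B′ = B + 1ℚ
        0<B′ = +-mono-< 0<B 0<1
        N₁ , p = cauchy x (ε * ½) (half-pos 0<ε)
        N₂ , q = arch (B′ * inv (ε * ½))
        N₀ = M ℕ.⊔ N₁
    in suc (N₀ ℕ.⊔ N₂) , λ where
      (suc m) (suc n) (ℕ.s≤s hm) (ℕ.s≤s hn) →
        let N₀≤m = ℕ.m≤n⇒m≤1+n (ℕ.m⊔n≤o⇒m≤o N₀ N₂ hm)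
            N₀≤n = ℕ.m≤n⇒m≤1+n (ℕ.m⊔n≤o⇒m≤o N₀ N₂ hn)
            a = 1ℚ ⊔ seq x (suc m)
            b = 1ℚ ⊔ seq x (suc n)
            1≤a = p≤p⊔q 1ℚ (seq x (suc m))
            1≤b = p≤p⊔q 1ℚ (seq x (suc n))
            b≤B′ : b ≤ B′
            b≤B′ = ⊔-lub
              (subst (_≤ B′) (+-identityˡ 1ℚ) (+-monoˡ-≤ 1ℚ (<⇒≤ 0<B)))
              (≤-trans (≤-trans (p≤∣p∣ _) (hB (suc n) (ℕ.m⊔n≤o⇒m≤o M N₁ N₀≤n)))
                (subst (_≤ B′) (+-identityʳ B) (+-monoʳ-≤ B 0≤1)))
            t₁ : S a (suc m) ≤ S b (suc m) + ε * ½
            t₁ = ≤-trans (S-lip 1≤a 1≤b m) (+-monoʳ-≤ (S b (suc m))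
                   (≤-trans (clamp-lip (seq x (suc m)) (seq x (suc n)))
                     (p (suc m) (suc n) (ℕ.m⊔n≤o⇒n≤o M N₁ N₀≤m) (ℕ.m⊔n≤o⇒n≤o M N₁ N₀≤n))))
            t₂ : S b (suc m) ≤ S b (suc n) + ε * ½
            t₂ = ≤-trans (compare 1≤b m n) (+-monoʳ-≤ (S b (suc n))
                   (step-small {N = N₂} 0<B′ b≤B′ (ℕ.m⊔n≤o⇒n≤o N₀ N₂ hm) (half-pos 0<ε) q))
        in ≤-trans t₁ (≤-trans (+-monoˡ-≤ (ε * ½) t₂)
             (≤-reflexive (trans (+-assoc (S b (suc n)) (ε * ½) (ε * ½))
               (cong (λ z → S b (suc n) + z) (half+half ε)))))

-- log x is the integral of dt/t from 1 to x, for x ≥ 1.  The rational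
-- approximations of such an x may lie slightly below 1, hence the maximum,
-- which does not change the limit.
log : (x : ℝ) → .(1ℝ ≤ℝ x) → ℝ
log x _ = mkℝ (λ n → riemannSum inv 1ℚ (1ℚ ⊔ seq x n) n) (Log.log-cauchy x)

maximum : List ℕ → ℕ
maximum = foldr ℕ._⊔_ 0

-- For m, b ≥ 1 the condition d ^ b ∣ m forces d ≤ m, so searching
-- 1 ≤ d ≤ m loses nothing.
ggcd : (b m n : ℕ) → ℕ
ggcd b m n =
  maximum (filter (λ d → (d ℕ.^ b ∣? m) ×-dec (d ℕ.^ b ∣? n)) (applyUpTo suc m))

H : (b n : ℕ) → ℚ
H b n = ι n * inv (sum₁ n (λ j → 1ℚ ÷₀ ι (ggcd b j n)))

zetaTerm : (b k : ℕ) → ℚ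
zetaTerm b k = 1ℚ ÷₀ ι (k ℕ.^ b)

localTerm : (b p k : ℕ) → ℚ
localTerm b p k =
  ι (p ℕ.^ k) ÷₀
    (ι (p ℕ.^ (k ℕ.* (b ℕ.+ 1))) * (ι (p ℕ.^ (b ℕ.+ 1)) - ι p) + ι p - 1ℚ)

-- s stands for the sum over k ≥ 1 of localTerm b p k
localFactor : (b p : ℕ) → ℝ → ℝ
localFactor b p s = 1ℝ +ℝ fromℚ (ι (p ℕ.^ (b ℕ.+ 1)) - 1ℚ) *ℝ s

{-# OPTIONS --safe #-}
-- H_b(n) = n / Σ_{j ≤ n} 1/(j,n)_b is multiplicative, and H_b(p^a) is the function (increasing in k)
--   h_k(p) = (q - 1) q^k / (q^k (q - p) + p - 1),   q = p^(b+1),   k = ⌊a/b⌋.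
-- Hence H_b(n) = Σ_{e^b ∣ n} f(e) with f multiplicative and f(p^k) = h_k(p) - h_{k-1}(p) ≥ 0, and f ≤ 2
-- because Π h_k(p) ≤ Π p²/(p² - 1) ≤ 2.  Summing over multiples of e^b,
--   Σ_{n ≤ N} H_b(n)/n = Σ_e f(e)/e^b · harm(N/e^b),
-- and harm N ≤ harm D + harm(N/D) shows that this is (Σ_e f(e)/e^b) · log N + O_b(1).
-- Finally ζ(b) Σ_e f(e)/e^b = Σ_m H_b(m^b)/m^b, since Σ_{e ∣ m} f(e) = H_b(m^b), and the Euler product
-- of the right-hand side has the factors 1 + (q - 1) Σ_k p^k/(q^k (q - p) + p - 1).
module Submission where

open import Defs

-- Multiplicativity of H_b is never proved by itself: the recursion for Σ 1/(j,n)_b in the exponent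
-- of one prime p carries an arbitrary cofactor r prime to p, and n is then built one prime at a
-- time. Reals are Cauchy sequences here, so nearly all of the proof consists of inequalities
-- between rationals at a finite index n. The constant is replaced by C_n = P_n / Z_n, where Z_n and
-- P_n are partial sums of ζ(b) and of Σ H_b(m^b)/m^b. The n-th partial sum of Σ f(e)/e^b lies
-- between C_n and C_n + 2/n; this error gets multiplied by harm N ≤ N ≤ n, so it is harmless once n
-- ≥ N. The logarithm enters only through the comparison of its Riemann sums with harmonic numbers.
-- The hypothesis b ≥ 2 acts twice: through q ≥ p³, which gives h_k(p) ≤ p²/(p² - 1), and through
-- e^-b ≤ e^-2, which makes the tails of all series O(1/n) uniformly in b.

module HarmonicMean where

  open Aux
  open ℝ
  open import Data.Empty using (⊥-elim)
  open import Data.Bool.Base using (if_then_else_)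
  import Data.Integer.Base as ℤ
  open import Data.List.Base using ([]; _∷_; filter; applyUpTo)
  open import Data.List.Membership.Propositional using (_∈_)
  open import Data.List.Membership.Propositional.Properties using (∈-filter⁺; ∈-filter⁻; ∈-applyUpTo⁺; ∈-applyUpTo⁻)
  open import Data.List.Relation.Unary.All as All using ()
  open import Data.List.Relation.Unary.Any using (here; there)
  open import Data.Nat.Base as ℕ using (ℕ; zero; suc)
  open import Data.Nat.Coprimality as Coprime using (Coprime)
  import Data.Nat.DivMod as ℕ
  open import Data.Nat.Divisibility as ∣ using (_∣_; _∤_; _∣?_; divides)
  open import Data.Nat.ListAction using (product)
  open import Data.Nat.Primality using (Prime; prime?; prime⇒nonZero; prime⇒nonTrivial; prime⇒irreducible; euclidsLemma; ¬prime[0]; ¬prime[1])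
  open import Data.Nat.Primality.Factorisation using (factorise)
  import Data.Nat.Properties as ℕ
  open import Data.Product.Base using (∃; _×_; _,_; proj₁; proj₂)
  open import Data.Rational.Base as ℚ hiding (∣_∣)
  open import Data.Rational.Properties
  open import Data.Rational.Solver using (module +-*-Solver)
  open import Data.Sum.Base using (inj₁; inj₂)
  open import Function.Base using (_∘_)
  open import Relation.Binary.PropositionalEquality
  open import Relation.Nullary using (¬_; Dec; yes; no; does; contradiction)
  open import Relation.Nullary.Decidable using (¬?; _×-dec_)
  open +-*-Solver using (solve; _:=_; _:+_; _:*_; _:-_; con)

  -- Rational arithmetic and finite sums

  -- Polynomial inequalities are proved below by writing the difference of the two sides as a
  -- visibly nonnegative expression; the solver then only has to check an equation.
  ≤-by : ∀ {p q r s} → r ≤ s → s - r ≡ q - p → p ≤ q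
  ≤-by h eq = diff⇒≤ (subst (0ℚ ≤_) eq (≤⇒diff h))

  ≤-+ʳ : ∀ {p q} → 0ℚ ≤ q → p ≤ p + q
  ≤-+ʳ {p} {q} h = ≤-by h (solve 2 (λ p q → q :- con 0ℚ := p :+ q :- p) refl p q)

  ≤-*-cancelʳ : ∀ {p q r} → 0ℚ < r → p * r ≤ q * r → p ≤ q
  ≤-*-cancelʳ {r = r} 0<r h = *-cancelʳ-≤-pos r {{positive 0<r}} h

  *-monoʳ : ∀ {p q} r → 0ℚ ≤ r → p ≤ q → p * r ≤ q * r
  *-monoʳ r h = *-monoʳ-≤-nonNeg r {{nonNegative h}}

  *-monoˡ : ∀ {p q} r → 0ℚ ≤ r → p ≤ q → r * p ≤ r * q
  *-monoˡ r h = *-monoˡ-≤-nonNeg r {{nonNegative h}}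

  inv-* : ∀ {p q} → 0ℚ < p → 0ℚ < q → inv (p * q) ≡ inv p * inv q
  inv-* {p} {q} 0<p 0<q = begin
    inv (p * q)                           ≡⟨ *-identityʳ _ ⟨
    inv (p * q) * 1ℚ                      ≡⟨ cong (inv (p * q) *_) (cong₂ _*_ (*-inv 0<p) (*-inv 0<q)) ⟨
    inv (p * q) * (p * inv p * (q * inv q)) ≡⟨ solve 5 (λ z p q a b → z :* (p :* a :* (q :* b)) := p :* q :* z :* (a :* b))
                                                refl (inv (p * q)) p q (inv p) (inv q) ⟩
    p * q * inv (p * q) * (inv p * inv q) ≡⟨ cong (_* (inv p * inv q)) (*-inv (*-positive 0<p 0<q)) ⟩
    1ℚ * (inv p * inv q)                  ≡⟨ *-identityˡ _ ⟩
    inv p * inv q                         ∎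
    where open ≡-Reasoning

  *-cancel-inv : ∀ p {q} → 0ℚ < q → p * q * inv q ≡ p
  *-cancel-inv p {q} h = trans (*-assoc p q (inv q)) (trans (cong (p *_) (*-inv h)) (*-identityʳ p))

  *-inv-cancel : ∀ p {q} → 0ℚ < q → p * inv q * q ≡ p
  *-inv-cancel p {q} h = trans (solve 3 (λ p q i → p :* i :* q := p :* q :* i) refl p q (inv q)) (*-cancel-inv p h)

  inv-unique : ∀ {p q} → 0ℚ < p → p * q ≡ 1ℚ → q ≡ inv p
  inv-unique {p} {q} 0<p h = begin
    q               ≡⟨ *-cancel-inv q 0<p ⟨
    q * p * inv p   ≡⟨ cong (_* inv p) (trans (*-comm q p) h) ⟩
    1ℚ * inv p      ≡⟨ *-identityˡ _ ⟩
    inv p           ∎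
    where open ≡-Reasoning

  ι-pos′ : ∀ n .{{_ : ℕ.NonZero n}} → 0ℚ < ι n
  ι-pos′ (suc n) = ι-pos n

  inv-ι-nonneg : ∀ n → 0ℚ ≤ inv (ι n)
  inv-ι-nonneg zero    = ≤-refl
  inv-ι-nonneg (suc n) = inv-nonneg {ι (suc n)} (ι-pos n)

  inv-ι-* : ∀ m n .{{_ : ℕ.NonZero m}} .{{_ : ℕ.NonZero n}} → inv (ι (m ℕ.* n)) ≡ inv (ι m) * inv (ι n)
  inv-ι-* m n = trans (cong inv (ι-* m n)) (inv-* (ι-pos′ m) (ι-pos′ n))

  inv-ι-anti : ∀ {m n} .{{_ : ℕ.NonZero m}} → m ℕ.≤ n → inv (ι n) ≤ inv (ι m)
  inv-ι-anti {m} h = inv-anti (ι-pos′ m) (ι-mono h)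

  inv-ι≤1 : ∀ n → inv (ι n) ≤ 1ℚ
  inv-ι≤1 zero    = 0≤1
  inv-ι≤1 (suc n) = inv-ι-anti {1} {suc n} (ℕ.s≤s ℕ.z≤n)

  sum-cong-< : ∀ n {f g} → (∀ i → i ℕ.< n → f i ≡ g i) → sum n f ≡ sum n g
  sum-cong-< zero    h = refl
  sum-cong-< (suc n) h = cong₂ _+_ (sum-cong-< n (λ i i<n → h i (ℕ.m<n⇒m<1+n i<n))) (h n ℕ.≤-refl)

  sum-mono : ∀ n {f g} → (∀ i → i ℕ.< n → f i ≤ g i) → sum n f ≤ sum n g
  sum-mono zero    h = ≤-refl
  sum-mono (suc n) h = +-mono-≤ (sum-mono n (λ i i<n → h i (ℕ.m<n⇒m<1+n i<n))) (h n ℕ.≤-refl)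

  sum-zero : ∀ n {f} → (∀ i → i ℕ.< n → f i ≡ 0ℚ) → sum n f ≡ 0ℚ
  sum-zero zero    h = refl
  sum-zero (suc n) h = trans (cong₂ _+_ (sum-zero n (λ i i<n → h i (ℕ.m<n⇒m<1+n i<n))) (h n ℕ.≤-refl)) (+-identityʳ 0ℚ)

  sum-nonneg : ∀ n {f} → (∀ i → 0ℚ ≤ f i) → 0ℚ ≤ sum n f
  sum-nonneg zero    h = ≤-refl
  sum-nonneg (suc n) h = +-mono-≤ (sum-nonneg n h) (h n)

  sum-+ : ∀ n f g → sum n (λ i → f i + g i) ≡ sum n f + sum n g
  sum-+ zero    f g = refl
  sum-+ (suc n) f g = trans (cong (_+ (f n + g n)) (sum-+ n f g))
    (solve 4 (λ a b c d → a :+ b :+ (c :+ d) := a :+ c :+ (b :+ d)) refl (sum n f) (sum n g) (f n) (g n))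

  sum-*ˡ : ∀ n c f → sum n (λ i → c * f i) ≡ c * sum n f
  sum-*ˡ zero    c f = sym (*-zeroʳ c)
  sum-*ˡ (suc n) c f = trans (cong (_+ c * f n) (sum-*ˡ n c f)) (sym (*-distribˡ-+ c (sum n f) (f n)))

  sum-*ʳ : ∀ n c f → sum n (λ i → f i * c) ≡ sum n f * c
  sum-*ʳ n c f = trans (sum-cong n (λ i → *-comm (f i) c)) (trans (sum-*ˡ n c f) (*-comm c _))

  sum-swap : ∀ m n (f : ℕ → ℕ → ℚ) → sum m (λ i → sum n (f i)) ≡ sum n (λ j → sum m (λ i → f i j))
  sum-swap zero    n f = sym (sum-zero n (λ _ _ → refl))
  sum-swap (suc m) n f = trans (cong (_+ sum n (f m)) (sum-swap m n f))
    (sym (sum-+ n (λ j → sum m (λ i → f i j)) (f m)))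

  sum-suc : ∀ n f → sum (suc n) f ≡ f 0 + sum n (f ∘ suc)
  sum-suc zero    f = +-comm 0ℚ (f 0)
  sum-suc (suc n) f = trans (cong (_+ f (suc n)) (sum-suc n f)) (+-assoc (f 0) _ _)

  sum-extend : ∀ {m n f} → (∀ i → 0ℚ ≤ f i) → m ℕ.≤ n → sum m f ≤ sum n f
  sum-extend {m} {n} {f} h m≤n = subst (λ k → sum m f ≤ sum k f) (ℕ.m∸n+n≡m m≤n)
    (≤-trans (≤-+ʳ (sum-nonneg (n ℕ.∸ m) (λ i → h (i ℕ.+ m)))) (≤-reflexive (sym (sum-++ (n ℕ.∸ m) m f))))

  -- The decrements of `t` dominate `a`. Keeping `t (K + M)` on the left lets the induction close;
  -- it is dropped later as nonnegative.
  sum-telescope : ∀ M K (a t : ℕ → ℚ) → (∀ i → M ℕ.≤ i → a i + t (suc i) ≤ t i) →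
                  sum (K ℕ.+ M) a + t (K ℕ.+ M) ≤ sum M a + t M
  sum-telescope M zero    a t h = ≤-refl
  sum-telescope M (suc K) a t h = ≤-trans
    (≤-trans (≤-reflexive (+-assoc (sum (K ℕ.+ M) a) _ _)) (+-monoʳ-≤ (sum (K ℕ.+ M) a) (h (K ℕ.+ M) (ℕ.m≤n+m M K))))
    (sum-telescope M K a t h)

  -- Indicator functions and sums over multiples

  χ : ∀ {p} {P : Set p} → Dec P → ℚ
  χ P? = if does P? then 1ℚ else 0ℚ

  module _ {p} {P : Set p} where

    χ-yes : (P? : Dec P) → P → χ P? ≡ 1ℚ
    χ-yes (yes _) _ = refl
    χ-yes (no ¬p) p = contradiction p ¬p

    χ-no : (P? : Dec P) → ¬ P → χ P? ≡ 0ℚ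
    χ-no (yes p) ¬p = contradiction p ¬p
    χ-no (no _)  _  = refl

    0≤χ : (P? : Dec P) → 0ℚ ≤ χ P?
    0≤χ (yes _) = 0≤1
    0≤χ (no _)  = ≤-refl

    χ≤1 : (P? : Dec P) → χ P? ≤ 1ℚ
    χ≤1 (yes _) = ≤-refl
    χ≤1 (no _)  = 0≤1

    χ-cong : ∀ {q} {Q : Set q} (P? : Dec P) (Q? : Dec Q) → (P → Q) → (Q → P) → χ P? ≡ χ Q?
    χ-cong (yes p) Q? f g = sym (χ-yes′ Q? (f p))
      where
      χ-yes′ : ∀ {q} {Q : Set q} (Q? : Dec Q) → Q → χ Q? ≡ 1ℚ
      χ-yes′ (yes _) _ = refl
      χ-yes′ (no ¬q) q = contradiction q ¬q
    χ-cong (no ¬p) (yes q) f g = contradiction (g q) ¬p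
    χ-cong (no ¬p) (no ¬q) f g = refl

  sum₁-multiples : ∀ D .{{_ : ℕ.NonZero D}} N (a : ℕ → ℚ) →
    sum₁ N (λ n → χ (D ∣? n) * a n) ≡ sum₁ (N ℕ./ D) (λ m → a (D ℕ.* m))
  sum₁-multiples D@(suc D-1) N a = go N (N ℕ./ D) (N ℕ.% D) (ℕ.m≡m%n+[m/n]*n N D) (ℕ.m%n<n N D)
    where
    -- The residue s counts down with N. At s = 0 the last index is a multiple of D and contributes
    -- a term, and the residue restarts at D - 1.
    go : ∀ N q s → N ≡ s ℕ.+ q ℕ.* D → s ℕ.< D →
         sum₁ N (λ n → χ (D ∣? n) * a n) ≡ sum₁ q (λ m → a (D ℕ.* m))
    go zero    zero    s       eq s<D = refl
    go zero    (suc q) zero    ()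
    go zero    (suc q) (suc s) ()
    go (suc N) zero    zero    () s<D
    go (suc N) q       (suc s) eq s<D = trans (cong₂ _+_ (go N q s (ℕ.suc-injective eq) (ℕ.<-trans ℕ.≤-refl s<D))
        (trans (cong (_* a (suc N)) (χ-no (D ∣? suc N) ∤)) (*-zeroˡ (a (suc N))))) (+-identityʳ _)
      where
      ∤ : ¬ D ∣ suc N
      ∤ D∣ = ∣.>⇒∤ s<D (∣.∣m+n∣m⇒∣n (subst (D ∣_) (trans eq (ℕ.+-comm (suc s) (q ℕ.* D))) D∣) (∣.n∣m*n q))
    go (suc N) (suc q) zero    eq s<D = cong₂ _+_ (go N q D-1 (ℕ.suc-injective eq) ℕ.≤-refl)
        (trans (cong (_* a (suc N)) (χ-yes (D ∣? suc N) (divides (suc q) eq)))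
          (trans (*-identityˡ _) (cong a (trans eq (ℕ.*-comm (suc q) D)))))

  χ-complement : ∀ {p} {P : Set p} (P? : Dec P) q → q ≡ χ (¬? P?) * q + χ P? * q
  χ-complement (yes _) q = solve 1 (λ q → q := con 0ℚ :* q :+ con 1ℚ :* q) refl q
  χ-complement (no _)  q = solve 1 (λ q → q := con 1ℚ :* q :+ con 0ℚ :* q) refl q

  quotPow : ∀ p .{{_ : ℕ.NonZero p}} → ℕ → ℕ → ℕ
  quotPow p i X = (X ℕ./ p ℕ.^ i) {{ℕ.m^n≢0 p i}}

  quotPow-≤ : ∀ p .{{_ : ℕ.NonZero p}} i X → quotPow p i X ℕ.≤ X
  quotPow-≤ p i X = ℕ.m/n≤m X (p ℕ.^ i) {{ℕ.m^n≢0 p i}}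

  quotPow-suc : ∀ p .{{_ : ℕ.NonZero p}} i X → quotPow p i X ℕ./ p ≡ quotPow p (suc i) X
  quotPow-suc p i X = trans (ℕ.m/n/o≡m/[n*o] X (p ℕ.^ i) p {{m^n}} {{_}} {{n*m}})
    (ℕ./-congʳ {{n*m}} {{ℕ.m^n≢0 p (suc i)}} (ℕ.*-comm (p ℕ.^ i) p))
    where
    m^n = ℕ.m^n≢0 p i
    n*m = ℕ.m*n≢0 (p ℕ.^ i) p {{m^n}}

  ≤-quotPow : ∀ p .{{_ : ℕ.NonZero p}} i {r X} → p ℕ.^ i ℕ.* r ℕ.≤ X → r ℕ.≤ quotPow p i X
  ≤-quotPow p i {r} {X} h = ℕ.≤-trans (ℕ.≤-reflexive (sym (ℕ.m*n/n≡m r (p ℕ.^ i) {{m^n}})))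
    (ℕ./-monoˡ-≤ (p ℕ.^ i) {{m^n}} (subst (ℕ._≤ X) (ℕ.*-comm (p ℕ.^ i) r) h))
    where m^n = ℕ.m^n≢0 p i

  -- The m with exact power pⁱ are grouped for i < E; those divisible by pᴱ are left over.
  sum₁-split : ∀ p .{{_ : ℕ.NonZero p}} E X (a : ℕ → ℚ) →
    sum₁ X a ≡ sum E (λ i → sum₁ (quotPow p i X) (λ m → χ (¬? (p ∣? m)) * a (p ℕ.^ i ℕ.* m)))
               + sum₁ (quotPow p E X) (λ m → a (p ℕ.^ E ℕ.* m))
  sum₁-split p zero X a = sym (trans (+-identityˡ _)
    (trans (cong (λ k → sum₁ k (λ m → a (1 ℕ.* m))) (ℕ.n/1≡n X)) (sum-cong X (λ i → cong a (ℕ.*-identityˡ (suc i))))))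
  sum₁-split p (suc E) X a = trans (sum₁-split p E X a)
    (trans (cong (λ z → S + z) split₁) (sym (+-assoc S (sum₁ Q (λ m → χ (¬? (p ∣? m)) * a′ m)) _)))
    where
    Q = quotPow p E X
    a′ = λ m → a (p ℕ.^ E ℕ.* m)
    S = sum E (λ i → sum₁ (quotPow p i X) (λ m → χ (¬? (p ∣? m)) * a (p ℕ.^ i ℕ.* m)))
    split₁ : sum₁ Q a′ ≡ sum₁ Q (λ m → χ (¬? (p ∣? m)) * a′ m)
                         + sum₁ (quotPow p (suc E) X) (λ m → a (p ℕ.^ suc E ℕ.* m))
    split₁ = begin
      sum₁ Q a′
        ≡⟨ sum-cong Q (λ i → χ-complement (p ∣? suc i) (a′ (suc i))) ⟩
      sum₁ Q (λ m → χ (¬? (p ∣? m)) * a′ m + χ (p ∣? m) * a′ m)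
        ≡⟨ sum-+ Q _ _ ⟩
      sum₁ Q (λ m → χ (¬? (p ∣? m)) * a′ m) + sum₁ Q (λ m → χ (p ∣? m) * a′ m)
        ≡⟨ cong (λ z → sum₁ Q (λ m → χ (¬? (p ∣? m)) * a′ m) + z) (sum₁-multiples p Q a′) ⟩
      sum₁ Q (λ m → χ (¬? (p ∣? m)) * a′ m) + sum₁ (Q ℕ./ p) (λ m → a (p ℕ.^ E ℕ.* (p ℕ.* m)))
        ≡⟨ cong (λ z → sum₁ Q (λ m → χ (¬? (p ∣? m)) * a′ m) + z)
             (trans (cong (λ k → sum₁ k (λ m → a (p ℕ.^ E ℕ.* (p ℕ.* m)))) (quotPow-suc p E X))
                    (sum-cong (quotPow p (suc E) X) (λ i → cong a (shift (suc i))))) ⟩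
      sum₁ Q (λ m → χ (¬? (p ∣? m)) * a′ m) + sum₁ (quotPow p (suc E) X) (λ m → a (p ℕ.^ suc E ℕ.* m)) ∎
      where
      open ≡-Reasoning
      shift : ∀ m → p ℕ.^ E ℕ.* (p ℕ.* m) ≡ p ℕ.^ suc E ℕ.* m
      shift m = trans (sym (ℕ.*-assoc (p ℕ.^ E) p m)) (cong (ℕ._* m) (ℕ.*-comm (p ℕ.^ E) p))

  -- The generalized gcd

  prime-coprime : ∀ {p d} → Prime p → p ∤ d → Coprime d p
  prime-coprime pr p∤d (k∣d , k∣p) with prime⇒irreducible pr k∣p
  ... | inj₁ k≡1 = k≡1
  ... | inj₂ refl = contradiction k∣d p∤d

  ∣-cancel-^ : ∀ {p d n} → Prime p → p ∤ d → ∀ i → d ∣ p ℕ.^ i ℕ.* n → d ∣ n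
  ∣-cancel-^ {d = d} {n} pr p∤d zero    h = subst (d ∣_) (ℕ.*-identityˡ n) h
  ∣-cancel-^ {p} {d} {n} pr p∤d (suc i) h = ∣-cancel-^ pr p∤d i
    (Coprime.coprime-divisor (prime-coprime pr p∤d) (subst (d ∣_) (ℕ.*-assoc p (p ℕ.^ i) n) h))

  ∣-prime-^ : ∀ {p} → Prime p → ∀ d b → p ∣ d ℕ.^ b → p ∣ d
  ∣-prime-^ pr d zero    h = contradiction (∣.∣1⇒≡1 h) λ { refl → ¬prime[1] pr }
  ∣-prime-^ pr d (suc b) h with euclidsLemma d (d ℕ.^ b) pr h
  ... | inj₁ p∣d = p∣d
  ... | inj₂ p∣d^b = ∣-prime-^ pr d b p∣d^b

  ^-pres-∣ : ∀ {m n} b → m ∣ n → m ℕ.^ b ∣ n ℕ.^ b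
  ^-pres-∣ zero    h = ∣.∣-refl
  ^-pres-∣ (suc b) h = ∣.*-pres-∣ h (^-pres-∣ b h)

  ^-monoʳ-∣ : ∀ p {i j} → i ℕ.≤ j → p ℕ.^ i ∣ p ℕ.^ j
  ^-monoʳ-∣ p {j = j} ℕ.z≤n     = ∣.1∣ (p ℕ.^ j)
  ^-monoʳ-∣ p         (ℕ.s≤s h) = ∣.*-monoʳ-∣ p (^-monoʳ-∣ p h)

  ^-distribʳ-* : ∀ b m n → (m ℕ.* n) ℕ.^ b ≡ m ℕ.^ b ℕ.* n ℕ.^ b
  ^-distribʳ-* zero    m n = refl
  ^-distribʳ-* (suc b) m n = trans (cong (m ℕ.* n ℕ.*_) (^-distribʳ-* b m n)) (ℕ.[m*n]*[o*p]≡[m*o]*[n*p] m n (m ℕ.^ b) (n ℕ.^ b))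

  ^-∣-bound : ∀ {p a i r} .{{_ : ℕ.NonZero p}} → p ∤ r → p ℕ.^ i ∣ p ℕ.^ a ℕ.* r → i ℕ.≤ a
  ^-∣-bound {p} {a} {i} {r} p∤r h with i ℕ.≤? a
  ... | yes i≤a = i≤a
  ... | no  i≰a = contradiction
    (∣.*-cancelˡ-∣ (p ℕ.^ a) {{ℕ.m^n≢0 p a}} (subst (_∣ p ℕ.^ a ℕ.* r) (ℕ.*-comm p (p ℕ.^ a))
      (∣.∣-trans (^-monoʳ-∣ p (ℕ.≰⇒> i≰a)) h))) p∤r

  m≤m^n : ∀ m n .{{_ : ℕ.NonZero n}} → m ℕ.≤ m ℕ.^ n
  m≤m^n zero    n       = ℕ.z≤n
  m≤m^n m@(suc _) (suc n) = ℕ.m≤m*n m (m ℕ.^ n) {{ℕ.m^n≢0 m n}}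

  ∈⇒≤maximum : ∀ {x xs} → x ∈ xs → x ℕ.≤ maximum xs
  ∈⇒≤maximum {xs = y ∷ xs} (here refl) = ℕ.m≤m⊔n y (maximum xs)
  ∈⇒≤maximum {xs = y ∷ xs} (there h)   = ℕ.≤-trans (∈⇒≤maximum h) (ℕ.m≤n⊔m y (maximum xs))

  maximum-∈-∷ : ∀ x xs → maximum (x ∷ xs) ∈ x ∷ xs
  maximum-∈-∷ x []       = here (ℕ.⊔-identityʳ x)
  maximum-∈-∷ x (y ∷ xs) with maximum (y ∷ xs) | maximum-∈-∷ y xs | ℕ.⊔-sel x (maximum (y ∷ xs))
  ... | _ | h | inj₁ eq = here eq
  ... | m | h | inj₂ eq = there (subst (_∈ y ∷ xs) (sym eq) h)

  maximum-∈ : ∀ {x} xs → x ∈ xs → maximum xs ∈ xs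
  maximum-∈ (x ∷ xs) _ = maximum-∈-∷ x xs

  CommonPower : (b m n d : ℕ) → Set
  CommonPower b m n d = d ℕ.^ b ∣ m × d ℕ.^ b ∣ n

  module _ (b : ℕ) .{{_ : ℕ.NonZero b}} where

    module _ (m : ℕ) .{{_ : ℕ.NonZero m}} (n : ℕ) where

      private
        P? = λ d → (d ℕ.^ b ∣? m) ×-dec (d ℕ.^ b ∣? n)

        member : ∀ {d} → CommonPower b m n d → d ∈ filter P? (applyUpTo suc m)
        member {zero}  (h , _) = contradiction (∣.0∣⇒≡0 (subst (_∣ m) (0^ b) h)) (ℕ.≢-nonZero⁻¹ m)
          where
          0^ : ∀ b .{{_ : ℕ.NonZero b}} → 0 ℕ.^ b ≡ 0
          0^ (suc _) = refl
        member {suc d} (h , h′) = ∈-filter⁺ P?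
          (∈-applyUpTo⁺ suc (ℕ.≤-trans (m≤m^n (suc d) b) (∣.∣⇒≤ h))) (h , h′)

        max-member : ggcd b m n ∈ filter P? (applyUpTo suc m)
        -- Since 1 always qualifies, the list is nonempty and the maximum is not the default value
        -- 0.
        max-member = maximum-∈ _ (member {1} (subst (λ k → k ∣ m × k ∣ n) (sym (ℕ.^-zeroˡ b)) (∣.1∣ m , ∣.1∣ n)))

      ggcd-common : CommonPower b m n (ggcd b m n)
      ggcd-common = proj₂ (∈-filter⁻ P? {xs = applyUpTo suc m} max-member)

      ggcd-greatest : ∀ {d} → CommonPower b m n d → d ℕ.≤ ggcd b m n
      ggcd-greatest h = ∈⇒≤maximum (member h)

      ggcd≢0 : ℕ.NonZero (ggcd b m n)
      ggcd≢0 with _ , _ , eq ← ∈-applyUpTo⁻ suc (proj₁ (∈-filter⁻ P? {xs = applyUpTo suc m} max-member)) =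
        subst ℕ.NonZero (sym eq) _

    -- `ggcd` depends only on the set of common d, so most identities below reduce to two
    -- divisibility arguments.
    ggcd-cong : ∀ {m m′ n n′} .{{_ : ℕ.NonZero m}} .{{_ : ℕ.NonZero m′}} →
      (∀ d → CommonPower b m n d → CommonPower b m′ n′ d) →
      (∀ d → CommonPower b m′ n′ d → CommonPower b m n d) → ggcd b m n ≡ ggcd b m′ n′
    ggcd-cong {m} {m′} {n} {n′} f g = ℕ.≤-antisym
      (ggcd-greatest m′ n′ (f _ (ggcd-common m n))) (ggcd-greatest m n (g _ (ggcd-common m′ n′)))

    ggcd-periodic : ∀ j r .{{_ : ℕ.NonZero j}} .{{_ : ℕ.NonZero (j ℕ.+ r)}} → ggcd b (j ℕ.+ r) r ≡ ggcd b j r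
    ggcd-periodic j r = ggcd-cong
      (λ d (h , h′) → ∣.∣m+n∣m⇒∣n (subst (d ℕ.^ b ∣_) (ℕ.+-comm j r) h) h′ , h′)
      (λ d (h , h′) → ∣.∣m∣n⇒∣m+n h h′ , h′)

    module _ {p : ℕ} (pr : Prime p) where

      private instance
        p≢0 = prime⇒nonZero pr

      -- When p^b is not a common divisor, no common d is a multiple of p; hence d^b is prime to p
      -- and p^a cancels.
      ggcd-∤ : ∀ j a r .{{_ : ℕ.NonZero j}} → p ∤ r → ¬ (p ℕ.^ b ∣ j × p ℕ.^ b ∣ p ℕ.^ a ℕ.* r) →
               ggcd b j (p ℕ.^ a ℕ.* r) ≡ ggcd b j r
      ggcd-∤ j a r p∤r h = ggcd-cong
        (λ d (u , v) → u , ∣-cancel-^ pr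
          (λ p∣d^b → let p^b∣d^b = ^-pres-∣ b (∣-prime-^ pr d b p∣d^b)
                      in h (∣.∣-trans p^b∣d^b u , ∣.∣-trans p^b∣d^b v)) a v)
        (λ d (u , v) → u , ∣.∣n⇒∣m*n (p ℕ.^ a) v)

      ggcd-coprime-^ : ∀ j i r .{{_ : ℕ.NonZero j}} .{{_ : ℕ.NonZero (p ℕ.^ i ℕ.* j)}} → p ∤ r →
                       ggcd b (p ℕ.^ i ℕ.* j) r ≡ ggcd b j r
      ggcd-coprime-^ j i r p∤r = ggcd-cong
        (λ d (u , v) → ∣-cancel-^ pr (λ p∣d^b → p∤r (∣.∣-trans p∣d^b v)) i u , v)
        (λ d (u , v) → ∣.∣n⇒∣m*n (p ℕ.^ i) u , v)

      -- A common d is either prime to p, and then d^b already divides j and n, or of the form e p,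
      -- and then p^b cancels and e is a common value for j and n.
      ggcd-scale : ∀ j n .{{_ : ℕ.NonZero j}} .{{_ : ℕ.NonZero (p ℕ.^ b ℕ.* j)}} →
                   ggcd b (p ℕ.^ b ℕ.* j) (p ℕ.^ b ℕ.* n) ≡ p ℕ.* ggcd b j n
      ggcd-scale j n = ℕ.≤-antisym (bound _ (ggcd-common (p ℕ.^ b ℕ.* j) (p ℕ.^ b ℕ.* n)))
        (ggcd-greatest _ _ (scale j (proj₁ g-common) , scale n (proj₂ g-common)))
        where
        g = ggcd b j n
        g-common = ggcd-common j n
        scale : ∀ k → g ℕ.^ b ∣ k → (p ℕ.* g) ℕ.^ b ∣ p ℕ.^ b ℕ.* k
        scale k h = subst (_∣ p ℕ.^ b ℕ.* k) (sym (^-distribʳ-* b p g)) (∣.*-monoʳ-∣ (p ℕ.^ b) h)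
        bound : ∀ d → CommonPower b (p ℕ.^ b ℕ.* j) (p ℕ.^ b ℕ.* n) d → d ℕ.≤ p ℕ.* g
        bound d (u , v) with p ∣? d
        ... | no p∤d = ℕ.≤-trans (ggcd-greatest j n (∣-cancel-^ pr p∤d^b b u , ∣-cancel-^ pr p∤d^b b v)) (ℕ.m≤n*m g p)
          where p∤d^b = λ h → p∤d (∣-prime-^ pr d b h)
        ... | yes (divides e refl) = ℕ.≤-trans (ℕ.≤-reflexive (ℕ.*-comm e p))
          (ℕ.*-monoʳ-≤ p (ggcd-greatest j n (cancel j u , cancel n v)))
          where
          cancel : ∀ k → (e ℕ.* p) ℕ.^ b ∣ p ℕ.^ b ℕ.* k → e ℕ.^ b ∣ k
          cancel k h = ∣.*-cancelˡ-∣ (p ℕ.^ b) {{ℕ.m^n≢0 p b}}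
            (subst (_∣ p ℕ.^ b ℕ.* k) (trans (^-distribʳ-* b e p) (ℕ.*-comm (e ℕ.^ b) (p ℕ.^ b))) h)

  -- The sum of 1/(j,n)_b at a prime power times a coprime cofactor

  sum-periodic : ∀ q r f → (∀ i → f (i ℕ.+ r) ≡ f i) → sum (q ℕ.* r) f ≡ ι q * sum r f
  sum-periodic zero    r f h = sym (*-zeroˡ (sum r f))
  sum-periodic (suc q) r f h = begin
    sum (r ℕ.+ q ℕ.* r) f                                  ≡⟨ sum-++ r (q ℕ.* r) f ⟩
    sum (q ℕ.* r) f + sum r (λ j → f (j ℕ.+ q ℕ.* r))      ≡⟨ cong₂ _+_ (sum-periodic q r f h) (sum-cong r (shift q)) ⟩
    ι q * sum r f + sum r f                                ≡⟨ ι-suc-* q (sum r f) ⟨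
    ι (suc q) * sum r f                                    ∎
    where
    open ≡-Reasoning
    shift : ∀ q j → f (j ℕ.+ q ℕ.* r) ≡ f j
    shift zero    j = cong f (ℕ.+-identityʳ j)
    shift (suc q) j = trans (cong f (trans (cong (j ℕ.+_) (ℕ.+-comm r (q ℕ.* r))) (sym (ℕ.+-assoc j (q ℕ.* r) r))))
                      (trans (h (j ℕ.+ q ℕ.* r)) (shift q j))

  weight : (b j n : ℕ) → ℚ
  weight b j n = 1ℚ ÷₀ ι (ggcd b j n)

  gcdSum : (b n : ℕ) → ℚ
  gcdSum b n = sum₁ n (λ j → weight b j n)

  module _ (b : ℕ) .{{_ : ℕ.NonZero b}} where

    gcdSum-blocks : ∀ q r → sum₁ (q ℕ.* r) (λ j → weight b j r) ≡ ι q * gcdSum b r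
    gcdSum-blocks q r = sum-periodic q r _ (λ i → cong (λ g → 1ℚ ÷₀ ι g) (ggcd-periodic b (suc i) r))

    module _ {p : ℕ} (pr : Prime p) where

      private instance
        p≢0 = prime⇒nonZero pr
        p^b≢0 = ℕ.m^n≢0 p b

      -- For a < b the prime p does not affect (j, p^a r)_b, which leaves p^a full periods of
      -- (j,r)_b.
      gcdSum-below : ∀ a r → a ℕ.< b → p ∤ r → gcdSum b (p ℕ.^ a ℕ.* r) ≡ ι (p ℕ.^ a) * gcdSum b r
      gcdSum-below a r a<b p∤r = trans
        (sum-cong (p ℕ.^ a ℕ.* r) (λ i → cong (λ g → 1ℚ ÷₀ ι g) (ggcd-∤ b pr (suc i) a r p∤r
          (λ (_ , h) → ℕ.<⇒≱ a<b (^-∣-bound p∤r h)))))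
        (gcdSum-blocks (p ℕ.^ a) r)

      -- With n = p^b p^a r, the j not divisible by p^b satisfy (j,n)_b = (j,r)_b, and those
      -- divisible by p^b reproduce the sum for p^a r with weights divided by p. Splitting the p^b
      -- p^a full periods of (j,r)_b in the same way eliminates the sum over the j not divisible by
      -- p^b.
      gcdSum-step : ∀ a r → p ∤ r →
        gcdSum b (p ℕ.^ b ℕ.* (p ℕ.^ a ℕ.* r)) + ι (p ℕ.^ a) * gcdSum b r
          ≡ ι (p ℕ.^ b) * ι (p ℕ.^ a) * gcdSum b r + inv (ι p) * gcdSum b (p ℕ.^ a ℕ.* r)
      gcdSum-step a r p∤r = begin
        gcdSum b n + x
          ≡⟨ cong (_+ x) eq₁ ⟩
        X + inv (ι p) * gcdSum b n′ + x
          ≡⟨ solve 3 (λ X y z → X :+ y :+ z := X :+ z :+ y) refl X _ x ⟩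
        X + x + inv (ι p) * gcdSum b n′
          ≡⟨ cong (_+ inv (ι p) * gcdSum b n′) eq₂ ⟨
        ι (p ℕ.^ b) * ι (p ℕ.^ a) * gcdSum b r + inv (ι p) * gcdSum b n′ ∎
        where
        open ≡-Reasoning
        D = p ℕ.^ b
        n′ = p ℕ.^ a ℕ.* r
        n = D ℕ.* n′
        x = ι (p ℕ.^ a) * gcdSum b r
        X = sum₁ n (λ j → χ (¬? (D ∣? j)) * weight b j r)
        n≡ : n ≡ p ℕ.^ (b ℕ.+ a) ℕ.* r
        n≡ = trans (sym (ℕ.*-assoc D (p ℕ.^ a) r)) (cong (ℕ._* r) (sym (ℕ.^-distribˡ-+-* p b a)))
        n/D : n ℕ./ D ≡ n′
        n/D = trans (cong (ℕ._/ D) (ℕ.*-comm D n′)) (ℕ.m*n/n≡m n′ D)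
        split : ∀ (f : ℕ → ℚ) → sum₁ n f ≡ sum₁ n (λ j → χ (¬? (D ∣? j)) * f j) + sum₁ n′ (λ m → f (D ℕ.* m))
        split f = trans (sum-cong n (λ i → χ-complement (D ∣? suc i) (f (suc i))))
          (trans (sum-+ n _ _) (cong (λ z → sum₁ n (λ j → χ (¬? (D ∣? j)) * f j) + z)
            (trans (sum₁-multiples D n f) (cong (λ k → sum₁ k (λ m → f (D ℕ.* m))) n/D))))
        away : ∀ i → χ (¬? (D ∣? suc i)) * weight b (suc i) n ≡ χ (¬? (D ∣? suc i)) * weight b (suc i) r
        away i with D ∣? suc i
        ... | yes _ = trans (*-zeroˡ (weight b (suc i) n)) (sym (*-zeroˡ (weight b (suc i) r)))
        ... | no D∤ = cong (λ g → 1ℚ * (1ℚ ÷₀ ι g)) (trans (cong (ggcd b (suc i)) n≡)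
                        (ggcd-∤ b pr (suc i) (b ℕ.+ a) r p∤r (λ (h , _) → D∤ h)))
        scaled : ∀ i → weight b (D ℕ.* suc i) n ≡ inv (ι p) * weight b (suc i) n′
        scaled i = trans (cong (λ g → 1ℚ ÷₀ ι g) (ggcd-scale b pr (suc i) n′ {{_}} {{ℕ.m*n≢0 D (suc i)}}))
          (trans (cong (1ℚ *_) (inv-ι-* p (ggcd b (suc i) n′) {{p≢0}} {{ggcd≢0 b (suc i) n′}}))
            (solve 3 (λ o x y → o :* (x :* y) := x :* (o :* y)) refl 1ℚ (inv (ι p)) (inv (ι (ggcd b (suc i) n′)))))
        eq₁ : gcdSum b n ≡ X + inv (ι p) * gcdSum b n′
        eq₁ = trans (split (λ j → weight b j n))
          (cong₂ _+_ (sum-cong n away) (trans (sum-cong n′ scaled) (sum-*ˡ n′ (inv (ι p)) _)))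
        eq₂ : ι (p ℕ.^ b) * ι (p ℕ.^ a) * gcdSum b r ≡ X + x
        eq₂ = trans (cong (_* gcdSum b r) (sym (ι-* D (p ℕ.^ a))))
          (trans (sym (gcdSum-blocks (D ℕ.* p ℕ.^ a) r))
          (trans (cong (λ k → sum₁ k (λ j → weight b j r)) (ℕ.*-assoc D (p ℕ.^ a) r))
          (trans (split (λ j → weight b j r))
            (cong (λ z → X + z) (trans
              (sum-cong n′ (λ i → cong (λ g → 1ℚ ÷₀ ι g) (ggcd-coprime-^ b pr (suc i) b r {{_}} {{ℕ.m*n≢0 D (suc i)}} p∤r)))
              (gcdSum-blocks (p ℕ.^ a) r))))))

  -- Local factors

  ÷-≤ : ∀ {a c d e} → 0ℚ < d → 0ℚ < e → a * e ≤ c * d → a * inv d ≤ c * inv e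
  ÷-≤ {a} {c} {d} {e} 0<d 0<e h = ≤-*-cancelʳ (*-positive 0<d 0<e) (subst₂ _≤_
    (trans (sym (*-identityʳ (a * e))) (trans (cong (a * e *_) (sym (*-inv 0<d)))
      (solve 4 (λ a e d i → a :* e :* (d :* i) := a :* i :* (d :* e)) refl a e d (inv d))))
    (trans (sym (*-identityʳ (c * d))) (trans (cong (c * d *_) (sym (*-inv 0<e)))
      (solve 4 (λ c d e i → c :* d :* (e :* i) := c :* i :* (d :* e)) refl c d e (inv e))))
    h)

  module _ (b : ℕ) where

    private
      Q : ℕ → ℚ
      Q p = ι (p ℕ.^ (b ℕ.+ 1))

      q^ : ℕ → ℕ → ℚ
      q^ p k = ι (p ℕ.^ (k ℕ.* (b ℕ.+ 1)))

    localDen : (p k : ℕ) → ℚ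
    localDen p k = q^ p k * (Q p - ι p) + ι p - 1ℚ

    -- H_b(p^a) for k = ⌊a/b⌋.
    localH : (p k : ℕ) → ℚ
    localH p k = (Q p - 1ℚ) * q^ p k * inv (localDen p k)

    private
      Q≡ : ∀ p → Q p ≡ ι (p ℕ.^ b) * ι p
      Q≡ p = trans (cong ι (trans (ℕ.^-distribˡ-+-* p b 1) (cong (p ℕ.^ b ℕ.*_) (ℕ.*-identityʳ p)))) (ι-* (p ℕ.^ b) p)

      q^-suc : ∀ p k → q^ p (suc k) ≡ Q p * q^ p k
      q^-suc p k = trans (cong ι (ℕ.^-distribˡ-+-* p (b ℕ.+ 1) (k ℕ.* (b ℕ.+ 1)))) (ι-* (p ℕ.^ (b ℕ.+ 1)) _)

      den-zero : ∀ p → localDen p 0 ≡ Q p - 1ℚ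
      den-zero p = solve 2 (λ q π → con 1ℚ :* (q :- π) :+ π :- con 1ℚ := q :- con 1ℚ) refl (Q p) (ι p)

      module _ {p : ℕ} (2≤p : 2 ℕ.≤ p) where

        instance
          p≢0 : ℕ.NonZero p
          p≢0 = ℕ.>-nonZero (ℕ.≤-trans (ℕ.s≤s ℕ.z≤n) 2≤p)

        1<π : 1ℚ < ι p
        1<π = <-≤-trans {1ℚ} {ι 2} (*<* (ℤ.+<+ (ℕ.s≤s (ℕ.s≤s ℕ.z≤n)))) (ι-mono 2≤p)

        0<π-1 : 0ℚ < ι p - 1ℚ
        0<π-1 = subst (_< ι p - 1ℚ) (+-inverseʳ 1ℚ) (+-monoˡ-< (- 1ℚ) 1<π)

        0<q^ : ∀ k → 0ℚ < q^ p k
        0<q^ k = ι-pos′ (p ℕ.^ (k ℕ.* (b ℕ.+ 1))) {{ℕ.m^n≢0 p (k ℕ.* (b ℕ.+ 1))}}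

        0≤Q-π : 0ℚ ≤ Q p - ι p
        0≤Q-π = ≤⇒diff (ι-mono (ℕ.≤-trans (ℕ.≤-reflexive (sym (ℕ.*-identityʳ p))) (ℕ.^-monoʳ-≤ p (ℕ.m≤n+m 1 b))))

        0<den : ∀ k → 0ℚ < localDen p k
        0<den k = <-≤-trans 0<π-1 (≤-by (*-nonneg (<⇒≤ (0<q^ k)) 0≤Q-π)
          (solve 3 (λ q d π → q :* d :- con 0ℚ := q :* d :+ π :- con 1ℚ :- (π :- con 1ℚ)) refl (q^ p k) (Q p - ι p) (ι p)))

        0<Q-1 : 0ℚ < Q p - 1ℚ
        0<Q-1 = subst (0ℚ <_) (den-zero p) (0<den 0)

    module _ {p : ℕ} (2≤p : 2 ℕ.≤ p) where

      localH-zero : localH p 0 ≡ 1ℚ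
      localH-zero = trans (cong₂ _*_ (*-identityʳ (Q p - 1ℚ)) (cong inv (den-zero p))) (*-inv (0<Q-1 2≤p))

      localH-nonneg : ∀ k → 0ℚ ≤ localH p k
      localH-nonneg k = *-nonneg (*-nonneg (<⇒≤ (0<Q-1 2≤p)) (<⇒≤ (0<q^ 2≤p k))) (inv-nonneg (0<den 2≤p k))

      -- After cross-multiplication the difference is (Q - 1) q^k (Q - 1) (p - 1), where Q =
      -- p^(b+1). This is what makes f nonnegative.
      localH-mono : ∀ k → localH p k ≤ localH p (suc k)
      localH-mono k = ÷-≤ {(Q p - 1ℚ) * q^ p k} {(Q p - 1ℚ) * q^ p (suc k)} (0<den 2≤p k) (0<den 2≤p (suc k)) (≤-by
        (*-nonneg (*-nonneg (<⇒≤ (0<Q-1 2≤p)) (<⇒≤ (0<q^ 2≤p k))) (*-nonneg (<⇒≤ (0<Q-1 2≤p)) (<⇒≤ (0<π-1 2≤p))))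
        (trans (solve 3 (λ Q π q → (Q :- con 1ℚ) :* q :* ((Q :- con 1ℚ) :* (π :- con 1ℚ)) :- con 0ℚ
                  := (Q :- con 1ℚ) :* (Q :* q) :* (q :* (Q :- π) :+ π :- con 1ℚ)
                  :- (Q :- con 1ℚ) :* q :* ((Q :* q) :* (Q :- π) :+ π :- con 1ℚ))
                 refl (Q p) (ι p) (q^ p k))
          (cong (λ z → (Q p - 1ℚ) * z * localDen p k - (Q p - 1ℚ) * q^ p k * (z * (Q p - ι p) + ι p - 1ℚ))
            (sym (q^-suc p k)))))

      -- With the denominator cleared the difference is q^k (Q - p³ + p² - 1) + p² (p - 1), and b ≥
      -- 2 gives Q ≥ p³. The bound p²/(p² - 1) is uniform in k and has a telescoping product over
      -- the integers.
      localH-bound : 2 ℕ.≤ b → ∀ k → localH p k * (ι p * ι p - 1ℚ) ≤ ι p * ι p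
      localH-bound 2≤b k = ≤-*-cancelʳ (0<den 2≤p k) (≤-by
        (+-mono-≤ (*-nonneg (<⇒≤ (0<q^ 2≤p k)) (+-mono-≤ Q≥π³ 1≤π²))
                  (*-nonneg (*-nonneg (ι-nonneg p) (ι-nonneg p)) (<⇒≤ (0<π-1 2≤p))))
        (trans (solve 3 (λ Q π q → q :* (Q :- π :* π :* π :+ (π :* π :- con 1ℚ)) :+ π :* π :* (π :- con 1ℚ) :- (con 0ℚ :+ con 0ℚ)
                  := π :* π :* (q :* (Q :- π) :+ π :- con 1ℚ) :- (Q :- con 1ℚ) :* q :* (π :* π :- con 1ℚ))
                 refl (Q p) (ι p) (q^ p k))
          (cong (λ z → ι p * ι p * localDen p k - z) (sym undo))))
        where
        undo : localH p k * (ι p * ι p - 1ℚ) * localDen p k ≡ (Q p - 1ℚ) * q^ p k * (ι p * ι p - 1ℚ)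
        undo = trans (solve 4 (λ x i y d → x :* i :* y :* d := x :* y :* (d :* i)) refl
                       ((Q p - 1ℚ) * q^ p k) (inv (localDen p k)) (ι p * ι p - 1ℚ) (localDen p k))
               (trans (cong ((Q p - 1ℚ) * q^ p k * (ι p * ι p - 1ℚ) *_) (*-inv (0<den 2≤p k))) (*-identityʳ _))
        instance _ = p≢0 2≤p
        Q≥π³ : 0ℚ ≤ Q p - ι p * ι p * ι p
        Q≥π³ = ≤⇒diff (≤-trans (≤-reflexive (trans (cong (_* ι p) (sym (ι-* p p))) (sym (ι-* (p ℕ.* p) p))))
          (ι-mono (ℕ.≤-trans (ℕ.≤-reflexive p³) (ℕ.^-monoʳ-≤ p (ℕ.+-monoˡ-≤ 1 2≤b)))))
          where
          p³ : p ℕ.* p ℕ.* p ≡ p ℕ.^ 3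
          p³ = trans (ℕ.*-assoc p p p) (cong (λ z → p ℕ.* (p ℕ.* z)) (sym (ℕ.*-identityʳ p)))
        1≤π² : 0ℚ ≤ ι p * ι p - 1ℚ
        1≤π² = ≤⇒diff (*-mono {1ℚ} {ι p} {1ℚ} {ι p} 0≤1 (<⇒≤ (1<π 2≤p)) 0≤1 (<⇒≤ (1<π 2≤p)))

      -- Because p^k p^(kb) = q^k, the summand in the constant is h_k(p) (p^k)^-b, the contribution
      -- of p^k to the Euler product of Σ H_b(m^b)/m^b.
      localTerm≡localH : ∀ k → (Q p - 1ℚ) * localTerm b p k ≡ localH p k * inv (ι (p ℕ.^ (k ℕ.* b)))
      localTerm≡localH k = begin
        (Q p - 1ℚ) * (ι (p ℕ.^ k) * i)
          ≡⟨ cong (λ z → (Q p - 1ℚ) * (z * i)) (sym (*-cancel-inv (ι (p ℕ.^ k)) 0<pᵏᵇ)) ⟩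
        (Q p - 1ℚ) * (ι (p ℕ.^ k) * ι (p ℕ.^ (k ℕ.* b)) * inv (ι (p ℕ.^ (k ℕ.* b))) * i)
          ≡⟨ solve 4 (λ Q z j i → Q :* (z :* j :* i) := Q :* z :* i :* j) refl (Q p - 1ℚ) _ _ i ⟩
        (Q p - 1ℚ) * (ι (p ℕ.^ k) * ι (p ℕ.^ (k ℕ.* b))) * i * inv (ι (p ℕ.^ (k ℕ.* b)))
          ≡⟨ cong (λ z → (Q p - 1ℚ) * z * i * inv (ι (p ℕ.^ (k ℕ.* b)))) eq ⟩
        localH p k * inv (ι (p ℕ.^ (k ℕ.* b))) ∎
        where
        open ≡-Reasoning
        i = inv (localDen p k)
        0<pᵏᵇ : 0ℚ < ι (p ℕ.^ (k ℕ.* b))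
        0<pᵏᵇ = ι-pos′ _ {{ℕ.m^n≢0 p (k ℕ.* b) {{p≢0 2≤p}}}}
        eq : ι (p ℕ.^ k) * ι (p ℕ.^ (k ℕ.* b)) ≡ q^ p k
        eq = trans (sym (ι-* (p ℕ.^ k) (p ℕ.^ (k ℕ.* b)))) (cong ι (trans (sym (ℕ.^-distribˡ-+-* p k (k ℕ.* b)))
          (cong (p ℕ.^_) (trans (sym (ℕ.*-suc k b)) (cong (k ℕ.*_) (ℕ.+-comm 1 b))))))

    module _ .{{_ : ℕ.NonZero b}} {p} (pr : Prime p) {r : ℕ} (p∤r : p ∤ r) where

      private
        2≤p = ℕ.nonTrivial⇒n>1 p {{prime⇒nonTrivial pr}}

        -- Solves the recursion `gcdSum-step` by induction on k: each step raises the exponent by b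
        -- and keeps the residue s. Denominators are cleared so that the solver applies.
        den-gcdSum : ∀ s k → s ℕ.< b →
          gcdSum b (p ℕ.^ (k ℕ.* b ℕ.+ s) ℕ.* r) * ((Q p - 1ℚ) * q^ p k)
            ≡ localDen p k * (ι (p ℕ.^ (k ℕ.* b ℕ.+ s)) * gcdSum b r)
        den-gcdSum s zero    s<b = trans (cong (_* ((Q p - 1ℚ) * 1ℚ)) (gcdSum-below b pr s r s<b p∤r))
          (solve 3 (λ x Q π → x :* ((Q :- con 1ℚ) :* con 1ℚ) := (con 1ℚ :* (Q :- π) :+ π :- con 1ℚ) :* x)
            refl (ι (p ℕ.^ s) * gcdSum b r) (Q p) (ι p))
        den-gcdSum s (suc k) s<b = begin
          gcdSum b (p ℕ.^ (suc k ℕ.* b ℕ.+ s) ℕ.* r) * ((Q p - 1ℚ) * q^ p (suc k))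
            ≡⟨ cong₂ (λ y z → y * ((Q p - 1ℚ) * z)) Φ′≡ (q^-suc p k) ⟩
          (B * X * R + inv π * Φ - X * R) * ((Q p - 1ℚ) * (Q p * q^ p k))
            ≡⟨ cong (λ z → (B * X * R + inv π * Φ - X * R) * ((z - 1ℚ) * (z * q^ p k))) (Q≡ p) ⟩
          (B * X * R + inv π * Φ - X * R) * ((B * π - 1ℚ) * (B * π * q^ p k))
            -- Isolates the product `π * inv π` and the left side of the induction hypothesis.
            ≡⟨ solve 7 (λ B X R i Φ π q → (B :* X :* R :+ i :* Φ :- X :* R) :* ((B :* π :- con 1ℚ) :* (B :* π :* q))
                 := (B :* X :* R :- X :* R) :* ((B :* π :- con 1ℚ) :* (B :* π :* q))
                 :+ (π :* i) :* B :* (Φ :* ((B :* π :- con 1ℚ) :* q))) refl B X R (inv π) Φ π (q^ p k) ⟩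
          (B * X * R - X * R) * ((B * π - 1ℚ) * (B * π * q^ p k)) + (π * inv π) * B * (Φ * ((B * π - 1ℚ) * q^ p k))
            ≡⟨ cong₂ (λ y z → (B * X * R - X * R) * ((B * π - 1ℚ) * (B * π * q^ p k)) + y * B * z)
                 (*-inv (ι-pos′ p {{p≢0 2≤p}})) IH ⟩
          (B * X * R - X * R) * ((B * π - 1ℚ) * (B * π * q^ p k)) + 1ℚ * B * ((q^ p k * (B * π - π) + π - 1ℚ) * (X * R))
            ≡⟨ solve 5 (λ B X R π q → (B :* X :* R :- X :* R) :* ((B :* π :- con 1ℚ) :* (B :* π :* q))
                 :+ con 1ℚ :* B :* ((q :* (B :* π :- π) :+ π :- con 1ℚ) :* (X :* R))
                 := (B :* π :* q :* (B :* π :- π) :+ π :- con 1ℚ) :* (B :* X :* R)) refl B X R π (q^ p k) ⟩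
          (B * π * q^ p k * (B * π - π) + π - 1ℚ) * (B * X * R)
            ≡⟨ cong₂ (λ y z → (y * q^ p k * (y - π) + π - 1ℚ) * (z * R)) (sym (Q≡ p)) (sym X′≡) ⟩
          (Q p * q^ p k * (Q p - π) + π - 1ℚ) * (ι (p ℕ.^ (suc k ℕ.* b ℕ.+ s)) * R)
            ≡⟨ cong (λ y → (y * (Q p - π) + π - 1ℚ) * (ι (p ℕ.^ (suc k ℕ.* b ℕ.+ s)) * R)) (sym (q^-suc p k)) ⟩
          localDen p (suc k) * (ι (p ℕ.^ (suc k ℕ.* b ℕ.+ s)) * R) ∎
          where
          open ≡-Reasoning
          π = ι p
          B = ι (p ℕ.^ b)
          R = gcdSum b r
          a = k ℕ.* b ℕ.+ s
          X = ι (p ℕ.^ a)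
          Φ = gcdSum b (p ℕ.^ a ℕ.* r)
          exponent : p ℕ.^ (suc k ℕ.* b ℕ.+ s) ≡ p ℕ.^ b ℕ.* p ℕ.^ a
          exponent = trans (cong (p ℕ.^_) (ℕ.+-assoc b (k ℕ.* b) s)) (ℕ.^-distribˡ-+-* p b a)
          X′≡ : ι (p ℕ.^ (suc k ℕ.* b ℕ.+ s)) ≡ B * X
          X′≡ = trans (cong ι exponent) (ι-* (p ℕ.^ b) (p ℕ.^ a))
          Φ′≡ : gcdSum b (p ℕ.^ (suc k ℕ.* b ℕ.+ s) ℕ.* r) ≡ B * X * R + inv π * Φ - X * R
          Φ′≡ = trans (cong (gcdSum b) (trans (cong (ℕ._* r) exponent) (ℕ.*-assoc (p ℕ.^ b) (p ℕ.^ a) r)))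
            (trans (solve 2 (λ y z → y := y :+ z :- z) refl _ (X * R)) (cong (_- X * R) (gcdSum-step b pr a r p∤r)))
          IH : Φ * ((B * π - 1ℚ) * q^ p k) ≡ (q^ p k * (B * π - π) + π - 1ℚ) * (X * R)
          IH = subst (λ z → Φ * ((z - 1ℚ) * q^ p k) ≡ (q^ p k * (z - π) + π - 1ℚ) * (X * R)) (Q≡ p) (den-gcdSum s k s<b)

      gcdSum-localH : ∀ a → gcdSum b (p ℕ.^ a ℕ.* r) * localH p (a ℕ./ b) ≡ ι (p ℕ.^ a) * gcdSum b r
      gcdSum-localH a = subst (λ a′ → gcdSum b (p ℕ.^ a′ ℕ.* r) * localH p k ≡ ι (p ℕ.^ a′) * gcdSum b r) a≡
        (trans (sym (*-assoc (gcdSum b (p ℕ.^ (k ℕ.* b ℕ.+ s) ℕ.* r)) ((Q p - 1ℚ) * q^ p k) (inv (localDen p k))))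
        (trans (cong (_* inv (localDen p k)) (trans (den-gcdSum s k (ℕ.m%n<n a b)) (*-comm (localDen p k) _)))
          (*-cancel-inv (ι (p ℕ.^ (k ℕ.* b ℕ.+ s)) * gcdSum b r) (0<den 2≤p k))))
        where
        k = a ℕ./ b
        s = a ℕ.% b
        a≡ : k ℕ.* b ℕ.+ s ≡ a
        a≡ = trans (ℕ.+-comm (k ℕ.* b) s) (sym (ℕ.m≡m%n+[m/n]*n a b))

  -- Multiplicative functions

  n<p^n : ∀ {p} → 2 ℕ.≤ p → ∀ n → n ℕ.< p ℕ.^ n
  n<p^n         2≤p zero    = ℕ.s≤s ℕ.z≤n
  n<p^n {p} 2≤p (suc n) = ℕ.≤-trans
    (ℕ.+-mono-≤ (ℕ.≤-trans (ℕ.s≤s ℕ.z≤n) (n<p^n 2≤p n)) (ℕ.≤-trans (n<p^n 2≤p n) (ℕ.≤-reflexive (sym (ℕ.+-identityʳ (p ℕ.^ n))))))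
    (ℕ.*-monoˡ-≤ (p ℕ.^ n) 2≤p)

  -- For n ≥ 1, strip p f n = (i , m) with n = pⁱ m and p ∤ m, provided the fuel f is at least i.
  strip : ℕ → ℕ → ℕ → ℕ × ℕ
  strip p zero    n = 0 , n
  strip p (suc f) n with p ∣? n
  ... | yes (divides q _) = suc (proj₁ (strip p f q)) , proj₂ (strip p f q)
  ... | no  _             = 0 , n

  strip-^ : ∀ p .{{_ : ℕ.NonZero p}} i f {m} → p ∤ m → i ℕ.≤ f → strip p f (p ℕ.^ i ℕ.* m) ≡ (i , m)
  strip-^ p zero    zero    {m} p∤m _ = cong (0 ,_) (ℕ.*-identityˡ m)
  strip-^ p zero    (suc f) {m} p∤m _ with p ∣? 1 ℕ.* m
  ... | yes h = contradiction (subst (p ∣_) (ℕ.*-identityˡ m) h) p∤m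
  ... | no  _ = cong (0 ,_) (ℕ.*-identityˡ m)
  strip-^ p (suc i) (suc f) {m} p∤m (ℕ.s≤s i≤f) with p ∣? p ℕ.^ suc i ℕ.* m
  ... | no  h = contradiction (∣.∣m⇒∣m*n m (∣.m∣m*n (p ℕ.^ i))) h
  ... | yes (divides q eq) = cong (λ (j , r) → suc j , r)
    (trans (cong (strip p f) (ℕ.*-cancelʳ-≡ q (p ℕ.^ i ℕ.* m) p
      (trans (sym eq) (trans (ℕ.*-assoc p (p ℕ.^ i) m) (ℕ.*-comm p _))))) (strip-^ p i f p∤m i≤f))

  factor-out : ∀ {p} → 2 ℕ.≤ p → ∀ n .{{_ : ℕ.NonZero n}} → ∃ λ i → ∃ λ m → n ≡ p ℕ.^ i ℕ.* m × p ∤ m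
  factor-out {p} 2≤p n = go n n ℕ.≤-refl
    where
    go : ∀ f n .{{_ : ℕ.NonZero n}} → n ℕ.≤ f → ∃ λ i → ∃ λ m → n ≡ p ℕ.^ i ℕ.* m × p ∤ m
    go zero    (suc n) ()
    go (suc f) n n≤f with p ∣? n
    ... | no p∤n = 0 , n , sym (ℕ.*-identityˡ n) , p∤n
    ... | yes (divides zero    refl) = ⊥-elim (ℕ.≢-nonZero⁻¹ 0 refl)
    ... | yes (divides q@(suc _) refl) with go f q (ℕ.s≤s⁻¹ (ℕ.≤-trans (ℕ.m<m*n q p 2≤p) n≤f))
    ... | i , m , eq , p∤m = suc i , m , trans (cong (ℕ._* p) eq)
      (trans (ℕ.*-comm (p ℕ.^ i ℕ.* m) p) (sym (ℕ.*-assoc p (p ℕ.^ i) m))) , p∤m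

  prime≥2 : ∀ {p} → Prime p → 2 ℕ.≤ p
  prime≥2 {p} pr = ℕ.nonTrivial⇒n>1 p {{prime⇒nonTrivial pr}}

  ∤⇒≢0 : ∀ {p m} → p ∤ m → ℕ.NonZero m
  ∤⇒≢0 {p} {zero}  p∤m = contradiction (p ∣.∣0) p∤m
  ∤⇒≢0 {p} {suc m} p∤m = _

  -- The multiplicative function with values u(p, i) at pⁱ for primes p ≤ y and 0 at p > y.
  mult : (ℕ → ℕ → ℚ) → ℕ → ℕ → ℚ
  mult u zero    n = χ (n ℕ.≟ 1)
  mult u (suc y) n = if does (prime? (suc y))
    then u (suc y) (proj₁ (strip (suc y) n n)) * mult u y (proj₂ (strip (suc y) n n)) else mult u y n

  mult-prime : ∀ u {y} → Prime (suc y) → ∀ i {m} → suc y ∤ m →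
               mult u (suc y) (suc y ℕ.^ i ℕ.* m) ≡ u (suc y) i * mult u y m
  mult-prime u {y} pr i {m} p∤m with prime? (suc y)
  ... | no ¬pr = contradiction pr ¬pr
  ... | yes _  = cong (λ (j , r) → u (suc y) j * mult u y r) (strip-^ (suc y) i (suc y ℕ.^ i ℕ.* m) p∤m
    -- The fuel that `mult` supplies is the number p^i m itself, which exceeds i.
    (ℕ.≤-trans (ℕ.<⇒≤ (n<p^n (prime≥2 pr) i)) (ℕ.m≤m*n (suc y ℕ.^ i) m {{∤⇒≢0 p∤m}})))

  mult-nonprime : ∀ u {y} → ¬ Prime (suc y) → ∀ n → mult u (suc y) n ≡ mult u y n
  mult-nonprime u {y} ¬pr n with prime? (suc y)
  ... | yes pr = contradiction pr ¬pr
  ... | no _   = refl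

  -- Follows the recursion of `mult`: a prime y + 1 is split off from n with its full exponent, a
  -- nonprime y + 1 changes nothing.
  prime-induction : ∀ {ℓ} (P : ℕ → ℕ → Set ℓ) →
    (∀ n .{{_ : ℕ.NonZero n}} → P 0 n) →
    (∀ {y} n → ¬ Prime (suc y) → P y n → P (suc y) n) →
    (∀ {y} i m → Prime (suc y) → suc y ∤ m → P y m → P (suc y) (suc y ℕ.^ i ℕ.* m)) →
    ∀ y n .{{_ : ℕ.NonZero n}} → P y n
  prime-induction P base nonprime prime zero    n = base n
  prime-induction P base nonprime prime (suc y) n with prime? (suc y)
  ... | no ¬pr = nonprime n ¬pr (prime-induction P base nonprime prime y n)
  ... | yes pr with factor-out (prime≥2 pr) n
  ... | i , m , refl , p∤m = prime i m pr p∤m (prime-induction P base nonprime prime y m {{∤⇒≢0 p∤m}})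

  mult-nonneg : ∀ {u} → (∀ {p} → Prime p → ∀ i → 0ℚ ≤ u p i) → ∀ y n .{{_ : ℕ.NonZero n}} → 0ℚ ≤ mult u y n
  mult-nonneg {u} 0≤u = prime-induction (λ y n → 0ℚ ≤ mult u y n) (λ n → 0≤χ (n ℕ.≟ 1))
    (λ n ¬pr h → ≤-trans h (≤-reflexive (sym (mult-nonprime u ¬pr n))))
    (λ i m pr p∤m h → ≤-trans (*-nonneg (0≤u pr i) h) (≤-reflexive (sym (mult-prime u pr i p∤m))))

  mult-mono : ∀ {u w} → (∀ {p} → Prime p → ∀ i → 0ℚ ≤ u p i) → (∀ {p} → Prime p → ∀ i → u p i ≤ w p i) →
              ∀ y n .{{_ : ℕ.NonZero n}} → mult u y n ≤ mult w y n
  mult-mono {u} {w} 0≤u u≤w = prime-induction (λ y n → mult u y n ≤ mult w y n) (λ _ → ≤-refl)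
    (λ n ¬pr h → subst₂ _≤_ (sym (mult-nonprime u ¬pr n)) (sym (mult-nonprime w ¬pr n)) h)
    (λ {y} i m pr p∤m h → subst₂ _≤_ (sym (mult-prime u pr i p∤m)) (sym (mult-prime w pr i p∤m))
      (*-mono (0≤u pr i) (u≤w pr i) (mult-nonneg 0≤u y m {{∤⇒≢0 p∤m}}) h))

  mult-cong : ∀ {u w} → (∀ {p} → Prime p → ∀ i → u p i ≡ w p i) →
              ∀ y n .{{_ : ℕ.NonZero n}} → mult u y n ≡ mult w y n
  mult-cong {u} {w} u≡w = prime-induction (λ y n → mult u y n ≡ mult w y n) (λ _ → refl)
    (λ n ¬pr h → trans (mult-nonprime u ¬pr n) (trans h (sym (mult-nonprime w ¬pr n))))
    (λ i m pr p∤m h → trans (mult-prime u pr i p∤m) (trans (cong₂ _*_ (u≡w pr i) h) (sym (mult-prime w pr i p∤m))))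

  -- A prime q > y is never stripped and survives to the base case, which tests n = 1. Sums of
  -- `mult u y` over all integers are therefore sums over y-smooth ones without any side condition.
  mult-vanish : ∀ u {q} → Prime q → ∀ y n .{{_ : ℕ.NonZero n}} → y ℕ.< q → q ∣ n → mult u y n ≡ 0ℚ
  mult-vanish u {q} prq = prime-induction (λ y n → y ℕ.< q → q ∣ n → mult u y n ≡ 0ℚ)
    (λ n _ q∣n → χ-no (n ℕ.≟ 1) (λ { refl → contradiction (∣.∣1⇒≡1 q∣n) λ { refl → ¬prime[1] prq } }))
    (λ n ¬pr h y<q q∣n → trans (mult-nonprime u ¬pr n) (h (ℕ.<-trans ℕ.≤-refl y<q) q∣n))
    (λ {y} i m pr p∤m h y<q q∣n → trans (mult-prime u pr i p∤m)
      (trans (cong (u (suc y) i *_) (h (ℕ.<-trans ℕ.≤-refl y<q) (∣-cancel-^ pr (p∤q pr y<q) i q∣n)))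
        (*-zeroʳ (u (suc y) i))))
    where
    p∤q : ∀ {p} → Prime p → p ℕ.< q → p ∤ q
    p∤q pr p<q p∣q with prime⇒irreducible prq p∣q
    ... | inj₁ refl = ¬prime[1] pr
    ... | inj₂ refl = ℕ.<-irrefl refl p<q

  module _ {u : ℕ → ℕ → ℚ} (u₀ : ∀ {p} → Prime p → u p 0 ≡ 1ℚ) where

    mult-∤ : ∀ y n → suc y ∤ n → mult u (suc y) n ≡ mult u y n
    mult-∤ y n p∤n with prime? (suc y)
    ... | no _   = refl
    ... | yes pr = trans (cong (λ (j , r) → u (suc y) j * mult u y r)
        (trans (cong (strip (suc y) n) (sym (ℕ.*-identityˡ n))) (strip-^ (suc y) 0 n p∤n ℕ.z≤n)))
      (trans (cong (_* mult u y n) (u₀ pr)) (*-identityˡ (mult u y n)))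

    -- Primes beyond n contribute `u p 0` = 1, so `mult u n n` is the value at n of the full
    -- multiplicative function.
    mult-stable : ∀ y n .{{_ : ℕ.NonZero n}} → n ℕ.≤ y → mult u y n ≡ mult u n n
    mult-stable y n n≤y = subst (λ z → mult u z n ≡ mult u n n) (ℕ.m∸n+n≡m n≤y) (go (y ℕ.∸ n))
      where
      go : ∀ k → mult u (k ℕ.+ n) n ≡ mult u n n
      go zero    = refl
      go (suc k) = trans (mult-∤ (k ℕ.+ n) n (∣.>⇒∤ (ℕ.s≤s (ℕ.m≤n+m n k)))) (go k)

    -- Raising y by one either leaves the value alone or replaces 0, at a multiple of the new prime,
    -- by something nonnegative.
    mult-≤-full : (∀ {p} → Prime p → ∀ i → 0ℚ ≤ u p i) → ∀ y n .{{_ : ℕ.NonZero n}} → mult u y n ≤ mult u n n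
    mult-≤-full 0≤u y n = ≤-trans (go n) (≤-reflexive (mult-stable (n ℕ.+ y) n (ℕ.m≤m+n n y)))
      where
      step : ∀ y → mult u y n ≤ mult u (suc y) n
      step y with suc y ∣? n
      ... | no p∤n = ≤-reflexive (sym (mult-∤ y n p∤n))
      ... | yes p∣n = by-prime (prime? (suc y))
        where
        by-prime : Dec (Prime (suc y)) → mult u y n ≤ mult u (suc y) n
        by-prime (no ¬pr) = ≤-reflexive (sym (mult-nonprime u ¬pr n))
        by-prime (yes pr) = ≤-trans (≤-reflexive (mult-vanish u pr y n ℕ.≤-refl p∣n)) (mult-nonneg 0≤u (suc y) n)
      go : ∀ k → mult u y n ≤ mult u (k ℕ.+ y) n
      go zero    = ≤-refl
      go (suc k) = ≤-trans (go k) (step (k ℕ.+ y))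

  -- Smooth numbers and sums over divisors

  Smooth : ℕ → ℕ → Set
  Smooth y n = ∀ {q} → Prime q → q ∣ n → q ℕ.≤ y

  ≤⇒smooth : ∀ {y n} .{{_ : ℕ.NonZero n}} → n ℕ.≤ y → Smooth y n
  ≤⇒smooth n≤y _ q∣n = ℕ.≤-trans (∣.∣⇒≤ q∣n) n≤y

  smooth-zero : ∀ {n} .{{_ : ℕ.NonZero n}} → Smooth 0 n → n ≡ 1
  smooth-zero {n} sm with factorise n
  ... | record { factors = []     ; isFactorisation = eq } = eq
  ... | record { factors = a ∷ as ; isFactorisation = eq ; factorsPrime = pr All.∷ _ } =
    contradiction (sm pr (divides (product as) (trans eq (ℕ.*-comm a (product as))))) (ℕ.<⇒≱ (ℕ.>-nonZero⁻¹ a {{prime⇒nonZero pr}}))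

  -- Smoothness reduces the base case of `prime-induction` to n = 1. The divisor sum identity needs
  -- this: at y = 0 and n > 1 its right side is 0, while e = 1 still contributes 1 on the left.
  smooth-induction : ∀ {ℓ} (P : ℕ → ℕ → Set ℓ) → P 0 1 →
    (∀ {y} n → ¬ Prime (suc y) → P y n → P (suc y) n) →
    (∀ {y} i m → Prime (suc y) → suc y ∤ m → P y m → P (suc y) (suc y ℕ.^ i ℕ.* m)) →
    ∀ y n .{{_ : ℕ.NonZero n}} → Smooth y n → P y n
  smooth-induction P base nonprime prime = prime-induction (λ y n → Smooth y n → P y n)
    (λ n sm → subst (P 0) (sym (smooth-zero sm)) base)
    (λ n ¬pr h sm → nonprime n ¬pr (h (λ prq q∣n → smaller prq (sm prq q∣n) (λ { refl → ¬pr prq }))))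
    (λ {y} i m pr p∤m h sm → prime i m pr p∤m (h (λ prq q∣m →
      smaller prq (sm prq (∣.∣n⇒∣m*n (suc y ℕ.^ i) q∣m)) (λ { refl → p∤m q∣m }))))
    where
    smaller : ∀ {q y} → Prime q → q ℕ.≤ suc y → q ≢ suc y → q ℕ.≤ y
    smaller _ q≤ q≢ = ℕ.s≤s⁻¹ (ℕ.≤∧≢⇒< q≤ q≢)

  ∣-^ : ∀ n c .{{_ : ℕ.NonZero c}} → n ∣ n ℕ.^ c
  ∣-^ n (suc c) = ∣.m∣m*n (n ℕ.^ c)

  module _ (c : ℕ) .{{_ : ℕ.NonZero c}} (u : ℕ → ℕ → ℚ) where

    partialSum : ℕ → ℕ → ℚ
    partialSum p a = sum (suc (a ℕ./ c)) (u p)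

    -- For e = p^i m with p ∤ m, the condition e^c ∣ p^a r means i ≤ a / c and m^c ∣ r, so the sum
    -- factors. The range X is free because the induction passes from X to X / p^i. The case c = b
    -- yields H_b(n), the case c = 1 yields H_b(m^b).
    divisorSum : ∀ y n .{{_ : ℕ.NonZero n}} → Smooth y n → ∀ X → n ℕ.≤ X →
      sum₁ X (λ e → χ (e ℕ.^ c ∣? n) * mult u y e) ≡ mult partialSum y n
    divisorSum = smooth-induction
      (λ y n → ∀ X → n ℕ.≤ X → sum₁ X (λ e → χ (e ℕ.^ c ∣? n) * mult u y e) ≡ mult partialSum y n)
      base
      (λ n ¬pr h X n≤X → trans (sum-cong X (λ i → cong (χ (suc i ℕ.^ c ∣? n) *_) (mult-nonprime u ¬pr (suc i))))
        (trans (h X n≤X) (sym (mult-nonprime partialSum ¬pr n))))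
      step
      where
      base : ∀ X → 1 ℕ.≤ X → sum₁ X (λ e → χ (e ℕ.^ c ∣? 1) * χ (e ℕ.≟ 1)) ≡ 1ℚ
      base (suc X) _ = trans (sum-suc X (λ i → χ (suc i ℕ.^ c ∣? 1) * χ (suc i ℕ.≟ 1))) (cong₂ _+_
        (cong (_* 1ℚ) (χ-yes (1 ℕ.^ c ∣? 1) (subst (_∣ 1) (sym (ℕ.^-zeroˡ c)) ∣.∣-refl)))
        (sum-zero X (λ i _ → *-zeroʳ (χ (suc (suc i) ℕ.^ c ∣? 1)))))
      step : ∀ {y} a r → Prime (suc y) → suc y ∤ r →
        (∀ X → r ℕ.≤ X → sum₁ X (λ e → χ (e ℕ.^ c ∣? r) * mult u y e) ≡ mult partialSum y r) →
        ∀ X → suc y ℕ.^ a ℕ.* r ℕ.≤ X →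
        sum₁ X (λ e → χ (e ℕ.^ c ∣? suc y ℕ.^ a ℕ.* r) * mult u (suc y) e) ≡ mult partialSum (suc y) (suc y ℕ.^ a ℕ.* r)
      step {y} a r pr p∤r h X n≤X = begin
        sum₁ X f
          ≡⟨ sum₁-split p E X f ⟩
        sum E (λ i → sum₁ (quotPow p i X) (λ m → χ (¬? (p ∣? m)) * f (p ℕ.^ i ℕ.* m)))
          + sum₁ (quotPow p E X) (λ m → f (p ℕ.^ E ℕ.* m))
          ≡⟨ cong₂ _+_ (sum-cong-< E inner) (sum-zero (quotPow p E X) (λ i _ → remainder (suc i))) ⟩
        sum E (λ i → u p i * mult partialSum y r) + 0ℚ
          ≡⟨ +-identityʳ _ ⟩
        sum E (λ i → u p i * mult partialSum y r)
          ≡⟨ sum-*ʳ E (mult partialSum y r) (u p) ⟩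
        partialSum p a * mult partialSum y r
          ≡⟨ mult-prime partialSum pr a p∤r ⟨
        mult partialSum (suc y) (p ℕ.^ a ℕ.* r) ∎
        where
        open ≡-Reasoning
        p = suc y
        n = p ℕ.^ a ℕ.* r
        -- The admissible exponents are i ≤ a / c; no multiple of p^E passes the divisibility test,
        -- so the leftover sum is 0.
        E = suc (a ℕ./ c)
        f : ℕ → ℚ
        f e = χ (e ℕ.^ c ∣? n) * mult u p e
        ^-split : ∀ i m → (p ℕ.^ i ℕ.* m) ℕ.^ c ≡ p ℕ.^ (i ℕ.* c) ℕ.* m ℕ.^ c
        ^-split i m = trans (^-distribʳ-* c (p ℕ.^ i) m) (cong (ℕ._* m ℕ.^ c) (ℕ.^-*-assoc p i c))
        remainder : ∀ m → f (p ℕ.^ E ℕ.* m) ≡ 0ℚ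
        remainder m = trans (cong (_* mult u p (p ℕ.^ E ℕ.* m)) (χ-no ((p ℕ.^ E ℕ.* m) ℕ.^ c ∣? n) too-big)) (*-zeroˡ (mult u p (p ℕ.^ E ℕ.* m)))
          where
          too-big : ¬ (p ℕ.^ E ℕ.* m) ℕ.^ c ∣ n
          too-big d = ℕ.<-irrefl refl (ℕ.≤-trans (ℕ.≤-reflexive (sym (ℕ.m*n/n≡m E c)))
            (ℕ./-monoˡ-≤ c (^-∣-bound p∤r (∣.∣-trans (∣.m∣m*n (m ℕ.^ c)) (subst (_∣ n) (^-split E m) d)))))
        term≡ : ∀ i m → i ℕ.< E →
          χ (¬? (p ∣? m)) * f (p ℕ.^ i ℕ.* m) ≡ u p i * (χ (m ℕ.^ c ∣? r) * mult u y m)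
        term≡ i m i<E = by-∣ (p ∣? m)
          where
          ic≤a : i ℕ.* c ℕ.≤ a
          ic≤a = ℕ.≤-trans (ℕ.*-monoˡ-≤ c (ℕ.s≤s⁻¹ i<E)) (ℕ.m/n*n≤m a c)
          by-∣ : (d : Dec (p ∣ m)) → χ (¬? d) * f (p ℕ.^ i ℕ.* m) ≡ u p i * (χ (m ℕ.^ c ∣? r) * mult u y m)
          -- Both sides vanish: the left by its indicator, the right because p ∣ m and m^c ∣ r would
          -- give p ∣ r.
          by-∣ (yes p∣m) = trans (*-zeroˡ (f (p ℕ.^ i ℕ.* m))) (sym (trans
            (cong (λ z → u p i * (z * mult u y m)) (χ-no (m ℕ.^ c ∣? r) (λ d → p∤r (∣.∣-trans p∣m (∣.∣-trans (∣-^ m c) d)))))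
            (trans (cong (u p i *_) (*-zeroˡ (mult u y m))) (*-zeroʳ (u p i)))))
          by-∣ (no p∤m) = trans (*-identityˡ (f (p ℕ.^ i ℕ.* m))) (trans (cong₂ _*_
              (χ-cong ((p ℕ.^ i ℕ.* m) ℕ.^ c ∣? n) (m ℕ.^ c ∣? r)
                (λ d → ∣-cancel-^ pr (λ p∣mᶜ → p∤m (∣-prime-^ pr m c p∣mᶜ)) a
                         (∣.∣-trans (∣.n∣m*n (p ℕ.^ (i ℕ.* c))) (subst (_∣ n) (^-split i m) d)))
                (λ d → subst (_∣ n) (sym (^-split i m)) (∣.*-pres-∣ (^-monoʳ-∣ p ic≤a) d)))
              (mult-prime u pr i p∤m))
            (solve 3 (λ x y z → x :* (y :* z) := y :* (x :* z)) refl (χ (m ℕ.^ c ∣? r)) (u p i) (mult u y m)))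
        inner : ∀ i → i ℕ.< E →
          sum₁ (quotPow p i X) (λ m → χ (¬? (p ∣? m)) * f (p ℕ.^ i ℕ.* m)) ≡ u p i * mult partialSum y r
        inner i i<E = trans (sum-cong (quotPow p i X) (λ j → term≡ i (suc j) i<E))
          (trans (sum-*ˡ (quotPow p i X) (u p i) _) (cong (u p i *_) (h (quotPow p i X)
            (≤-quotPow p i (ℕ.≤-trans (ℕ.*-monoˡ-≤ r (ℕ.^-monoʳ-≤ p i≤a)) n≤X)))))
          where
          i≤a : i ℕ.≤ a
          i≤a = ℕ.≤-trans (ℕ.s≤s⁻¹ i<E) (ℕ.m/n≤m a c)

  -- The coefficients f(e) and the values H_b(m^b)

  module _ (b : ℕ) where

    localF : (p k : ℕ) → ℚ
    localF p zero    = localH b p 0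
    localF p (suc k) = localH b p (suc k) - localH b p k

    sum-localF : ∀ p k → sum (suc k) (localF p) ≡ localH b p k
    sum-localF p zero    = +-identityˡ (localH b p 0)
    sum-localF p (suc k) = trans (cong (_+ localF p (suc k)) (sum-localF p k))
      (solve 2 (λ x y → x :+ (y :- x) := y) refl (localH b p k) (localH b p (suc k)))

    -- In the notation of the header, fullF e = f(e) and fullH m = H_b(mᵇ).
    fullF fullH : ℕ → ℚ
    fullF e = mult localF e e
    fullH m = mult (localH b) m m

    private
      localF-nonneg : ∀ {p} → Prime p → ∀ k → 0ℚ ≤ localF p k
      localF-nonneg {p} pr zero    = localH-nonneg b (prime≥2 pr) 0
      localF-nonneg {p} pr (suc k) = ≤⇒diff (localH-mono b (prime≥2 pr) k)

      localF≤localH : ∀ {p} → Prime p → ∀ k → localF p k ≤ localH b p k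
      localF≤localH {p} pr zero    = ≤-refl
      localF≤localH {p} pr (suc k) = ≤-by (localH-nonneg b (prime≥2 pr) k)
        (solve 2 (λ x y → x :- con 0ℚ := y :- (y :- x)) refl (localH b p k) (localH b p (suc k)))

      localH₀ : ∀ {p} → Prime p → localH b p 0 ≡ 1ℚ
      localH₀ pr = localH-zero b (prime≥2 pr)

      localF₀ : ∀ {p} → Prime p → localF p 0 ≡ 1ℚ
      localF₀ = localH₀

    localH-nonneg′ : ∀ {p} → Prime p → ∀ k → 0ℚ ≤ localH b p k
    localH-nonneg′ pr = localH-nonneg b (prime≥2 pr)

    fullH-stable : ∀ y m .{{_ : ℕ.NonZero m}} → m ℕ.≤ y → mult (localH b) y m ≡ fullH m
    fullH-stable = mult-stable localH₀

    fullF-stable : ∀ y m .{{_ : ℕ.NonZero m}} → m ℕ.≤ y → mult localF y m ≡ fullF m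
    fullF-stable = mult-stable localF₀

    mult-localH≤fullH : ∀ y m .{{_ : ℕ.NonZero m}} → mult (localH b) y m ≤ fullH m
    mult-localH≤fullH = mult-≤-full localH₀ localH-nonneg′

    fullF-nonneg : ∀ e .{{_ : ℕ.NonZero e}} → 0ℚ ≤ fullF e
    fullF-nonneg e = mult-nonneg localF-nonneg e e

    fullF≤fullH : ∀ e .{{_ : ℕ.NonZero e}} → fullF e ≤ fullH e
    fullF≤fullH e = mult-mono localF-nonneg localF≤localH e e

    fullH-nonneg : ∀ e .{{_ : ℕ.NonZero e}} → 0ℚ ≤ fullH e
    fullH-nonneg e = mult-nonneg localH-nonneg′ e e

    -- Π p²/(p² - 1) over 2 ≤ p ≤ y + 1 telescopes to 2(y + 1)/(y + 2).
    fullH≤2 : 2 ℕ.≤ b → ∀ m .{{_ : ℕ.NonZero m}} → fullH m ≤ ι 2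
    fullH≤2 2≤b (suc y) = ≤-*-cancelʳ (ι-pos (suc y)) (≤-trans (bound (suc y) (suc y) y refl)
      (*-monoˡ (ι 2) (ι-nonneg 2) (ι-mono (ℕ.n≤1+n (suc y)))))
      where
      -- The bound 2z/(z + 1) with its denominator cleared. It is asserted only for z ≥ 1, since at
      -- z = 0 it would be 0 while the value at n = 1 is 1. A nonprime z is covered as well, because
      -- its factor z²/(z² - 1) is at least 1.
      Bound : ℕ → ℕ → Set
      Bound z n = ∀ y → z ≡ suc y → mult (localH b) z n * ι (suc (suc y)) ≤ ι 2 * ι (suc y)
      χ-bound : ∀ n → χ (n ℕ.≟ 1) * ι 2 ≤ ι 2 * 1ℚ
      χ-bound n = ≤-trans (*-monoʳ (ι 2) (ι-nonneg 2) (χ≤1 (n ℕ.≟ 1))) (≤-reflexive (*-comm 1ℚ (ι 2)))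
      Bound₁ : ∀ n → Bound 1 n
      Bound₁ n zero refl = subst (λ z → z * ι 2 ≤ ι 2 * 1ℚ) (sym (mult-nonprime (localH b) ¬prime[1] n)) (χ-bound n)
      bound : ∀ z n .{{_ : ℕ.NonZero n}} → Bound z n
      bound = prime-induction Bound (λ n y ()) nonprime prime
        where
        ι₃ : ∀ y → ι (3 ℕ.+ y) ≡ ι (suc y) + 1ℚ + 1ℚ
        ι₃ y = trans (ι-suc (2 ℕ.+ y)) (cong (_+ 1ℚ) (ι-suc (suc y)))
        grow : ∀ y i M → 0ℚ ≤ M → 2 ℕ.≤ 2 ℕ.+ y → M * ι (2 ℕ.+ y) ≤ ι 2 * ι (suc y) →
          localH b (2 ℕ.+ y) i * M * ι (3 ℕ.+ y) ≤ ι 2 * ι (2 ℕ.+ y)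
        -- With t = y + 1 and p = s = y + 2, multiplying by t s turns p + 1 = t + 2 into t (t + 2) =
        -- p² - 1, where `localH-bound` applies.
        grow y i M 0≤M 2≤p h = ≤-*-cancelʳ (*-positive (ι-pos y) (ι-pos (suc y))) (≤-trans
          (≤-reflexive (trans (cong (λ z → k * M * z * (t * s)) (ι₃ y)) (trans (cong (λ z → k * M * (t + 1ℚ + 1ℚ) * (t * z)) s≡)
            (trans (solve 3 (λ k M t → k :* M :* (t :+ con 1ℚ :+ con 1ℚ) :* (t :* (t :+ con 1ℚ))
              := k :* ((t :+ con 1ℚ) :* (t :+ con 1ℚ) :- con 1ℚ) :* (M :* (t :+ con 1ℚ))) refl k M t)
            (cong (λ z → k * (z * z - 1ℚ) * (M * z)) (sym s≡))))))
          (≤-trans (*-mono (*-nonneg (localH-nonneg b 2≤p i) (<⇒≤ 0<s²-1))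
                     (localH-bound b 2≤p 2≤b i) (*-nonneg 0≤M (ι-nonneg (2 ℕ.+ y))) h)
            (≤-reflexive (solve 3 (λ s t w → s :* s :* (w :* t) := w :* s :* (t :* s)) refl s t (ι 2)))))
          where
          k = localH b (2 ℕ.+ y) i
          t = ι (suc y)
          s = ι (2 ℕ.+ y)
          s≡ : s ≡ t + 1ℚ
          s≡ = ι-suc (suc y)
          0<s²-1 : 0ℚ < s * s - 1ℚ
          0<s²-1 = <-≤-trans (*-positive (ι-pos y) (ι-pos (suc y))) (≤-by (ι-nonneg (suc y))
            (trans (solve 1 (λ t → t :- con 0ℚ := (t :+ con 1ℚ) :* (t :+ con 1ℚ) :- con 1ℚ :- t :* (t :+ con 1ℚ)) refl t)
              (cong (λ z → z * z - 1ℚ - t * z) (sym s≡))))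
        relax : ∀ n y → mult (localH b) (suc y) n * ι (2 ℕ.+ y) ≤ ι 2 * ι (suc y) →
          mult (localH b) (suc y) n * ι (3 ℕ.+ y) ≤ ι 2 * ι (2 ℕ.+ y)
        relax n y h = ≤-*-cancelʳ (ι-pos (suc y)) (≤-trans
          (≤-reflexive (solve 3 (λ M s s′ → M :* s′ :* s := M :* s :* s′) refl (mult (localH b) (suc y) n) (ι (2 ℕ.+ y)) (ι (3 ℕ.+ y))))
          (≤-trans (*-monoʳ (ι (3 ℕ.+ y)) (ι-nonneg (3 ℕ.+ y)) h) (≤-by (ι-nonneg 2)
            (trans (solve 2 (λ w t → w :- con 0ℚ := w :* (t :+ con 1ℚ) :* (t :+ con 1ℚ) :- w :* t :* (t :+ con 1ℚ :+ con 1ℚ)) refl (ι 2) (ι (suc y)))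
              (cong₂ (λ s s′ → ι 2 * s * s - ι 2 * ι (suc y) * s′) (sym (ι-suc (suc y))) (sym (ι₃ y)))))))
        nonprime : ∀ {z} n → ¬ Prime (suc z) → Bound z n → Bound (suc z) n
        nonprime {zero}  n ¬pr h = Bound₁ n
        nonprime {suc y} n ¬pr h _ refl = ≤-trans
          (≤-reflexive (cong (_* ι (3 ℕ.+ y)) (mult-nonprime (localH b) ¬pr n))) (relax n y (h y refl))
        prime : ∀ {z} i m → Prime (suc z) → suc z ∤ m → Bound z m → Bound (suc z) (suc z ℕ.^ i ℕ.* m)
        prime {zero}  i m pr p∤m h = contradiction pr ¬prime[1]
        prime {suc y} i m pr p∤m h _ refl = ≤-trans
          (≤-reflexive (cong (_* ι (3 ℕ.+ y)) (mult-prime (localH b) pr i p∤m)))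
          (grow y i (mult (localH b) (suc y) m) (mult-nonneg localH-nonneg′ (suc y) m {{∤⇒≢0 p∤m}}) (prime≥2 pr) (h y refl))

  -- Harmonic numbers

  harm : ℕ → ℚ
  harm N = sum₁ N (λ n → inv (ι n))

  harm-nonneg : ∀ N → 0ℚ ≤ harm N
  harm-nonneg N = sum-nonneg N (λ i → inv-ι-nonneg (suc i))

  harm-mono : ∀ {M N} → M ℕ.≤ N → harm M ≤ harm N
  harm-mono = sum-extend (λ i → inv-ι-nonneg (suc i))

  harm≤ι : ∀ N → harm N ≤ ι N
  harm≤ι N = ≤-trans (sum-≤ N (λ i _ → inv-ι≤1 (suc i))) (≤-reflexive (*-identityʳ (ι N)))

  -- Going from (M + 1) D to (M + 2) D adds D terms, each at most 1/((M + 1) D), hence at most 1/(M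
  -- + 1) in all.
  harm-* : ∀ M D .{{_ : ℕ.NonZero D}} → harm (suc M ℕ.* D) ≤ harm D + harm M
  harm-* zero    D = ≤-reflexive (trans (cong harm (ℕ.*-identityˡ D)) (sym (+-identityʳ (harm D))))
  harm-* (suc M) D = ≤-trans (≤-reflexive (sum-++ D (suc M ℕ.* D) _))
    (≤-trans (+-mono-≤ (harm-* M D) block) (≤-reflexive (+-assoc (harm D) (harm M) _)))
    where
    instance _ = ℕ.m*n≢0 (suc M) D
    block : sum D (λ j → inv (ι (suc (j ℕ.+ suc M ℕ.* D)))) ≤ inv (ι (suc M))
    block = ≤-trans (sum-≤ D {c = inv (ι (suc M ℕ.* D))} (λ j _ → inv-ι-anti {suc M ℕ.* D} {suc (j ℕ.+ suc M ℕ.* D)} (ℕ.m≤n+m _ (suc j))))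
      (≤-reflexive (trans (cong (ι D *_) (inv-ι-* (suc M) D))
        (trans (solve 3 (λ d m i → d :* (m :* i) := m :* d :* i) refl (ι D) (inv (ι (suc M))) (inv (ι D)))
          (*-cancel-inv (inv (ι (suc M))) (ι-pos′ D)))))

  -- A one-sided form of log N = log D + log (N/D). It remains true for D > N, with harm 0 = 0, so
  -- the sum over e never has to be cut at e^b ≤ N.
  harm-quotient : ∀ N D .{{_ : ℕ.NonZero D}} → harm N ≤ harm D + harm (N ℕ./ D)
  harm-quotient N D = ≤-trans (harm-mono N≤) (harm-* (N ℕ./ D) D)
    where
    N≤ : N ℕ.≤ suc (N ℕ./ D) ℕ.* D
    N≤ = ℕ.≤-trans (ℕ.≤-reflexive (ℕ.m≡m%n+[m/n]*n N D)) (ℕ.+-monoˡ-≤ (N ℕ./ D ℕ.* D) (ℕ.m%n≤n N D))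

  1≤harm : ∀ e .{{_ : ℕ.NonZero e}} → 1ℚ ≤ harm e
  1≤harm (suc e) = harm-mono {1} {suc e} (ℕ.s≤s ℕ.z≤n)

  -- Stands in for log (e^c) = c log e; the extra 1 in the factor covers c = 0, where the left side
  -- is 1.
  harm-^ : ∀ c e .{{_ : ℕ.NonZero e}} → harm (e ℕ.^ c) ≤ ι (suc c) * harm e
  harm-^ zero    e = ≤-trans (1≤harm e) (≤-reflexive (sym (*-identityˡ (harm e))))
  harm-^ (suc c) e@(suc e-1) = ≤-trans (harm-* e-1 (e ℕ.^ c) {{ℕ.m^n≢0 e c}})
    (≤-trans (+-mono-≤ (harm-^ c e) (harm-mono (ℕ.n≤1+n e-1))) (≤-reflexive (sym (ι-suc-* (suc c) (harm e)))))

  -- 1/n - 1/(n + 1) = 1/(n (n + 1)), stated as a vanishing expression so that multiples of it can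
  -- be inserted into solver identities.
  inv-ι-step : ∀ i → inv (ι (suc i)) - inv (ι (2 ℕ.+ i)) - inv (ι (suc i)) * inv (ι (2 ℕ.+ i)) ≡ 0ℚ
  inv-ι-step i = trans (cong (_- x * y) x-y) (+-inverseʳ (x * y))
    where
    n = ι (suc i)
    x = inv n
    y = inv (ι (2 ℕ.+ i))
    x-y : x - y ≡ x * y
    x-y = trans (sym (cong₂ _-_ (*-inv-cancel x (ι-pos (suc i))) (*-inv-cancel y (ι-pos i))))
      (trans (cong (λ s → x * y * s - y * x * n) (ι-suc (suc i)))
        (solve 3 (λ x y n → x :* y :* (n :+ con 1ℚ) :- y :* x :* n := x :* y) refl x y n))

  -- (harm i + 1)/i is a telescoping majorant: its decrement at i is at least harm (i + 1)/(i + 1)².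
  sum-harm/e² : ∀ X → sum₁ X (λ e → harm e * (inv (ι e) * inv (ι e))) ≤ ι 3
  sum-harm/e² zero    = ι-nonneg 3
  sum-harm/e² (suc X) = subst (λ k → sum k a ≤ ι 3) (ℕ.+-comm X 1)
    -- Starting at 1 gives a 0 + t 1 = 1 + 2 = 3. Starting at 0 would fail, since 1/0 = 0 makes
    -- `t 0` vanish.
    (≤-trans (≤-+ʳ (t-nonneg (X ℕ.+ 1))) (sum-telescope 1 X a t decrement))
    where
    a t : ℕ → ℚ
    a i = harm (suc i) * (inv (ι (suc i)) * inv (ι (suc i)))
    t i = (harm i + 1ℚ) * inv (ι i)
    t-nonneg : ∀ i → 0ℚ ≤ t i
    t-nonneg i = *-nonneg (+-mono-≤ (harm-nonneg i) 0≤1) (inv-ι-nonneg i)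
    decrement : ∀ i → 1 ℕ.≤ i → a i + t (suc i) ≤ t i
    decrement (suc i) _ = ≤-by gap-nonneg gap≡
      where
      n = ι (suc i)
      x = inv n
      y = inv (ι (2 ℕ.+ i))
      h = harm (suc i)
      gap : ℚ
      gap = (h + y) * (x * y * y)
      gap-nonneg : 0ℚ ≤ gap
      gap-nonneg = *-nonneg (harm-nonneg (2 ℕ.+ i))
        (*-nonneg (*-nonneg (inv-ι-nonneg (suc i)) (inv-ι-nonneg (2 ℕ.+ i))) (inv-ι-nonneg (2 ℕ.+ i)))
      gap≡ : gap - 0ℚ ≡ t (suc i) - (a (suc i) + t (2 ℕ.+ i))
      -- The solver sees x and y as independent; their relation enters as a multiple of x - y - x y,
      -- which `inv-ι-step` then sends to 0.
      gap≡ = trans (solve 3 (λ h x y → (h :+ y) :* (x :* y :* y) :- con 0ℚ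
          := (h :+ con 1ℚ) :* x :- ((h :+ y) :* (y :* y) :+ (h :+ y :+ con 1ℚ) :* y)
             :- (h :+ con 1ℚ :+ h :* y :+ y :+ y :* y) :* (x :- y :- x :* y)) refl h x y)
        (trans (cong (λ z → (h + 1ℚ) * x - ((h + y) * (y * y) + (h + y + 1ℚ) * y) - (h + 1ℚ + h * y + y + y * y) * z)
                 (inv-ι-step i))
          (solve 2 (λ d c → d :- c :* con 0ℚ := d) refl _ (h + 1ℚ + h * y + y + y * y)))

  -- Telescoping with majorant 1/i, as 1/(i + 1)² ≤ 1/i - 1/(i + 1). M is nonzero because 1/0 = 0
  -- would spoil the majorant.
  sum-inv-² : ∀ K M .{{_ : ℕ.NonZero M}} → sum (K ℕ.+ M) (λ i → inv (ι (suc i)) * inv (ι (suc i)))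
                                           ≤ sum M (λ i → inv (ι (suc i)) * inv (ι (suc i))) + inv (ι M)
  sum-inv-² K M = ≤-trans (≤-+ʳ (inv-ι-nonneg (K ℕ.+ M))) (sum-telescope M K _ (λ i → inv (ι i)) decrement)
    where
    decrement : ∀ i → M ℕ.≤ i → inv (ι (suc i)) * inv (ι (suc i)) + inv (ι (suc i)) ≤ inv (ι i)
    decrement zero    M≤0 = contradiction (ℕ.n≤0⇒n≡0 M≤0) (ℕ.≢-nonZero⁻¹ M)
    decrement (suc i) _   = ≤-by (*-nonneg (*-nonneg (inv-ι-nonneg (suc i)) (inv-ι-nonneg (2 ℕ.+ i))) (inv-ι-nonneg (2 ℕ.+ i)))
      (trans (solve 2 (λ x y → x :* y :* y :- con 0ℚ := x :- (y :* y :+ y) :- (con 1ℚ :+ y) :* (x :- y :- x :* y)) refl x y)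
        (trans (cong (λ z → x - (y * y + y) - (1ℚ + y) * z) (inv-ι-step i))
          (solve 2 (λ d c → d :- c :* con 0ℚ := d) refl (x - (y * y + y)) (1ℚ + y))))
      where
      x = inv (ι (suc i))
      y = inv (ι (2 ℕ.+ i))

  -- Dirichlet convolution sums

  -- Serves twice: c = b with a(n) = 1/n for the mean of H_b(n)/n, and c = 1 with a(n) = n^-b for Σ
  -- H_b(m^b)/m^b.
  sum-divisors-swap : ∀ c N X (g a : ℕ → ℚ) →
    sum₁ N (λ n → sum₁ X (λ e → χ (e ℕ.^ c ∣? n) * g e) * a n)
      ≡ sum X (λ i → g (suc i) * sum₁ (quotPow (suc i) c N) (λ m → a (suc i ℕ.^ c ℕ.* m)))
  sum-divisors-swap c N X g a = begin
    sum₁ N (λ n → sum₁ X (λ e → χ (e ℕ.^ c ∣? n) * g e) * a n)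
      ≡⟨ sum-cong N (λ j → sym (sum-*ʳ X (a (suc j)) _)) ⟩
    sum₁ N (λ n → sum₁ X (λ e → χ (e ℕ.^ c ∣? n) * g e * a n))
      ≡⟨ sum-swap N X _ ⟩
    sum₁ X (λ e → sum₁ N (λ n → χ (e ℕ.^ c ∣? n) * g e * a n))
      ≡⟨ sum-cong X inner ⟩
    sum X (λ i → g (suc i) * sum₁ (quotPow (suc i) c N) (λ m → a (suc i ℕ.^ c ℕ.* m))) ∎
    where
    open ≡-Reasoning
    inner : ∀ i → sum₁ N (λ n → χ (suc i ℕ.^ c ∣? n) * g (suc i) * a n)
                  ≡ g (suc i) * sum₁ (quotPow (suc i) c N) (λ m → a (suc i ℕ.^ c ℕ.* m))
    inner i = trans
      (sum-cong N (λ j → solve 3 (λ x y z → x :* y :* z := y :* (x :* z)) refl (χ (suc i ℕ.^ c ∣? suc j)) (g (suc i)) (a (suc j))))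
      (trans (sum-*ˡ N (g (suc i)) _)
        (cong (g (suc i) *_) (sum₁-multiples (suc i ℕ.^ c) {{ℕ.m^n≢0 (suc i) c}} N a)))

  inv^ : (b k : ℕ) → ℚ
  inv^ b k = inv (ι (k ℕ.^ b))

  inv^-nonneg : ∀ b k → 0ℚ ≤ inv^ b k
  inv^-nonneg b k = inv-ι-nonneg (k ℕ.^ b)

  inv^-* : ∀ b m n .{{_ : ℕ.NonZero m}} .{{_ : ℕ.NonZero n}} → inv^ b (m ℕ.* n) ≡ inv^ b m * inv^ b n
  inv^-* b m n = trans (cong (inv ∘ ι) (^-distribʳ-* b m n)) (inv-ι-* (m ℕ.^ b) (n ℕ.^ b) {{ℕ.m^n≢0 m b}} {{ℕ.m^n≢0 n b}})

  inv^≤inv² : ∀ {b} → 2 ℕ.≤ b → ∀ k .{{_ : ℕ.NonZero k}} → inv^ b k ≤ inv (ι k) * inv (ι k)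
  inv^≤inv² {b} 2≤b k = ≤-trans (inv-ι-anti {k ℕ.* k} {k ℕ.^ b} {{ℕ.m*n≢0 k k}}
      (ℕ.≤-trans (ℕ.≤-reflexive (cong (k ℕ.*_) (sym (ℕ.*-identityʳ k)))) (ℕ.^-monoʳ-≤ k 2≤b)))
    (≤-reflexive (inv-ι-* k k))

  sum-inv^ : ∀ {b} → 2 ℕ.≤ b → ∀ K M .{{_ : ℕ.NonZero M}} →
             sum K (λ i → inv^ b (suc (i ℕ.+ M))) ≤ inv (ι M)
  sum-inv^ {b} 2≤b K M = ≤-trans (sum-mono K (λ i _ → inv^≤inv² 2≤b (suc (i ℕ.+ M)))) (≤-by (sum-inv-² K M)
    (trans (cong (λ z → sum M s + inv (ι M) - z) (sum-++ K M s))
      (solve 3 (λ x y z → x :+ y :- (x :+ z) := y :- z) refl (sum M s) (inv (ι M)) (sum K (λ i → s (i ℕ.+ M))))))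
    where s = λ i → inv (ι (suc i)) * inv (ι (suc i))

  -- H_b(n)/n and H_b(m^b)/m^b as convolutions, with partial sum bounds

  module _ {b : ℕ} (2≤b : 2 ℕ.≤ b) where

    instance
      b≢0 : ℕ.NonZero b
      b≢0 = ℕ.>-nonZero (ℕ.≤-trans (ℕ.s≤s ℕ.z≤n) 2≤b)

    gcdSum-one : gcdSum b 1 ≡ 1ℚ
    gcdSum-one = trans (+-identityˡ (weight b 1 1)) (cong (λ g → 1ℚ ÷₀ ι g) (ℕ.≤-antisym
      (ℕ.≤-trans (m≤m^n (ggcd b 1 1) b) (ℕ.≤-reflexive (∣.∣1⇒≡1 (proj₁ (ggcd-common b 1 1)))))
      (ℕ.>-nonZero⁻¹ (ggcd b 1 1) {{ggcd≢0 b 1 1}})))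

    -- The closed form and the multiplicativity of H_b at once: `gcdSum-localH` allows any cofactor
    -- r prime to p, so the primes of n are removed one after the other.
    gcdSum-mult : ∀ y n .{{_ : ℕ.NonZero n}} → Smooth y n →
                  gcdSum b n * mult (λ p a → localH b p (a ℕ./ b)) y n ≡ ι n
    gcdSum-mult = smooth-induction (λ y n → gcdSum b n * mult u y n ≡ ι n)
      (trans (*-identityʳ (gcdSum b 1)) gcdSum-one)
      (λ n ¬pr h → trans (cong (gcdSum b n *_) (mult-nonprime u ¬pr n)) h)
      (λ {y} a r pr p∤r h → begin
        gcdSum b (suc y ℕ.^ a ℕ.* r) * mult u (suc y) (suc y ℕ.^ a ℕ.* r)
          ≡⟨ cong (gcdSum b (suc y ℕ.^ a ℕ.* r) *_) (mult-prime u pr a p∤r) ⟩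
        gcdSum b (suc y ℕ.^ a ℕ.* r) * (u (suc y) a * mult u y r)
          ≡⟨ *-assoc (gcdSum b (suc y ℕ.^ a ℕ.* r)) (u (suc y) a) (mult u y r) ⟨
        gcdSum b (suc y ℕ.^ a ℕ.* r) * u (suc y) a * mult u y r
          ≡⟨ cong (_* mult u y r) (gcdSum-localH b pr p∤r a) ⟩
        ι (suc y ℕ.^ a) * gcdSum b r * mult u y r
          ≡⟨ *-assoc (ι (suc y ℕ.^ a)) (gcdSum b r) (mult u y r) ⟩
        ι (suc y ℕ.^ a) * (gcdSum b r * mult u y r)
          ≡⟨ cong (ι (suc y ℕ.^ a) *_) h ⟩
        ι (suc y ℕ.^ a) * ι r
          ≡⟨ ι-* (suc y ℕ.^ a) r ⟨
        ι (suc y ℕ.^ a ℕ.* r) ∎)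
      where
      open ≡-Reasoning
      u = λ p a → localH b p (a ℕ./ b)

    gcdSum-pos : ∀ n .{{_ : ℕ.NonZero n}} → 0ℚ < gcdSum b n
    gcdSum-pos (suc n) = +-mono-≤-< {0ℚ} {sum₁ n w} {0ℚ} {w (suc n)}
      (sum-nonneg n (λ i → *-nonneg 0≤1 (inv-ι-nonneg (ggcd b (suc i) (suc n)))))
      (*-positive 0<1 (inv-pos (ι-pos′ (ggcd b (suc n) (suc n)) {{ggcd≢0 b (suc n) (suc n)}})))
      where
      w : ℕ → ℚ
      w j = weight b j (suc n)

    sum-fullF : ∀ c .{{_ : ℕ.NonZero c}} X n .{{_ : ℕ.NonZero n}} → n ℕ.≤ X →
      sum₁ X (λ e → χ (e ℕ.^ c ∣? n) * fullF b e) ≡ mult (λ p a → localH b p (a ℕ./ c)) X n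
    sum-fullF c X n n≤X = trans
      (sum-cong-< X (λ i i<X → cong (χ (suc i ℕ.^ c ∣? n) *_) (sym (fullF-stable b X (suc i) i<X))))
      (trans (divisorSum c (localF b) X n (≤⇒smooth n≤X) X n≤X)
        (mult-cong (λ {p} _ a → sum-localF b p (a ℕ./ c)) X n))

    -- The range X does not depend on n, so that all n ≤ N can share it when the order of summation
    -- is changed.
    H-fullF : ∀ X n .{{_ : ℕ.NonZero n}} → n ℕ.≤ X →
      H b n ÷₀ ι n ≡ sum₁ X (λ e → χ (e ℕ.^ b ∣? n) * fullF b e) * inv (ι n)
    H-fullF X n n≤X = begin
      ι n * inv (gcdSum b n) * inv (ι n)
        ≡⟨ solve 3 (λ x y z → x :* y :* z := y :* (x :* z)) refl (ι n) (inv (gcdSum b n)) (inv (ι n)) ⟩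
      inv (gcdSum b n) * (ι n * inv (ι n))
        ≡⟨ cong (inv (gcdSum b n) *_) (*-inv (ι-pos′ n)) ⟩
      inv (gcdSum b n) * 1ℚ
        ≡⟨ *-identityʳ _ ⟩
      inv (gcdSum b n)
        ≡⟨ inv-unique (gcdSum-pos n) (trans (sym (*-assoc (gcdSum b n) G (inv (ι n))))
             (trans (cong (_* inv (ι n)) (gcdSum-mult X n (≤⇒smooth n≤X))) (*-inv (ι-pos′ n)))) ⟨
      G * inv (ι n)
        ≡⟨ cong (_* inv (ι n)) (sum-fullF b X n n≤X) ⟨
      sum₁ X (λ e → χ (e ℕ.^ b ∣? n) * fullF b e) * inv (ι n) ∎
      where
      open ≡-Reasoning
      G = mult (λ p a → localH b p (a ℕ./ b)) X n

    fullH-fullF : ∀ X n .{{_ : ℕ.NonZero n}} → n ℕ.≤ X →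
      fullH b n ≡ sum₁ X (λ e → χ (e ℕ.^ 1 ∣? n) * fullF b e)
    fullH-fullF X n n≤X = sym (trans (sum-fullF 1 X n n≤X)
      (trans (mult-cong (λ {p} _ a → cong (localH b p) (ℕ.n/1≡n a)) X n) (fullH-stable b X n n≤X)))

    meanSum fSum hSum zSum : ℕ → ℚ
    meanSum N = sum₁ N (λ n → H b n ÷₀ ι n)
    fSum X = sum₁ X (λ e → fullF b e * inv^ b e)
    hSum X = sum₁ X (λ m → fullH b m * inv^ b m)
    zSum X = sum₁ X (zetaTerm b)

    zetaTerm≡ : ∀ k → zetaTerm b k ≡ inv^ b k
    zetaTerm≡ k = *-identityˡ (inv^ b k)

    zSum-nonneg : ∀ X → 0ℚ ≤ zSum X
    zSum-nonneg X = sum-nonneg X (λ i → *-nonneg 0≤1 (inv^-nonneg b (suc i)))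

    zSum-mono : ∀ {M N} → M ℕ.≤ N → zSum M ≤ zSum N
    zSum-mono = sum-extend (λ i → *-nonneg 0≤1 (inv^-nonneg b (suc i)))

    hSum-mono : ∀ {M N} → M ℕ.≤ N → hSum M ≤ hSum N
    hSum-mono = sum-extend (λ i → *-nonneg (fullH-nonneg b (suc i)) (inv^-nonneg b (suc i)))

    meanSum≡ : ∀ X N → N ℕ.≤ X →
      meanSum N ≡ sum X (λ i → fullF b (suc i) * (inv^ b (suc i) * harm (quotPow (suc i) b N)))
    meanSum≡ X N N≤X = trans (sum-cong-< N (λ i i<N → H-fullF X (suc i) (ℕ.≤-trans i<N N≤X)))
      (trans (sum-divisors-swap b N X (fullF b) (λ n → inv (ι n)))
        (sum-cong X (λ i → cong (fullF b (suc i) *_) (trans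
          (sum-cong (quotPow (suc i) b N) (λ j → inv-ι-* (suc i ℕ.^ b) (suc j) {{ℕ.m^n≢0 (suc i) b}}))
          (sum-*ˡ (quotPow (suc i) b N) (inv^ b (suc i)) _)))))

    hSum≡ : ∀ N → hSum N ≡ sum N (λ i → fullF b (suc i) * (inv^ b (suc i) * zSum (quotPow (suc i) 1 N)))
    hSum≡ N = trans (sum-cong-< N (λ i i<N → cong (_* inv^ b (suc i)) (fullH-fullF N (suc i) i<N)))
      (trans (sum-divisors-swap 1 N N (fullF b) (inv^ b))
        (sum-cong N (λ i → cong (fullF b (suc i) *_) (trans
          (sum-cong (quotPow (suc i) 1 N) (λ j → trans (cong (λ k → inv^ b (k ℕ.* suc j)) (ℕ.*-identityʳ (suc i)))
            (trans (inv^-* b (suc i) (suc j)) (cong (inv^ b (suc i) *_) (sym (zetaTerm≡ (suc j)))))))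
          (sum-*ˡ (quotPow (suc i) 1 N) (inv^ b (suc i)) _)))))

    private
      fSum-* : ∀ X c → fSum X * c ≡ sum X (λ i → fullF b (suc i) * (inv^ b (suc i) * c))
      fSum-* X c = trans (sym (sum-*ʳ X c _)) (sum-cong X (λ i → *-assoc (fullF b (suc i)) (inv^ b (suc i)) c))

      scale : ∀ i {p q} → p ≤ q → fullF b (suc i) * (inv^ b (suc i) * p) ≤ fullF b (suc i) * (inv^ b (suc i) * q)
      scale i h = *-monoˡ (fullF b (suc i)) (fullF-nonneg b (suc i)) (*-monoˡ (inv^ b (suc i)) (inv^-nonneg b (suc i)) h)

    -- The pairs with e m ≤ n lie in the square e, m ≤ n, and all terms are nonnegative.
    hSum≤fSum*zSum : ∀ n → hSum n ≤ fSum n * zSum n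
    hSum≤fSum*zSum n = subst₂ _≤_ (sym (hSum≡ n)) (sym (fSum-* n (zSum n)))
      (sum-mono n (λ i _ → scale i (zSum-mono (quotPow-≤ (suc i) 1 n))))

    -- The square e, m ≤ n lies in the region e m ≤ n². Together with the previous bound this is the
    -- finite form of ζ(b) Σ f(e)/e^b = Σ H_b(m^b)/m^b.
    fSum*zSum≤hSum : ∀ n → fSum n * zSum n ≤ hSum (n ℕ.* n)
    fSum*zSum≤hSum n = subst₂ _≤_ (sym (fSum-* n (zSum n))) (sym (hSum≡ (n ℕ.* n)))
      (≤-trans
        (sum-mono n (λ i i<n → scale i (zSum-mono (≤-quotPow (suc i) 1
          (ℕ.*-monoˡ-≤ n (ℕ.≤-trans (ℕ.≤-reflexive (ℕ.*-identityʳ (suc i))) i<n))))))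
        (sum-extend (λ i → *-nonneg (fullF-nonneg b (suc i)) (*-nonneg (inv^-nonneg b (suc i)) (zSum-nonneg (quotPow (suc i) 1 (n ℕ.* n))))) (n≤n*n n)))
      where
      n≤n*n : ∀ n → n ℕ.≤ n ℕ.* n
      n≤n*n zero    = ℕ.z≤n
      n≤n*n (suc n) = ℕ.m≤m*n (suc n) (suc n)

    meanSum≤ : ∀ X N → N ℕ.≤ X → meanSum N ≤ fSum X * harm N
    meanSum≤ X N N≤X = subst₂ _≤_ (sym (meanSum≡ X N N≤X)) (sym (fSum-* X (harm N)))
      (sum-mono X (λ i _ → scale i (harm-mono (quotPow-≤ (suc i) b N))))

    -- A product of three bounds: f ≤ 2, harm (e^b) ≤ (b + 1) harm e, and Σ harm e / e² ≤ 3.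
    errorBound : ℚ
    errorBound = ι 2 * ι (suc b) * ι 3

    -- Replacing harm (N/e^b) by harm N costs at most harm (e^b) for each e, and these costs form a
    -- convergent series with weights f(e)/e^b.
    meanSum≥ : ∀ X N → N ℕ.≤ X → fSum X * harm N ≤ meanSum N + errorBound
    meanSum≥ X N N≤X = ≤-trans
      (subst₂ _≤_ (sym (fSum-* X (harm N))) (trans (sum-+ X _ _) (cong (_+ sum X err) (sym (meanSum≡ X N N≤X))))
        (sum-mono X λ i _ → ≤-trans
          (scale i (harm-quotient N (suc i ℕ.^ b) {{ℕ.m^n≢0 (suc i) b}}))
          (≤-reflexive (solve 4 (λ f v x y → f :* (v :* (x :+ y)) := f :* (v :* y) :+ f :* (v :* x)) refl
            (fullF b (suc i)) (inv^ b (suc i)) (harm (suc i ℕ.^ b)) (harm (quotPow (suc i) b N))))))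
      (+-monoʳ-≤ (meanSum N) (≤-trans (sum-mono X (λ i _ → err≤ i))
        (≤-trans (≤-reflexive (sum-*ˡ X (ι 2 * ι (suc b)) _))
          (*-monoˡ (ι 2 * ι (suc b)) (*-nonneg (ι-nonneg 2) (ι-nonneg (suc b))) (sum-harm/e² X)))))
      where
      err : ℕ → ℚ
      err i = fullF b (suc i) * (inv^ b (suc i) * harm (suc i ℕ.^ b))
      err≤ : ∀ i → err i ≤ ι 2 * ι (suc b) * (harm (suc i) * (inv (ι (suc i)) * inv (ι (suc i))))
      err≤ i = ≤-trans
        (*-mono (fullF-nonneg b (suc i)) (≤-trans (fullF≤fullH b (suc i)) (fullH≤2 b 2≤b (suc i)))
          (*-nonneg (inv^-nonneg b (suc i)) (harm-nonneg (suc i ℕ.^ b)))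
          (*-mono (inv^-nonneg b (suc i)) (inv^≤inv² 2≤b (suc i)) (harm-nonneg (suc i ℕ.^ b)) (harm-^ b (suc i))))
        (≤-reflexive (solve 4 (λ w v s h → w :* (v :* (s :* h)) := w :* s :* (h :* v)) refl
          (ι 2) (inv (ι (suc i)) * inv (ι (suc i))) (ι (suc b)) (harm (suc i))))

    zSum-tail : ∀ K M .{{_ : ℕ.NonZero M}} → zSum (K ℕ.+ M) ≤ zSum M + inv (ι M)
    zSum-tail K M = ≤-trans (≤-reflexive (sum-++ K M (zetaTerm b ∘ suc)))
      (+-monoʳ-≤ (zSum M) (≤-trans (≤-reflexive (sum-cong K (λ i → zetaTerm≡ (suc (i ℕ.+ M))))) (sum-inv^ 2≤b K M)))

    hSum-tail : ∀ K M .{{_ : ℕ.NonZero M}} → hSum (K ℕ.+ M) ≤ hSum M + ι 2 * inv (ι M)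
    hSum-tail K M = ≤-trans (≤-reflexive (sum-++ K M (λ i → fullH b (suc i) * inv^ b (suc i))))
      (+-monoʳ-≤ (hSum M) (≤-trans (sum-mono K (λ i _ → *-monoʳ (inv^ b (suc (i ℕ.+ M))) (inv^-nonneg b (suc (i ℕ.+ M))) (fullH≤2 b 2≤b (suc (i ℕ.+ M)))))
        (≤-trans (≤-reflexive (sum-*ˡ K (ι 2) _)) (*-monoˡ (ι 2) (ι-nonneg 2) (sum-inv^ 2≤b K M)))))

  -- The Euler product

  -- Real multiplication is termwise, so this is what a fixed index of the sequence of
  -- `primeProduct` evaluates to.
  ratPrimeProduct : (ℕ → ℚ) → ℕ → ℚ
  ratPrimeProduct g zero    = 1ℚ
  ratPrimeProduct g (suc n) =
    if does (prime? (suc n)) then ratPrimeProduct g n * g (suc n) else ratPrimeProduct g n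

  ratPrimeProduct-prime : ∀ g {n} → Prime (suc n) → ratPrimeProduct g (suc n) ≡ ratPrimeProduct g n * g (suc n)
  ratPrimeProduct-prime g {n} pr with prime? (suc n)
  ... | yes _  = refl
  ... | no ¬pr = contradiction pr ¬pr

  ratPrimeProduct-nonprime : ∀ g {n} → ¬ Prime (suc n) → ratPrimeProduct g (suc n) ≡ ratPrimeProduct g n
  ratPrimeProduct-nonprime g {n} ¬pr with prime? (suc n)
  ... | yes pr = contradiction pr ¬pr
  ... | no _   = refl

  seq-primeProduct : ∀ (F : ℕ → ℝ) g E → (∀ {p} → Prime p → seq (F p) E ≡ g p) →
                     ∀ n → seq (primeProduct F n) E ≡ ratPrimeProduct g n
  seq-primeProduct F g E h zero    = refl
  seq-primeProduct F g E h (suc n) = by-prime (prime? (suc n))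
    where
    by-prime : (d : Dec (Prime (suc n))) →
      seq (if does d then primeProduct F n *ℝ F (suc n) else primeProduct F n) E
        ≡ (if does d then ratPrimeProduct g n * g (suc n) else ratPrimeProduct g n)
    by-prime (yes pr) = cong₂ _*_ (seq-primeProduct F g E h n) (h pr)
    by-prime (no  _)  = seq-primeProduct F g E h n

  module _ (b : ℕ) .{{_ : ℕ.NonZero b}} where

    eulerCoeff : (p i : ℕ) → ℚ
    eulerCoeff p i = localH b p i * inv (ι (p ℕ.^ (i ℕ.* b)))

    -- Cut at exponent E because the local series at index E stops there; i = 0 supplies the 1 of
    -- `localFactor`.
    eulerFactor : (E p : ℕ) → ℚ
    eulerFactor E p = sum (suc E) (eulerCoeff p)

    smoothTerm : (y m : ℕ) → ℚ
    smoothTerm y m = mult (localH b) y m * inv^ b m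

    private
      coeff-nonneg : ∀ {p} → Prime p → ∀ i → 0ℚ ≤ eulerCoeff p i
      coeff-nonneg {p} pr i = *-nonneg (localH-nonneg′ b pr i) (inv-ι-nonneg (p ℕ.^ (i ℕ.* b)))

      smoothTerm-nonneg : ∀ y m .{{_ : ℕ.NonZero m}} → 0ℚ ≤ smoothTerm y m
      smoothTerm-nonneg y m = *-nonneg (mult-nonneg (localH-nonneg′ b) y m) (inv^-nonneg b m)

      -- For p ∣ m the right side vanishes too, by `mult-vanish`, so no indicator remains in the
      -- inner sums.
      smoothTerm-prime : ∀ {y} → Prime (suc y) → ∀ i m .{{_ : ℕ.NonZero m}} →
        χ (¬? (suc y ∣? m)) * smoothTerm (suc y) (suc y ℕ.^ i ℕ.* m) ≡ eulerCoeff (suc y) i * smoothTerm y m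
      smoothTerm-prime {y} pr i m = by-∣ (p ∣? m)
        where
        p = suc y
        by-∣ : (d : Dec (p ∣ m)) → χ (¬? d) * smoothTerm p (p ℕ.^ i ℕ.* m) ≡ eulerCoeff p i * smoothTerm y m
        by-∣ (yes p∣m) = trans (*-zeroˡ (smoothTerm p (p ℕ.^ i ℕ.* m))) (sym (trans
          (cong (λ z → eulerCoeff p i * (z * inv^ b m)) (mult-vanish (localH b) pr y m ℕ.≤-refl p∣m))
          (trans (cong (eulerCoeff p i *_) (*-zeroˡ (inv^ b m))) (*-zeroʳ (eulerCoeff p i)))))
        by-∣ (no p∤m) = trans (*-identityˡ (smoothTerm p (p ℕ.^ i ℕ.* m))) (trans
          (cong₂ _*_ (mult-prime (localH b) pr i p∤m)
            (trans (inv^-* b (p ℕ.^ i) m {{ℕ.m^n≢0 p i}}) (cong (λ k → inv (ι k) * inv^ b m) (ℕ.^-*-assoc p i b))))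
          (solve 4 (λ h g v w → h :* g :* (v :* w) := h :* v :* (g :* w)) refl
            (localH b p i) (mult (localH b) y m) (inv (ι (p ℕ.^ (i ℕ.* b)))) (inv^ b m)))

      smoothTerm-split : ∀ {y} → Prime (suc y) → ∀ E X →
        sum₁ X (smoothTerm (suc y)) ≡ sum E (λ i → eulerCoeff (suc y) i * sum₁ (quotPow (suc y) i X) (smoothTerm y))
          + sum₁ (quotPow (suc y) E X) (λ m → smoothTerm (suc y) (suc y ℕ.^ E ℕ.* m))
      smoothTerm-split {y} pr E X = trans (sum₁-split (suc y) E X (smoothTerm (suc y)))
        (cong (_+ sum₁ (quotPow (suc y) E X) (λ m → smoothTerm (suc y) (suc y ℕ.^ E ℕ.* m)))
          (sum-cong E (λ i → trans (sum-cong (quotPow (suc y) i X) (λ j → smoothTerm-prime pr i (suc j)))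
            (sum-*ˡ (quotPow (suc y) i X) (eulerCoeff (suc y) i) _))))

      factor-* : ∀ E p c → sum (suc E) (λ i → eulerCoeff p i * c) ≡ c * eulerFactor E p
      factor-* E p c = trans (sum-*ʳ (suc E) c (eulerCoeff p)) (*-comm (eulerFactor E p) c)

    -- An m ≤ X ≤ E has all its exponents below E + 1, because p^(E+1) > X; the truncated factors
    -- therefore miss nothing.
    smoothSum≤product : ∀ E y X → X ℕ.≤ E → sum₁ X (smoothTerm y) ≤ ratPrimeProduct (eulerFactor E) y
    smoothSum≤product E zero    zero    _   = 0≤1
    smoothSum≤product E zero    (suc X) _   = ≤-trans (≤-reflexive (sum-suc X (smoothTerm 0 ∘ suc)))
      (≤-trans (+-mono-≤ (≤-trans (≤-reflexive (*-identityˡ (inv^ b 1))) (inv-ι≤1 (1 ℕ.^ b)))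
                         (≤-reflexive (sum-zero X (λ i _ → *-zeroˡ (inv^ b (2 ℕ.+ i))))))
        (≤-reflexive (+-identityʳ 1ℚ)))
    smoothSum≤product E (suc y) X X≤E = by-prime (prime? (suc y))
      where
      by-prime : Dec (Prime (suc y)) → sum₁ X (smoothTerm (suc y)) ≤ ratPrimeProduct (eulerFactor E) (suc y)
      by-prime (no ¬pr) = subst₂ _≤_
        (sum-cong X (λ i → cong (_* inv^ b (suc i)) (sym (mult-nonprime (localH b) ¬pr (suc i)))))
        (sym (ratPrimeProduct-nonprime (eulerFactor E) ¬pr)) (smoothSum≤product E y X X≤E)
      by-prime (yes pr) = subst₂ _≤_ (sym (smoothTerm-split pr (suc E) X)) (sym (ratPrimeProduct-prime (eulerFactor E) pr))
        (≤-trans (≤-reflexive (trans (cong (λ k → S + sum₁ k (λ m → smoothTerm p (p ℕ.^ suc E ℕ.* m))) quot≡0) (+-identityʳ S)))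
          (≤-trans (sum-mono (suc E) (λ i _ → *-monoˡ (eulerCoeff p i) (coeff-nonneg pr i)
              (smoothSum≤product E y (quotPow p i X) (ℕ.≤-trans (quotPow-≤ p i X) X≤E))))
            (≤-reflexive (factor-* E p (ratPrimeProduct (eulerFactor E) y)))))
        where
        p = suc y
        S = sum (suc E) (λ i → eulerCoeff p i * sum₁ (quotPow p i X) (smoothTerm y))
        quot≡0 : quotPow p (suc E) X ≡ 0
        quot≡0 = ℕ.m<n⇒m/n≡0 {{ℕ.m^n≢0 p (suc E)}}
          (ℕ.<-trans (ℕ.s≤s X≤E) (n<p^n (prime≥2 pr) (suc E)))

    -- Expanding one more factor multiplies the numbers that occur by at most p^E, so the range
    -- grows from X to p^E X.
    product≤smoothSum : ∀ E y → ∃ λ X → ratPrimeProduct (eulerFactor E) y ≤ sum₁ X (smoothTerm y)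
    product≤smoothSum E zero    = 1 , ≤-reflexive (sym (trans (+-identityˡ (1ℚ * inv^ b 1)) (trans (*-identityˡ (inv^ b 1))
      (cong (inv ∘ ι) (ℕ.^-zeroˡ b)))))
    product≤smoothSum E (suc y) = by-prime (prime? (suc y))
      where
      X = proj₁ (product≤smoothSum E y)
      h = proj₂ (product≤smoothSum E y)
      by-prime : Dec (Prime (suc y)) → ∃ λ X′ → ratPrimeProduct (eulerFactor E) (suc y) ≤ sum₁ X′ (smoothTerm (suc y))
      by-prime (no ¬pr) = X , subst₂ _≤_ (sym (ratPrimeProduct-nonprime (eulerFactor E) ¬pr))
        (sum-cong X (λ i → cong (_* inv^ b (suc i)) (sym (mult-nonprime (localH b) ¬pr (suc i))))) h
      by-prime (yes pr) = X′ , subst₂ _≤_ (sym (ratPrimeProduct-prime (eulerFactor E) pr)) (sym (smoothTerm-split pr (suc E) X′))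
        (≤-trans (≤-reflexive (sym (factor-* E p (ratPrimeProduct (eulerFactor E) y))))
          (≤-trans (sum-mono (suc E) (λ i i<E → *-monoˡ (eulerCoeff p i) (coeff-nonneg pr i)
              (≤-trans h (sum-extend (λ j → smoothTerm-nonneg y (suc j))
                (≤-quotPow p i (ℕ.*-monoˡ-≤ X (ℕ.^-monoʳ-≤ p (ℕ.s≤s⁻¹ i<E))))))))
            (≤-+ʳ (sum-nonneg (quotPow p (suc E) X′) (λ j → smoothTerm-nonneg p (p ℕ.^ suc E ℕ.* suc j)
              {{ℕ.m*n≢0 (p ℕ.^ suc E) (suc j) {{ℕ.m^n≢0 p (suc E)}}}})))))
        where
        p = suc y
        X′ = p ℕ.^ E ℕ.* X

  module _ {b : ℕ} (2≤b : 2 ℕ.≤ b) where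

    private instance _ = b≢0 2≤b

    hSum≤product : ∀ E n → n ℕ.≤ E → hSum 2≤b n ≤ ratPrimeProduct (eulerFactor b E) n
    hSum≤product E n n≤E = ≤-trans
      (≤-reflexive (sum-cong-< n (λ i i<n → cong (_* inv^ b (suc i)) (sym (fullH-stable b n (suc i) i<n)))))
      (smoothSum≤product b E n n n≤E)

    product≤hSum : ∀ E n → ∃ λ X → ratPrimeProduct (eulerFactor b E) n ≤ hSum 2≤b X
    product≤hSum E n = X , ≤-trans (proj₂ (product≤smoothSum b E n)) (sum-mono X (λ i _ →
      *-monoʳ (inv^ b (suc i)) (inv^-nonneg b (suc i)) (mult-localH≤fullH b n (suc i))))
      where X = proj₁ (product≤smoothSum b E n)

    eulerFactor≡ : ∀ {p} → 2 ℕ.≤ p → ∀ E →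
      1ℚ + (ι (p ℕ.^ (b ℕ.+ 1)) - 1ℚ) * sum₁ E (localTerm b p) ≡ eulerFactor b E p
    eulerFactor≡ {p} 2≤p E = sym (trans (sum-suc E (eulerCoeff b p)) (cong₂ _+_
      (trans (cong (_* inv (ι 1)) (localH-zero b 2≤p)) (*-identityˡ (inv (ι 1))))
      (trans (sum-cong E (λ i → sym (localTerm≡localH b 2≤p (suc i)))) (sum-*ˡ E (ι (p ℕ.^ (b ℕ.+ 1)) - 1ℚ) _))))

  -- The logarithm and the final estimate

  c/n-small : ∀ c {ε} → 0ℚ < ε → ∃ λ N → ∀ n → N ℕ.≤ n → c * inv (ι n) ≤ ε
  c/n-small c {ε} 0<ε with arch (c * inv ε)
  ... | N , c/ε≤ = suc N , λ { n@(suc _) N<n → ≤-trans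
      (*-monoʳ (inv (ι n)) (inv-ι-nonneg n) (≤-trans (≤-reflexive (sym (*-inv-cancel c 0<ε)))
        (≤-trans (*-monoʳ ε (<⇒≤ 0<ε) (≤-trans c/ε≤ (ι-mono N<n))) (≤-reflexive (*-comm (ι n) ε)))))
      (≤-reflexive (*-cancel-inv ε (ι-pos′ n))) }

  module _ {s : ℕ → ℚ} (s-mono : ∀ {m n} → m ℕ.≤ n → s m ≤ s n) (c : ℚ)
           (s-tail : ∀ K M .{{_ : ℕ.NonZero M}} → s (K ℕ.+ M) ≤ s M + c * inv (ι M)) where

    -- For m < n monotonicity suffices, so m and n need not be ordered; this uniformity in m is what
    -- the Euler product uses later.
    tail-bound : ∀ m n .{{_ : ℕ.NonZero n}} → s m ≤ s n + c * inv (ι n)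
    tail-bound m n = ≤-trans (s-mono (ℕ.m≤m+n m n)) (s-tail m n)

    tail⇒cauchy : IsCauchy s
    tail⇒cauchy = toCauchy s λ ε 0<ε → let N , small = c/n-small c 0<ε in
      suc N , λ { m n@(suc _) _ (ℕ.s≤s N≤n) → ≤-trans (tail-bound m n) (+-monoʳ-≤ (s n) (small n (ℕ.m≤n⇒m≤1+n N≤n))) }

  hasSum₁-cauchy : ∀ a (c : IsCauchy (λ n → sum₁ n a)) → HasSum₁ a (mkℝ (λ n → sum₁ n a) c)
  hasSum₁-cauchy a c ε 0<ε = let N , close = c ε 0<ε in
    N , λ n N≤n ε′ 0<ε′ → N , λ m N≤m → ≤-trans (close n m N≤n N≤m) (≤-+ʳ (<⇒≤ 0<ε′))

  module _ (N : ℕ) where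

    private
      -- The endpoint N + 2 gives N + 1 unit steps, a positive number even for N = 0, as
      -- `Log.compare` requires.
      x = ι (2 ℕ.+ N)

      1≤x : 1ℚ ≤ x
      1≤x = ι-mono {1} {2 ℕ.+ N} (ℕ.s≤s ℕ.z≤n)

      x-1 : x - 1ℚ ≡ ι (suc N)
      x-1 = trans (cong (_- 1ℚ) (ι-suc (suc N))) (solve 1 (λ t → t :+ con 1ℚ :- con 1ℚ := t) refl (ι (suc N)))

      step≡1 : Log.step x (suc N) ≡ 1ℚ
      step≡1 = trans (cong (_* inv (ι (suc N))) x-1) (*-inv (ι-pos N))

      grid : Log.S x (suc N) ≡ harm (suc N)
      grid = trans (cong (λ h → sum (suc N) (λ i → h * inv (1ℚ + ι i * h))) step≡1)
        (sum-cong (suc N) (λ i → trans (*-identityˡ _) (cong inv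
          (trans (cong (λ z → 1ℚ + z) (*-identityʳ (ι i))) (trans (+-comm 1ℚ (ι i)) (sym (ι-suc i)))))))

      step≤1 : ∀ n → N ℕ.≤ n → Log.step x (suc n) ≤ 1ℚ
      step≤1 n N≤n = ≤-trans (≤-reflexive (cong (_* inv (ι (suc n))) x-1))
        (≤-trans (*-monoʳ (inv (ι (suc n))) (inv-ι-nonneg (suc n)) (ι-mono (ℕ.s≤s N≤n)))
          (≤-reflexive (*-inv (ι-pos n))))

    -- With N + 1 steps on [1 , N + 2] the left Riemann sum of 1/t is harm (N + 1).
    module _ {X : ℚ} (1≤X : 1ℚ ≤ X) (close : ℚ.∣ X - x ∣ ≤ ι 3) (n : ℕ) (N≤n : N ℕ.≤ n) where

      -- The 5 is made up of 3 for the distance from X to N + 2, 1 for the step width and 1 for the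
      -- last term of harm (N + 1).
      riemann≤harm : Log.S X (suc n) ≤ harm N + ι 5
      riemann≤harm = begin
        Log.S X (suc n)                       ≤⟨ Log.S-lip 1≤X 1≤x n ⟩
        Log.S x (suc n) + ℚ.∣ X - x ∣         ≤⟨ +-mono-≤ (Log.compare 1≤x n N) close ⟩
        Log.S x (suc N) + Log.step x (suc n) + ι 3
                                              ≤⟨ +-monoˡ-≤ (ι 3) (+-mono-≤ (≤-reflexive grid) (step≤1 n N≤n)) ⟩
        harm N + inv (ι (suc N)) + 1ℚ + ι 3   ≤⟨ +-monoˡ-≤ (ι 3) (+-monoˡ-≤ 1ℚ (+-monoʳ-≤ (harm N) (inv-ι≤1 (suc N)))) ⟩
        harm N + 1ℚ + 1ℚ + ι 3                ≡⟨ solve 1 (λ h → h :+ con 1ℚ :+ con 1ℚ :+ con (ι 3) := h :+ con (ι 5)) refl (harm N) ⟩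
        harm N + ι 5                          ∎
        where open ≤-Reasoning

      harm≤riemann : harm N ≤ Log.S X (suc n) + ι 5
      harm≤riemann = begin
        harm N                                ≤⟨ harm-mono (ℕ.n≤1+n N) ⟩
        harm (suc N)                          ≡⟨ grid ⟨
        Log.S x (suc N)                       ≤⟨ Log.compare 1≤x N n ⟩
        Log.S x (suc n) + Log.step x (suc N)  ≡⟨ cong (λ z → Log.S x (suc n) + z) step≡1 ⟩
        Log.S x (suc n) + 1ℚ                  ≤⟨ +-monoˡ-≤ 1ℚ (Log.S-lip 1≤x 1≤X n) ⟩
        Log.S X (suc n) + ℚ.∣ x - X ∣ + 1ℚ    ≤⟨ +-monoˡ-≤ 1ℚ (+-monoʳ-≤ (Log.S X (suc n)) (≤-trans (≤-reflexive (∣-∣-sym x X)) close)) ⟩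
        Log.S X (suc n) + ι 3 + 1ℚ            ≤⟨ ≤-+ʳ 0≤1 ⟩
        Log.S X (suc n) + ι 3 + 1ℚ + 1ℚ       ≡⟨ solve 1 (λ h → h :+ con (ι 3) :+ con 1ℚ :+ con 1ℚ := h :+ con (ι 5)) refl (Log.S X (suc n)) ⟩
        Log.S X (suc n) + ι 5                 ∎
        where open ≤-Reasoning

  module _ {b : ℕ} (2≤b : 2 ℕ.≤ b) where

    private
      instance _ = b≢0 2≤b

      Z P T : ℕ → ℚ
      Z = zSum 2≤b
      P = hSum 2≤b
      T = fSum 2≤b

      A : ℕ → ℚ
      A = meanSum 2≤b

    1≤zSum : ∀ n .{{_ : ℕ.NonZero n}} → 1ℚ ≤ Z n
    1≤zSum (suc n) = ≤-trans (≤-reflexive (sym (trans (+-identityˡ (zetaTerm b 1))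
      (cong (λ k → 1ℚ ÷₀ ι k) (ℕ.^-zeroˡ b))))) (zSum-mono 2≤b {1} {suc n} (ℕ.s≤s ℕ.z≤n))

    -- The n-th term of the sequence representing C_b, so that the real estimate unfolds to a
    -- rational one.
    constant : ℕ → ℚ
    constant n = inv (Z n) * P n

    private
      P-tail : ∀ m n .{{_ : ℕ.NonZero n}} → P m ≤ P n + ι 2 * inv (ι n)
      P-tail = tail-bound (hSum-mono 2≤b) (ι 2) (hSum-tail 2≤b)

      P-nonneg : ∀ n → 0ℚ ≤ P n
      P-nonneg n = hSum-mono 2≤b {0} {n} ℕ.z≤n

      P≤4 : ∀ n → P n ≤ ι 4
      -- 2 for the term m = 1 and 2/1 for the tail after it.
      P≤4 n = ≤-trans (P-tail n 1) (+-monoˡ-≤ (ι 2 * inv (ι 1)) P1≤2)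
        where
        P1≤2 : P 1 ≤ ι 2
        P1≤2 = ≤-trans (≤-reflexive (+-identityˡ (fullH b 1 * inv^ b 1)))
          (≤-trans (*-mono (fullH-nonneg b 1) (fullH≤2 b 2≤b 1) (inv^-nonneg b 1) (inv-ι≤1 (1 ℕ.^ b)))
            (≤-reflexive (*-identityʳ (ι 2))))

    module _ (n : ℕ) .{{_ : ℕ.NonZero n}} where

      private
        0<Z : 0ℚ < Z n
        0<Z = <-≤-trans 0<1 (1≤zSum n)

        C = constant n

        C*Z : C * Z n ≡ P n
        C*Z = trans (cong (_* Z n) (*-comm (inv (Z n)) (P n))) (*-inv-cancel (P n) 0<Z)

      constant-nonneg : 0ℚ ≤ C
      constant-nonneg = *-nonneg (inv-nonneg 0<Z) (P-nonneg n)

      constant≤4 : C ≤ ι 4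
      constant≤4 = ≤-trans (*-mono (inv-nonneg 0<Z) (inv≤1 (1≤zSum n)) (P-nonneg n) (P≤4 n)) (≤-reflexive (*-identityˡ (ι 4)))

      constant≤fSum : C ≤ T n
      constant≤fSum = ≤-*-cancelʳ 0<Z (≤-trans (≤-reflexive C*Z) (hSum≤fSum*zSum 2≤b n))

      -- Multiplied by Z n, the claim compares P at n² with P at n; the tail 2/n is absorbed because
      -- Z n ≥ 1.
      fSum≤constant : T n ≤ C + ι 2 * inv (ι n)
      fSum≤constant = ≤-*-cancelʳ 0<Z (begin
        T n * Z n                             ≤⟨ fSum*zSum≤hSum 2≤b n ⟩
        P (n ℕ.* n)                           ≤⟨ P-tail (n ℕ.* n) n ⟩
        P n + δ                               ≡⟨ cong₂ _+_ (sym C*Z) (sym (*-identityʳ δ)) ⟩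
        C * Z n + δ * 1ℚ                      ≤⟨ +-monoʳ-≤ (C * Z n) (*-monoˡ δ (*-nonneg (ι-nonneg 2) (inv-ι-nonneg n)) (1≤zSum n)) ⟩
        C * Z n + δ * Z n                     ≡⟨ *-distribʳ-+ (Z n) C δ ⟨
        (C + δ) * Z n                         ∎)
        where
        open ≤-Reasoning
        δ = ι 2 * inv (ι n)

    -- 4 · 5 is the bound for the constant times the distance between log and harm; the 2 bounds
    -- (2/n) harm N.
    meanSum-error : ℚ
    meanSum-error = errorBound 2≤b + (ι 4 * ι 5 + ι 2)

    -- N is fixed while n tends to infinity. The constant is known at index n only up to 2/n, and
    -- harm N ≤ N ≤ n keeps the resulting error at most 2.
    meanSum-estimate : ∀ N n .{{_ : ℕ.NonZero n}} → N ℕ.≤ n → ∀ L → L ≤ harm N + ι 5 → harm N ≤ L + ι 5 →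
                       ℚ.∣ A N - constant n * L ∣ ≤ meanSum-error
    meanSum-estimate N n N≤n L L≤ L≥ = ∣-∣-intro
      (begin
        A N                                             ≤⟨ meanSum≤ 2≤b n N N≤n ⟩
        T n * h                                         ≤⟨ *-monoʳ h (harm-nonneg N) (fSum≤constant n) ⟩
        (C + ι 2 * inv (ι n)) * h                       ≡⟨ solve 4 (λ C w i h → (C :+ w :* i) :* h := C :* h :+ w :* (h :* i)) refl C (ι 2) (inv (ι n)) h ⟩
        C * h + ι 2 * (h * inv (ι n))                   ≤⟨ +-mono-≤ (*-monoˡ C (constant-nonneg n) L≥) (*-monoˡ (ι 2) (ι-nonneg 2) h/n≤1) ⟩
        C * (L + ι 5) + ι 2 * 1ℚ                        ≡⟨ solve 4 (λ C L v w → C :* (L :+ v) :+ w :* con 1ℚ := C :* L :+ (C :* v :+ w)) refl C L (ι 5) (ι 2) ⟩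
        C * L + (C * ι 5 + ι 2)                         ≤⟨ +-monoʳ-≤ (C * L) (+-monoˡ-≤ (ι 2) C*5≤) ⟩
        C * L + (ι 4 * ι 5 + ι 2)                       ≤⟨ ≤-+ʳ 0≤E ⟩
        C * L + (ι 4 * ι 5 + ι 2) + E                   ≡⟨ solve 3 (λ x y z → x :+ y :+ z := x :+ (z :+ y)) refl (C * L) (ι 4 * ι 5 + ι 2) E ⟩
        C * L + meanSum-error                           ∎)
      (begin
        C * L                                           ≤⟨ *-monoˡ C (constant-nonneg n) L≤ ⟩
        C * (h + ι 5)                                   ≡⟨ *-distribˡ-+ C h (ι 5) ⟩
        C * h + C * ι 5                                 ≤⟨ +-mono-≤ (*-monoʳ h (harm-nonneg N) (constant≤fSum n)) C*5≤ ⟩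
        T n * h + ι 4 * ι 5                             ≤⟨ +-monoˡ-≤ (ι 4 * ι 5) (meanSum≥ 2≤b n N N≤n) ⟩
        A N + E + ι 4 * ι 5                             ≤⟨ ≤-+ʳ (ι-nonneg 2) ⟩
        A N + E + ι 4 * ι 5 + ι 2                       ≡⟨ solve 4 (λ a e v w → a :+ e :+ v :+ w := a :+ (e :+ (v :+ w))) refl (A N) E (ι 4 * ι 5) (ι 2) ⟩
        A N + meanSum-error                             ∎)
      where
      open ≤-Reasoning
      C = constant n
      h = harm N
      E = errorBound 2≤b
      0≤E : 0ℚ ≤ E
      0≤E = *-nonneg (*-nonneg (ι-nonneg 2) (ι-nonneg (suc b))) (ι-nonneg 3)
      C*5≤ : C * ι 5 ≤ ι 4 * ι 5
      C*5≤ = *-monoʳ (ι 5) (ι-nonneg 5) (constant≤4 n)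
      h/n≤1 : h * inv (ι n) ≤ 1ℚ
      h/n≤1 = ≤-trans (*-monoʳ (inv (ι n)) (inv-ι-nonneg n) (≤-trans (harm≤ι N) (ι-mono N≤n)))
        (≤-reflexive (*-inv (ι-pos′ n)))

  -- The real limits and the estimate for real x

  module _ {b : ℕ} (2≤b : 2 ℕ.≤ b) where

    private
      instance _ = b≢0 2≤b

    module _ {p : ℕ} (2≤p : 2 ℕ.≤ p) where

      private
        instance _ = ℕ.>-nonZero (ℕ.≤-trans (ℕ.s≤s ℕ.z≤n) 2≤p)

        Q-1 = ι (p ℕ.^ (b ℕ.+ 1)) - 1ℚ

        1≤Q-1 : 1ℚ ≤ Q-1
        1≤Q-1 = ≤-by (≤-trans (ι-mono 2≤p) (ι-mono (m≤m^n p (b ℕ.+ 1) {{ℕ.>-nonZero (ℕ.m≤n+m 1 b)}})))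
          (solve 1 (λ q → q :- con (ι 2) := q :- con 1ℚ :- con 1ℚ) refl (ι (p ℕ.^ (b ℕ.+ 1))))

        localTerm-nonneg : ∀ k → 0ℚ ≤ localTerm b p k
        localTerm-nonneg k = ≤-*-cancelʳ {0ℚ} {localTerm b p k} {Q-1} (<-≤-trans 0<1 1≤Q-1)
          (≤-trans (≤-reflexive (*-zeroˡ Q-1)) (≤-trans
            (*-nonneg (localH-nonneg b 2≤p k) (inv-ι-nonneg (p ℕ.^ (k ℕ.* b))))
            (≤-reflexive (trans (sym (localTerm≡localH b 2≤p k)) (*-comm Q-1 (localTerm b p k))))))

        localH≤2 : ∀ k → localH b p k ≤ ι 2
        localH≤2 k = ≤-*-cancelʳ 0<p²-1 (≤-trans (localH-bound b 2≤p 2≤b k) (≤-by 2≤p²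
          (solve 1 (λ s → s :- con (ι 2) := con (ι 2) :* (s :- con 1ℚ) :- s) refl (ι p * ι p))))
          where
          2≤p² : ι 2 ≤ ι p * ι p
          2≤p² = ≤-trans (ι-mono 2≤p) (≤-trans (≤-reflexive (sym (*-identityʳ (ι p))))
            (*-monoˡ (ι p) (ι-nonneg p) (ι-mono (ℕ.≤-trans (ℕ.s≤s ℕ.z≤n) 2≤p))))
          0<p²-1 : 0ℚ < ι p * ι p - 1ℚ
          0<p²-1 = <-≤-trans 0<1 (≤-by 2≤p² (solve 1 (λ s → s :- con (ι 2) := s :- con 1ℚ :- con 1ℚ) refl (ι p * ι p)))

        -- A crude comparison from Q - 1 ≥ 1, h_k(p) ≤ 2 and p^k ≥ k, enough for the tail bound of Σ
        -- k^-b to provide the modulus of convergence.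
        localTerm≤ : ∀ k .{{_ : ℕ.NonZero k}} → localTerm b p k ≤ ι 2 * inv^ b k
        localTerm≤ k = begin
          localTerm b p k                             ≡⟨ *-identityˡ (localTerm b p k) ⟨
          1ℚ * localTerm b p k                        ≤⟨ *-monoʳ (localTerm b p k) (localTerm-nonneg k) 1≤Q-1 ⟩
          Q-1 * localTerm b p k                       ≡⟨ localTerm≡localH b 2≤p k ⟩
          localH b p k * inv (ι (p ℕ.^ (k ℕ.* b)))    ≤⟨ *-mono (localH-nonneg b 2≤p k) (localH≤2 k) (inv-ι-nonneg (p ℕ.^ (k ℕ.* b)))
                                                          (inv-ι-anti {k ℕ.^ b} {p ℕ.^ (k ℕ.* b)} {{ℕ.m^n≢0 k b}}
                                                            (ℕ.≤-trans (ℕ.^-monoˡ-≤ b (ℕ.<⇒≤ (n<p^n 2≤p k))) (ℕ.≤-reflexive (ℕ.^-*-assoc p k b)))) ⟩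
          ι 2 * inv^ b k                              ∎
          where open ≤-Reasoning

        localSum-tail : ∀ K M .{{_ : ℕ.NonZero M}} → sum₁ (K ℕ.+ M) (localTerm b p) ≤ sum₁ M (localTerm b p) + ι 2 * inv (ι M)
        localSum-tail K M = ≤-trans (≤-reflexive (sum-++ K M (localTerm b p ∘ suc)))
          (+-monoʳ-≤ (sum₁ M (localTerm b p)) (≤-trans (sum-mono K (λ i _ → localTerm≤ (suc (i ℕ.+ M))))
            (≤-trans (≤-reflexive (sum-*ˡ K (ι 2) _)) (*-monoˡ (ι 2) (ι-nonneg 2) (sum-inv^ 2≤b K M)))))

      localSum-cauchy : IsCauchy (λ n → sum₁ n (localTerm b p))
      localSum-cauchy = tail⇒cauchy (sum-extend (λ i → localTerm-nonneg (suc i))) (ι 2) localSum-tail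

    -- Only the values at primes matter.
    localSum : ℕ → ℝ
    localSum 0 = 0ℝ
    localSum 1 = 0ℝ
    localSum p@(suc (suc _)) = mkℝ (λ n → sum₁ n (localTerm b p)) (localSum-cauchy (ℕ.s≤s (ℕ.s≤s ℕ.z≤n)))

    localSum-hasSum : ∀ p → Prime p → HasSum₁ (localTerm b p) (localSum p)
    localSum-hasSum 0 pr = contradiction pr ¬prime[0]
    localSum-hasSum 1 pr = contradiction pr ¬prime[1]
    localSum-hasSum p@(suc (suc _)) _ = hasSum₁-cauchy (localTerm b p) (localSum-cauchy (ℕ.s≤s (ℕ.s≤s ℕ.z≤n)))

    zeta : ℝ
    zeta = mkℝ (zSum 2≤b) (tail⇒cauchy (zSum-mono 2≤b) 1ℚ
      (λ K M → ≤-trans (zSum-tail 2≤b K M) (≤-reflexive (cong (λ z → zSum 2≤b M + z) (sym (*-identityˡ (inv (ι M))))))))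

    zeta-hasSum : HasSum₁ (zetaTerm b) zeta
    zeta-hasSum = hasSum₁-cauchy (zetaTerm b) (cauchy zeta)

    zeta-positive : 0ℝ <ℝ zeta
    zeta-positive = 1ℚ , 0<1 , 1 , λ { n@(suc _) _ → ≤-trans (≤-reflexive (+-identityˡ 1ℚ)) (1≤zSum 2≤b n) }

    -- Represented by the partial sums of Σ H_b(m^b)/m^b instead of partial products, since these
    -- sums have the tail bound and enter `constant`.
    eulerProduct : ℝ
    eulerProduct = mkℝ (hSum 2≤b) (tail⇒cauchy (hSum-mono 2≤b) (ι 2) (hSum-tail 2≤b))

    -- At an index E ≥ n the n-th partial product is at least P n, hence at least P E - 2/n. It is
    -- also at most P at some large argument, hence at most P E + 2/E, however large that argument
    -- is.
    eulerProduct-converges : HasPrimeProduct (λ p → localFactor b p (localSum p)) eulerProduct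
    eulerProduct-converges ε 0<ε = suc N , converges
      where
      N = proj₁ (c/n-small (ι 2) 0<ε)
      small = proj₂ (c/n-small (ι 2) 0<ε)
      P = hSum 2≤b
      F : ℕ → ℝ
      F p = localFactor b p (localSum p)
      P-tail : ∀ m n .{{_ : ℕ.NonZero n}} → P m ≤ P n + ι 2 * inv (ι n)
      P-tail = tail-bound (hSum-mono 2≤b) (ι 2) (hSum-tail 2≤b)
      seq-F : ∀ E {p} → Prime p → seq (F p) E ≡ eulerFactor b E p
      seq-F E {0} pr = contradiction pr ¬prime[0]
      seq-F E {1} pr = contradiction pr ¬prime[1]
      seq-F E {suc (suc _)} pr = eulerFactor≡ 2≤b (ℕ.s≤s (ℕ.s≤s ℕ.z≤n)) E
      converges : ∀ n → suc N ℕ.≤ n → ∣ primeProduct F n -ℝ eulerProduct ∣ℝ ≤ℝ fromℚ ε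
      converges n@(suc _) N<n ε′ 0<ε′ = n , estimate
        where
        estimate : ∀ E → n ℕ.≤ E → ℚ.∣ seq (primeProduct F n) E - P E ∣ ≤ ε + ε′
        estimate E@(suc _) n≤E = ≤-trans (subst (λ z → ℚ.∣ z - P E ∣ ≤ ε)
          (sym (seq-primeProduct F (eulerFactor b E) E (seq-F E) n))
          (∣-∣-intro
            (≤-trans (proj₂ (product≤hSum 2≤b E n)) (≤-trans (P-tail (proj₁ (product≤hSum 2≤b E n)) E)
              (+-monoʳ-≤ (P E) (small E (ℕ.≤-trans (ℕ.<⇒≤ N<n) n≤E)))))
            (≤-trans (P-tail E n) (+-mono-≤ (hSum≤product 2≤b E n n≤E) (small n (ℕ.<⇒≤ N<n))))))
          (≤-+ʳ (<⇒≤ 0<ε′))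

    meanSum-asymptotics : ∀ (x : ℝ) (1≤x : 1ℝ ≤ℝ x) N → fromℕ N ≤ℝ x → x <ℝ fromℕ (suc N) →
      ∣ fromℚ (meanSum 2≤b N) -ℝ recip zeta zeta-positive *ℝ eulerProduct *ℝ log x 1≤x ∣ℝ ≤ℝ fromℚ (meanSum-error 2≤b)
    -- The index exceeds N, as the rational estimate needs. Beyond M₁ the approximations of x are at
    -- least N - 1, beyond M₂ they are below N + 1.
    meanSum-asymptotics x 1≤x N N≤x (δ , 0<δ , M₂ , x<) ε 0<ε = suc N ℕ.⊔ (M₁ ℕ.⊔ M₂) , estimate
      where
      M₁ = proj₁ (N≤x 1ℚ 0<1)
      estimate : ∀ n → suc N ℕ.⊔ (M₁ ℕ.⊔ M₂) ℕ.≤ n →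
        ℚ.∣ meanSum 2≤b N - constant 2≤b n * Log.S (1ℚ ⊔ seq x n) n ∣ ≤ meanSum-error 2≤b + ε
      estimate zero h = contradiction (ℕ.≤-trans (ℕ.m≤m⊔n (suc N) (M₁ ℕ.⊔ M₂)) h) λ ()
      estimate n@(suc n-1) h = ≤-trans
        (meanSum-estimate 2≤b N n (ℕ.m≤n⇒m≤1+n N≤n-1) (Log.S X n)
          (riemann≤harm N 1≤X close n-1 N≤n-1) (harm≤riemann N 1≤X close n-1 N≤n-1))
        (≤-+ʳ (<⇒≤ 0<ε))
        where
        N≤n-1 : N ℕ.≤ n-1
        N≤n-1 = ℕ.s≤s⁻¹ (ℕ.m⊔n≤o⇒m≤o (suc N) (M₁ ℕ.⊔ M₂) h)
        M≤n = ℕ.m⊔n≤o⇒n≤o (suc N) (M₁ ℕ.⊔ M₂) h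
        xₙ = seq x n
        X = 1ℚ ⊔ xₙ
        1≤X : 1ℚ ≤ X
        1≤X = p≤p⊔q 1ℚ xₙ
        lower : ι N ≤ xₙ + 1ℚ
        lower = proj₂ (N≤x 1ℚ 0<1) n (ℕ.m⊔n≤o⇒m≤o M₁ M₂ M≤n)
        upper : xₙ ≤ ι (suc N)
        upper = ≤-trans (≤-+ʳ (<⇒≤ 0<δ)) (x< n (ℕ.m⊔n≤o⇒n≤o M₁ M₂ M≤n))
        -- The 3 is the gap 2 between N and N + 2 plus the tolerance 1 in `lower`.
        close : ℚ.∣ X - ι (2 ℕ.+ N) ∣ ≤ ι 3
        close = ∣-∣-intro
          (≤-trans (⊔-lub (ι-mono {1} {2 ℕ.+ N} (ℕ.s≤s ℕ.z≤n)) (≤-trans upper (ι-mono (ℕ.n≤1+n (suc N))))) (≤-+ʳ (ι-nonneg 3)))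
          (begin
            ι (2 ℕ.+ N)             ≡⟨ trans (ι-suc (suc N)) (cong (_+ 1ℚ) (ι-suc N)) ⟩
            ι N + 1ℚ + 1ℚ           ≤⟨ +-monoˡ-≤ 1ℚ (+-monoˡ-≤ 1ℚ lower) ⟩
            xₙ + 1ℚ + 1ℚ + 1ℚ       ≡⟨ solve 1 (λ x → x :+ con 1ℚ :+ con 1ℚ :+ con 1ℚ := x :+ con (ι 3)) refl xₙ ⟩
            xₙ + ι 3                ≤⟨ +-monoˡ-≤ (ι 3) (p≤q⊔p 1ℚ xₙ) ⟩
            X + ι 3                 ∎)
          where open ≤-Reasoning

open HarmonicMean
open import Data.Nat.Base using (ℕ; suc; _≤_)
open import Data.Nat.Primality using (Prime)
open import Data.Product.Base using (Σ; _×_; _,_)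

theorem1p4 : ∀ (b : ℕ) → 2 ≤ b →
    Σ ℝ λ ζb → Σ (0ℝ <ℝ ζb) λ ζb>0 → Σ (ℕ → ℝ) λ S → Σ ℝ λ P →
    HasSum₁ (zetaTerm b) ζb
    × (∀ p → Prime p → HasSum₁ (localTerm b p) (S p))
    × HasPrimeProduct (λ p → localFactor b p (S p)) P
    × (let C = recip ζb ζb>0 *ℝ P in
    Σ ℝ λ K → Σ ℝ λ x₀ →
    ∀ (x : ℝ) (1≤x : 1ℝ ≤ℝ x) → x₀ ≤ℝ x →
    ∀ (N : ℕ) → fromℕ N ≤ℝ x → x <ℝ fromℕ (suc N) →
    ∣ fromℚ (sum₁ N (λ n → H b n ÷₀ ι n)) -ℝ C *ℝ log x 1≤x ∣ℝ ≤ℝ K)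
theorem1p4 b 2≤b = zeta 2≤b , zeta-positive 2≤b , localSum 2≤b , eulerProduct 2≤b ,
  zeta-hasSum 2≤b , localSum-hasSum 2≤b , eulerProduct-converges 2≤b ,
  fromℚ (meanSum-error 2≤b) , 1ℝ , λ x 1≤x _ → meanSum-asymptotics 2≤b x 1≤x
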